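{- Let $V$ and $U$ be finite digraphs, potentially with cycles, whose nodes are coloured white or gray and whose gray nodes have outdegree at most $1$. Let $G=(V,x)$ and $H=(U,y)$ be two games with $x$ and $y$ white nodes. Then the Grundy value $\mathcal G(G+H)$ of the disjunctive sum is obtained from $\mathcal G(G)$ (row) and $\mathcal G(H)$ (column) by the following table: $$\begin{array}{c|ccccc} + & \mathrm{Full} & \infty_{\mathbf D'} & \mathrm{Moon}_{\mathbf F'} & \mathrm{Nym}_{f'} & n'\\ \hline \mathrm{Full} & \mathrm{Full} & \mathrm{Full} & \mathrm{Full} & \mathrm{Full} & \mathrm{Full}\\ \infty_{\mathbf D} & \mathrm{Full} & \infty_{\emptyset} & \infty_{\mathbf D\oplus\mathbf F'} & \infty_{f'\oplus\mathbf D} & \infty_{n'\oplus\mathbf D}\\ \mathrm{Moon}_{\mathbf F} & \mathrm{Full} & \infty_{\mathbf F\oplus\mathbf D'} & \mathrm{Moon}_{\mathbf F\oplus\mathbf F'} & \mathrm{Moon}_{f'\oplus\mathbf F} & \mathrm{Moon}_{n'\oplus\mathbf F}\\ \mathrm{Nym}_{f} & \mathrm{Full} & \infty_{f\oplus\mathbf D'} & \mathrm{Moon}_{f\oplus\mathbf F'} & \mathrm{Nym}_{f\oplus f'} & \mathrm{Nym}_{f\oplus n'}\\ n & \mathrm{Full} & \infty_{n\oplus\mathbf D'} & \mathrm{Moon}_{n\oplus\mathbf F'} & \mathrm{Nym}_{n\oplus f'} & n\oplus n' \end{array}$$ Here $n,n',f,f'\in\mathbb Z_0^+$, and $\mathbf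 D,\mathbf F,\mathbf D',\mathbf F'$ are subsets of $\mathbb Z_0^+$ (the subscripts of the Grundy values of $G$ and $H$).
   Context: $\mathbb Z_0^{+}$ denotes the nonnegative integers. $\oplus$ on $\mathbb Z_0^+$ is nim-sum (bitwise XOR of binary expansions); for $m\in\mathbb Z_0^+$ and sets $S,S'\subseteq\mathbb Z_0^+$, $m\oplus S=\{m\oplus s:s\in S\}$ and $S\oplus S'=\{s\oplus s':s\in S,s'\in S'\}$ (empty if $S$ or $S'$ is empty). A game is a pair $G=(V,x)$, where $x$ is a node of the digraph $V$ (the location of a piece). The options of $G$ are the games $G'=(V,x')$ with an arc from $x$ to $x'$; $G'$ denotes a generic option of $G$ and $G''$ a generic option of $G'$. An option is white or gray according to the colour of its node. A node is terminal if it has no outgoing arcs. $\mathrm{mex}(S)$ is the least nonnegative integer not in $S$. Disjunctive sum. The cartproduct $V\ast U$ is the digraph whose nodes are the pairs $(x,y)\in V\times U$ with $x,y$ not both gray, and in which there is an arc from $(x,y)$ to $(x^*,y^*)$ if and only if either $\langle x,x^*\rangle$ is an arc of $V$ and $y=y^*$ is white, or $\langle y,y^*\rangle$ is an arc of $U$ and $x=x^*$ is white. A node $(x,y)$ of $V\ast U$ is gray if one of $x,y$ is gray, and white if both are white. For $G=(V,x)$ and $H=(U,y)$ with $x,y$ not both gray, $G+H=(V\ast U,(x,y))$. Labels. At step $n$ of the algorithm below, applied to a finite digraph $V$ whose gray nodes have outdegree at most $1$, a game $G=(V,x)$ with $x$ white has a label $\mathcal G_n(G)\in\mathbb Z_0^+\cup\{\mathrm{Full},\mathrm{Moon},\infty\}$,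 and a game $G=(V,x)$ with $x$ gray has a label $\mathcal C_n(G)$ which is $\mathrm{New}$, $\mathrm{Full}$, $\infty$, or a subset of $\mathbb Z_0^+$ that is finite or has finite complement. Here $\mathrm{Full}$ (full moon), $\mathrm{New}$ (new moon) and $\mathrm{Moon}$ are formal symbols, and the label $\infty$ means "unassigned". Function Cr (evaluated with the step-$n$ labels). For $k\in\mathbb Z_0^+$ and $G=(V,x)$ with $x$ gray: if $x$ is terminal, $\mathrm{Cr}(G,k)=\textsc{true}$. Otherwise $\mathrm{Cr}(G,k)=\textsc{true}$ if every option $G'$ of $G$ falls into one of the cases: (i) $G'$ is white and $\mathcal G_n(G')\in\{\mathrm{Moon},\mathrm{Full}\}\cup(\mathbb Z_0^+\setminus\{k\})$; (ii) $G'$ has a white option $G''$ with $\mathcal G_n(G'')=k$; (iii) $G'$ has a gray option $G''$ with $\mathrm{Cr}(G'',k)=\textsc{true}$. In all other cases, including when the recursive evaluation does not reach $\textsc{true}$ because of an infinite run, $\mathrm{Cr}(G,k)=\textsc{false}$. Algorithm. Step 0. For white $x$: $\mathcal G_0(G)=0$ if $x$ is terminal and $\infty$ otherwise. For gray $x$: $\mathcal C_0(G)=\mathrm{New}$ if $x$ is terminal and $\infty$ otherwise. Step $n+1$. For every node $x$ with $G=(V,x)$ (a label to which no rule below applies is kept unchanged): White $x$: if $G$ has a gray option $G'$ with $\mathcal C_n(G')=\mathrm{New}$, then $\mathcal G_{n+1}(G)=\mathrm{Full}$. Otherwise let $D$ be the set of labels $\mathcal G_n(G')$ of white options $G'$ with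 $\mathcal G_n(G')\in\mathbb Z_0^+$, and let $P$ be the union of the sets $\mathcal C_n(G')$ over gray options $G'$ that are assigned and not labelled $\mathrm{Full}$. If $\mathbb Z_0^+\subseteq D\cup P$, then $\mathcal G_{n+1}(G)=\mathrm{Moon}$. Otherwise let $m=\mathrm{mex}(D\cup P)$; if for every unassigned option $G'$ of $G$ there is a white option $G''$ of $G'$ with $\mathcal G_n(G'')=m$ or a gray option $G''$ of $G'$ with $\mathrm{Cr}(G'',m)=\textsc{true}$, then $\mathcal G_{n+1}(G)=m$. Gray $x$ whose unique option $G'$ is white: if $\mathcal G_n(G')=\mathrm{Full}$, then $\mathcal C_{n+1}(G)=\mathrm{New}$; if $\mathcal G_n(G')=k\in\mathbb Z_0^+$, then $\mathcal C_{n+1}(G)=\mathbb Z_0^+\setminus\{k\}$; if $\mathcal G_n(G')=\mathrm{Moon}$, then $\mathcal C_{n+1}(G)=\mathbb Z_0^+$. Gray $x$ whose unique option $G'$ is gray: if $\mathcal C_n(G')=\mathrm{Full}$, then $\mathcal C_{n+1}(G)=\mathrm{New}$; if $\mathcal C_n(G')=\mathrm{New}$, then $\mathcal C_{n+1}(G)=\mathrm{Full}$; if $\mathcal C_n(G')=F$ (finite set), then $\mathcal C_{n+1}(G)=\mathbb Z_0^+\setminus F$; if $\mathcal C_n(G')=\mathbb Z_0^+\setminus F$ ($F$ finite), then $\mathcal C_{n+1}(G)=F$. Ending condition: if $\mathcal G_{n+1}(G)=\mathcal G_n(G)$ and $\mathcal C_{n+1}(G)=\mathcal C_n(G)$ for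 all $G=(V,x)$, the algorithm ends, at step $t=n+1$. Direct and forcing values. For any $G=(V,x)$, the sets $\mathbf D(G),\mathbf F(G)\subseteq\mathbb Z_0^+$ are defined inductively (as the smallest sets satisfying the following rules, where $\mathcal G(\cdot)=k$ means that the final label is the integer $k$). Direct values: if $G$ has a white option $G'$ with $\mathcal G(G')=k$, then $k\in\mathbf D(G)$; if $G$ has a gray option $G'$ such that $k\in\mathbf D(G'')$ for every option $G''$ of $G'$, then $k\in\mathbf D(G)$. Forcing values: if $G$ has a gray option $G'$ with a white option $G''$ such that $\mathcal G(G'')=k$, then $k\in\mathbf F(G)$; if $G$ has a gray option $G'$ with an option $G''$ (of either colour) such that $k\in\mathbf F(G'')$, then $k\in\mathbf F(G)$. Grundy value. For white $x$ and final step $t$: $\mathcal G(G)=\mathcal G_t(G)$ if $\mathcal G_t(G)\in\mathbb Z_0^+\cup\{\mathrm{Full}\}$; $\mathcal G(G)=\mathrm{Moon}_{\mathbf F(G)}$ if $\mathcal G_t(G)=\mathrm{Moon}$; $\mathcal G(G)=\mathrm{Nym}_f$ ("nymphet $f$") if $\mathcal G_t(G)=\infty$ and $\mathbf F(G)=\{f\}$; $\mathcal G(G)=\infty_{\mathbf D(G)}$ if $\mathcal G_t(G)=\infty$ and $\mathbf F(G)=\emptyset$. The paper asserts that when $\mathcal G_t(G)=\infty$ the set $\mathbf F(G)$ has at most one element, so that these cases are exhaustive. The Grundy value of $G+H$ is the one obtained by applying the algorithm to $V\ast U$. -}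

module Defs where

open import Level using (0ℓ)
open import Data.Nat.Base using (ℕ; zero; suc; _+_; _*_; _/_; _%_; _<_)
open import Data.List.Base using (List; []; [_]; cartesianProduct; mapMaybe)
open import Data.List.Membership.Propositional using (_∈_; _∉_)
open import Data.List.Membership.Propositional.Properties using (∈-cartesianProduct⁺)
open import Data.List.Relation.Unary.Any as Any using ()
open import Data.List.Relation.Unary.Any.Properties using (map⁺; mapMaybe⁺)
open import Data.Maybe.Base using (Maybe; just; nothing)
open import Data.Maybe.Relation.Unary.Any as Maybe using ()
open import Data.Product using (Σ; ∃-syntax; _×_; _,_)
open import Data.Sum using (_⊎_; inj₁; inj₂)
open import Data.Empty using (⊥)
open import Data.Empty.Irrelevant using (⊥-elim)
open import Relation.Nullary using (¬_; yes; no; ¬?; _×-dec_; _⊎-dec_)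
open import Relation.Unary as Pred using (Pred; _∪_; _≐_; ｛_｝; ∅)
open import Relation.Binary.Definitions using (Decidable; DecidableEquality)
open import Relation.Binary.PropositionalEquality using (_≡_; refl; sym; trans; cong)

infixl 6 _⊕_ _⊕ᵐ_ _⊕ˢ_ _⊞_
infix  4 _∈ᶜ_

-- Bitwise exclusive or of the `fuel` lowest binary digits.
xorBits : (fuel m n : ℕ) → ℕ
xorBits zero       m n = 0
xorBits (suc fuel) m n = (m % 2 + n % 2) % 2 + 2 * xorBits fuel (m / 2) (n / 2)

-- Neither m nor n has more than m + n binary digits.
_⊕_ : ℕ → ℕ → ℕ
m ⊕ n = xorBits (m + n) m n

_⊕ᵐ_ : ℕ → Pred ℕ 0ℓ → Pred ℕ 0ℓ
(m ⊕ᵐ S) k = ∃[ s ] S s × k ≡ m ⊕ s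

_⊕ˢ_ : Pred ℕ 0ℓ → Pred ℕ 0ℓ → Pred ℕ 0ℓ
(S ⊕ˢ S′) k = ∃[ s ] ∃[ s′ ] S s × S′ s′ × k ≡ s ⊕ s′

IsMex : ℕ → Pred ℕ 0ℓ → Set
IsMex m S = ¬ S m × (∀ k → k < m → S k)

data Colour : Set where
  white gray : Colour

_≟ᶜ_ : DecidableEquality Colour
white ≟ᶜ white = yes refl
white ≟ᶜ gray  = no λ ()
gray  ≟ᶜ white = no λ ()
gray  ≟ᶜ gray  = yes refl

-- Finite digraphs whose nodes are white or gray and whose gray nodes have
-- outdegree at most 1.  Cycles and loops are allowed.
record Digraph : Set₁ where
  infix 4 _⟶_
  field
    Node            : Set
    _≟_             : DecidableEquality Node
    nodes           : List Node
    nodes-complete  : ∀ x → x ∈ nodes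
    _⟶_             : Node → Node → Set
    _⟶?_            : Decidable _⟶_
    colour          : Node → Colour
    gray-outdegree≤1 : ∀ {x y z} → colour x ≡ gray → x ⟶ y → x ⟶ z → y ≡ z

  White Gray Terminal : Node → Set
  White x    = colour x ≡ white
  Gray x     = colour x ≡ gray
  Terminal x = ∀ y → ¬ (x ⟶ y)

Game : Set₁
Game = Σ Digraph Digraph.Node

mix : Colour → Colour → Colour
mix white white = white
mix white gray  = gray
mix gray  _     = gray

module Cartproduct (V U : Digraph) where
  private
    module V = Digraph V
    module U = Digraph U

  NotBothGray : V.Node → U.Node → Set
  NotBothGray x y = ¬ (V.Gray x × U.Gray y)

  -- The last field is irrelevant, so a pair (x , y) gives at most one node.
  record Pair : Set where
    constructor pair
    field
      left         : V.Node
      right        : U.Node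
      .notBothGray : NotBothGray left right

  open Pair

  _≟ᵖ_ : DecidableEquality Pair
  pair x y p ≟ᵖ pair x′ y′ p′ with x V.≟ x′ | y U.≟ y′
  ... | yes refl | yes refl = yes refl
  ... | no x≢x′  | _        = no λ eq → x≢x′ (cong left eq)
  ... | _        | no y≢y′  = no λ eq → y≢y′ (cong right eq)

  toPair : V.Node × U.Node → Maybe Pair
  toPair (x , y) with ¬? ((V.colour x ≟ᶜ gray) ×-dec (U.colour y ≟ᶜ gray))
  ... | yes p = just (pair x y p)
  ... | no  _ = nothing

  pairs : List Pair
  pairs = mapMaybe toPair (cartesianProduct V.nodes U.nodes)

  pairs-complete : ∀ q → q ∈ pairs
  pairs-complete q@(pair x y p) =
    mapMaybe⁺ toPair _ (map⁺ (Any.map (λ where refl → found)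
      (∈-cartesianProduct⁺ (V.nodes-complete x) (U.nodes-complete y))))
    where
    found : Maybe.Any (q ≡_) (toPair (x , y))
    found with ¬? ((V.colour x ≟ᶜ gray) ×-dec (U.colour y ≟ᶜ gray))
    ... | yes _  = Maybe.just refl
    ... | no ¬p = ⊥-elim (¬p p)

  Arc : Pair → Pair → Set
  Arc q q* =
      (left q V.⟶ left q* × right q ≡ right q* × U.White (right q))
    ⊎ (right q U.⟶ right q* × left q ≡ left q* × V.White (left q))

  arc? : Decidable Arc
  arc? q q* =
    ((left q V.⟶? left q*) ×-dec (right q U.≟ right q*)
      ×-dec (U.colour (right q) ≟ᶜ white))
    ⊎-dec
    ((right q U.⟶? right q*) ×-dec (left q V.≟ left q*)
      ×-dec (V.colour (left q) ≟ᶜ white))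

  colourᵖ : Pair → Colour
  colourᵖ q = mix (V.colour (left q)) (U.colour (right q))

  private
    pair-≡ : ∀ {q q* : Pair} → left q ≡ left q* → right q ≡ right q* → q ≡ q*
    pair-≡ refl refl = refl

    gray≢white : ∀ {c} → c ≡ gray → c ≡ white → ⊥
    gray≢white refl ()

    mix-white : ∀ {c d} → c ≡ white → d ≡ white → mix c d ≡ white
    mix-white refl refl = refl

    grayˡ : ∀ {c d} → mix c d ≡ gray → d ≡ white → c ≡ gray
    grayˡ {gray} _ _ = refl
    grayˡ {white} {gray} _ ()

    grayʳ : ∀ {c d} → mix c d ≡ gray → c ≡ white → d ≡ gray
    grayʳ {white} {gray} _ _ = refl

  arc-unique : ∀ {q r s} → colourᵖ q ≡ gray → Arc q r → Arc q s → r ≡ s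
  arc-unique g (inj₁ (a , e , w)) (inj₁ (b , e′ , _)) =
    pair-≡ (V.gray-outdegree≤1 (grayˡ g w) a b) (trans (sym e) e′)
  arc-unique g (inj₂ (a , e , w)) (inj₂ (b , e′ , _)) =
    pair-≡ (trans (sym e) e′) (U.gray-outdegree≤1 (grayʳ g w) a b)
  arc-unique g (inj₁ (_ , _ , w)) (inj₂ (_ , _ , w′)) with () ← gray≢white g (mix-white w′ w)
  arc-unique g (inj₂ (_ , _ , w)) (inj₁ (_ , _ , w′)) with () ← gray≢white g (mix-white w w′)

_∗_ : Digraph → Digraph → Digraph
V ∗ U = record
  { Node             = Pair
  ; _≟_              = _≟ᵖ_
  ; nodes            = pairs
  ; nodes-complete   = pairs-complete
  ; _⟶_              = Arc
  ; _⟶?_             = arc?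
  ; colour           = colourᵖ
  ; gray-outdegree≤1 = λ {q} {r} {s} → arc-unique {q} {r} {s}
  }
  where open Cartproduct V U

disjunctiveSum : (G H : Game) →
  let (V , x) = G ; (U , y) = H in .(Cartproduct.NotBothGray V U x y) → Game
disjunctiveSum (V , x) (U , y) p = V ∗ U , Cartproduct.pair x y p

white⇒notBothGray : ∀ V U {x y} → Digraph.White V x → Cartproduct.NotBothGray V U x y
white⇒notBothGray V U w (g , _) with () ← trans (sym w) g

data WhiteLabel : Set where
  int       : ℕ → WhiteLabel
  Full Moon : WhiteLabel
  ∞         : WhiteLabel

-- finite F is the set of the members of F and cofinite F its complement.
-- The algorithm only ever produces lists with at most one member, so
-- propositional equality of these labels is equality of the sets.
data GrayLabel : Set where
  New Full        : GrayLabel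
  finite cofinite : List ℕ → GrayLabel
  ∞               : GrayLabel

_∈ᶜ_ : ℕ → GrayLabel → Set
k ∈ᶜ finite F   = k ∈ F
k ∈ᶜ cofinite F = k ∉ F
k ∈ᶜ New        = ⊥
k ∈ᶜ Full       = ⊥
k ∈ᶜ ∞          = ⊥

module Algorithm (V : Digraph) where
  open Digraph V

  -- 𝒢 is only used at white nodes and 𝒞 only at gray nodes; their values
  -- elsewhere are irrelevant and are left unconstrained.
  record Labelling : Set where
    field
      𝒢 : Node → WhiteLabel
      𝒞 : Node → GrayLabel

  module _ (L : Labelling) where
    open Labelling L

    -- Being inductive, Cr k x is false if its evaluation runs forever.  A
    -- terminal gray x satisfies Cr k x, the condition on options being vacuous.
    mutual
      data Cr (k : ℕ) : Node → Set where
        cr : ∀ {x} → Gray x → (∀ x′ → x ⟶ x′ → CrOption k x′) → Cr k x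

      data CrOption (k : ℕ) : Node → Set where
        white-Moon : ∀ {x′} → White x′ → 𝒢 x′ ≡ Moon → CrOption k x′
        white-Full : ∀ {x′} → White x′ → 𝒢 x′ ≡ Full → CrOption k x′
        white-int  : ∀ {x′ j} → White x′ → 𝒢 x′ ≡ int j → ¬ (j ≡ k) → CrOption k x′
        to-white   : ∀ {x′ x″} → x′ ⟶ x″ → White x″ → 𝒢 x″ ≡ int k → CrOption k x′
        to-gray    : ∀ {x′ x″} → x′ ⟶ x″ → Gray x″ → Cr k x″ → CrOption k x′

    NewOption : Node → Set
    NewOption x = ∃[ x′ ] x ⟶ x′ × Gray x′ × 𝒞 x′ ≡ New

    D P : Node → Pred ℕ 0ℓ
    D x k = ∃[ x′ ] x ⟶ x′ × White x′ × 𝒢 x′ ≡ int k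
    P x k = ∃[ x′ ] x ⟶ x′ × Gray x′ × k ∈ᶜ 𝒞 x′

    Unassigned : Node → Set
    Unassigned x = (White x × 𝒢 x ≡ ∞) ⊎ (Gray x × 𝒞 x ≡ ∞)

    Reverts : ℕ → Node → Set
    Reverts m x′ = ∃[ x″ ] x′ ⟶ x″ × ((White x″ × 𝒢 x″ ≡ int m) ⊎ (Gray x″ × Cr m x″))

    -- WhiteRule x ℓ (GrayRule x ℓ): some rule gives x the label ℓ at the next step.
    data WhiteRule (x : Node) : WhiteLabel → Set where
      full : NewOption x → WhiteRule x Full
      moon : ¬ NewOption x → Pred.Universal (D x ∪ P x) → WhiteRule x Moon
      mex  : ∀ {m} → ¬ NewOption x → IsMex m (D x ∪ P x) →
             (∀ x′ → x ⟶ x′ → Unassigned x′ → Reverts m x′) →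
             WhiteRule x (int m)

    data GrayRule (x : Node) : GrayLabel → Set where
      white-Full    : ∀ {x′} → x ⟶ x′ → White x′ → 𝒢 x′ ≡ Full → GrayRule x New
      white-int     : ∀ {x′ k} → x ⟶ x′ → White x′ → 𝒢 x′ ≡ int k → GrayRule x (cofinite [ k ])
      white-Moon    : ∀ {x′} → x ⟶ x′ → White x′ → 𝒢 x′ ≡ Moon → GrayRule x (cofinite [])
      gray-Full     : ∀ {x′} → x ⟶ x′ → Gray x′ → 𝒞 x′ ≡ Full → GrayRule x New
      gray-New      : ∀ {x′} → x ⟶ x′ → Gray x′ → 𝒞 x′ ≡ New → GrayRule x Full
      gray-finite   : ∀ {x′ F} → x ⟶ x′ → Gray x′ → 𝒞 x′ ≡ finite F → GrayRule x (cofinite F)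
      gray-cofinite : ∀ {x′ F} → x ⟶ x′ → Gray x′ → 𝒞 x′ ≡ cofinite F → GrayRule x (finite F)

    -- Direct and Forcing are meant for the final labelling L.
    data Direct (k : ℕ) (x : Node) : Set where
      via-white : ∀ {x′} → x ⟶ x′ → White x′ → 𝒢 x′ ≡ int k → Direct k x
      via-gray  : ∀ {x′} → x ⟶ x′ → Gray x′ → (∀ x″ → x′ ⟶ x″ → Direct k x″) → Direct k x

    data Forcing (k : ℕ) (x : Node) : Set where
      here  : ∀ {x′ x″} → x ⟶ x′ → Gray x′ → x′ ⟶ x″ → White x″ → 𝒢 x″ ≡ int k → Forcing k x
      later : ∀ {x′ x″} → x ⟶ x′ → Gray x′ → x′ ⟶ x″ → Forcing k x″ → Forcing k x

    𝐃 𝐅 : Node → Pred ℕ 0ℓ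
    𝐃 x k = Direct k x
    𝐅 x k = Forcing k x

  open Labelling

  record Initial (L : Labelling) : Set where
    field
      white-terminal    : ∀ {x} → White x → Terminal x → 𝒢 L x ≡ int 0
      white-nonterminal : ∀ {x} → White x → ¬ Terminal x → 𝒢 L x ≡ ∞
      gray-terminal     : ∀ {x} → Gray x → Terminal x → 𝒞 L x ≡ New
      gray-nonterminal  : ∀ {x} → Gray x → ¬ Terminal x → 𝒞 L x ≡ ∞

  -- The label `new` comes from a rule, or no rule applies and it equals `old`.
  Update : {A : Set} → (A → Set) → A → A → Set
  Update Rule old new = Rule new ⊎ ((∀ ℓ → ¬ Rule ℓ) × new ≡ old)

  record Step (L L′ : Labelling) : Set where
    field
      white-step : ∀ {x} → White x → Update (WhiteRule L x) (𝒢 L x) (𝒢 L′ x)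
      gray-step  : ∀ {x} → Gray x → Update (GrayRule L x) (𝒞 L x) (𝒞 L′ x)

  data AtStep : ℕ → Labelling → Set where
    start : ∀ {L} → Initial L → AtStep 0 L
    next  : ∀ {n L L′} → AtStep n L → Step L L′ → AtStep (suc n) L′

  record Unchanged (L L′ : Labelling) : Set where
    field
      white-unchanged : ∀ {x} → White x → 𝒢 L′ x ≡ 𝒢 L x
      gray-unchanged  : ∀ {x} → Gray x → 𝒞 L′ x ≡ 𝒞 L x

  -- The labels at a step t = n + 1 where the ending condition holds.  Rules
  -- depend only on the current labels, so once the condition holds the labels
  -- stay the same for ever, and it does not matter which such t is taken.
  Final : Labelling → Set
  Final L = ∃[ n ] ∃[ L₀ ] AtStep n L₀ × Step L₀ L × Unchanged L₀ L

data Value : Set₁ where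
  Full    : Value
  ∞[_]    : Pred ℕ 0ℓ → Value
  Moon[_] : Pred ℕ 0ℓ → Value
  Nym     : ℕ → Value
  int     : ℕ → Value

-- The Grundy value read off from the final labelling L at a white node x.
-- Subscripts are determined up to extensional equality of sets.
data ReadsAs {V : Digraph} (L : Algorithm.Labelling V) (x : Digraph.Node V) : Value → Set₁ where
  full : Algorithm.Labelling.𝒢 L x ≡ Full → ReadsAs L x Full
  int  : ∀ {n} → Algorithm.Labelling.𝒢 L x ≡ int n → ReadsAs L x (int n)
  moon : ∀ {F} → Algorithm.Labelling.𝒢 L x ≡ Moon → Algorithm.𝐅 V L x ≐ F →
         ReadsAs L x Moon[ F ]
  nym  : ∀ {f} → Algorithm.Labelling.𝒢 L x ≡ ∞ → Algorithm.𝐅 V L x ≐ ｛ f ｝ →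
         ReadsAs L x (Nym f)
  inf  : ∀ {D} → Algorithm.Labelling.𝒢 L x ≡ ∞ → Algorithm.𝐅 V L x ≐ ∅ →
         Algorithm.𝐃 V L x ≐ D → ReadsAs L x ∞[ D ]

-- The Grundy value of the game (whose node is assumed white) is v.
HasGrundyValue : Game → Value → Set₁
HasGrundyValue (V , x) v = ∃[ L ] Algorithm.Final V L × ReadsAs {V} L x v

-- The addition table: left argument gives the row, right the column.
_⊞_ : Value → Value → Value
Full      ⊞ Full        = Full
Full      ⊞ ∞[ D′ ]     = Full
Full      ⊞ Moon[ F′ ]  = Full
Full      ⊞ Nym f′      = Full
Full      ⊞ int n′      = Full
∞[ D ]    ⊞ Full        = Full
∞[ D ]    ⊞ ∞[ D′ ]     = ∞[ ∅ ]
∞[ D ]    ⊞ Moon[ F′ ]  = ∞[ D ⊕ˢ F′ ]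
∞[ D ]    ⊞ Nym f′      = ∞[ f′ ⊕ᵐ D ]
∞[ D ]    ⊞ int n′      = ∞[ n′ ⊕ᵐ D ]
Moon[ F ] ⊞ Full        = Full
Moon[ F ] ⊞ ∞[ D′ ]     = ∞[ F ⊕ˢ D′ ]
Moon[ F ] ⊞ Moon[ F′ ]  = Moon[ F ⊕ˢ F′ ]
Moon[ F ] ⊞ Nym f′      = Moon[ f′ ⊕ᵐ F ]
Moon[ F ] ⊞ int n′      = Moon[ n′ ⊕ᵐ F ]
Nym f     ⊞ Full        = Full
Nym f     ⊞ ∞[ D′ ]     = ∞[ f ⊕ᵐ D′ ]
Nym f     ⊞ Moon[ F′ ]  = Moon[ f ⊕ᵐ F′ ]
Nym f     ⊞ Nym f′      = Nym (f ⊕ f′)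
Nym f     ⊞ int n′      = Nym (f ⊕ n′)
int n     ⊞ Full        = Full
int n     ⊞ ∞[ D′ ]     = ∞[ n ⊕ᵐ D′ ]
int n     ⊞ Moon[ F′ ]  = Moon[ n ⊕ᵐ F′ ]
int n     ⊞ Nym f′      = Nym (n ⊕ f′)
int n     ⊞ int n′      = int (n ⊕ n′)

{-# OPTIONS --safe #-}
-- The labels are described without step numbers, by the inductively defined
-- outcomes of the positions x + *k: the algorithm only assigns labels that agree
-- with them, and a labelling at which it stops assigns all of them.  It stops
-- because labels only grow in an order of height three.  For the sum, strategies
-- for x + *a and y + *b combine to one for (x + y) + *(a ⊕ b), and if y is worth
-- *b then a strategy for (x + y) + *m gives one for x + *(m ⊕ b).  The remaining
-- point is that x + y is no integer when neither x nor y is: a moon has an option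
-- that forces the opponent to stay outside the integers, and two undecided
-- components would have to cover the same integers, so that y could replace the
-- integer mex x in the play from x, contrary to x being undecided.

module Submission where

open import Level using (0ℓ)
open import Data.Empty using (⊥; ⊥-elim)
open import Data.List.Base using (List; []; _∷_; [_]; concatMap; map)
open import Data.List.Extrema.Nat using (max; xs≤max)
open import Data.List.Membership.Propositional using (_∈_; _∉_; lose)
open import Data.List.Membership.Propositional.Properties using (∈-concatMap⁺)
open import Data.List.Relation.Unary.All as All using ()
open import Data.List.Relation.Unary.Any as Any using (here; there)
open import Data.Nat.Base using
  ( _%_; _*_; _+_; _/_; _<_; _≤_; suc; s≤s; s≤s⁻¹; z<s; zero; z≤n; ℕ )
open import Data.Nat.DivMod using
  ( %-distribˡ-+; +-distrib-/-∣ʳ; /-monoˡ-≤; [m+kn]%n≡m%n; m%n%n≡m%n; m%n<n; m*n%n≡0; m*n/n≡m;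
  m/n<m; m<n⇒m/n≡0; m≡m%n+[m/n]*n )
open import Data.Nat.Divisibility using (divides)
open import Data.Nat.ListAction using (sum)
open import Data.Nat.Properties using
  ( *-comm; +-assoc; +-cancelʳ-≤; +-cancelˡ-≤; +-comm; +-identityʳ;
  +-mono-≤; +-monoʳ-≤; +-monoˡ-<; +-monoˡ-≤; +-suc; <-cmp; <-irrefl; <-≤-trans; <⇒≤; <⇒≱; _<?_; _≟_;
  m≤m+n; m≤n+m; m≤n⇒m<n∨m≡n; m≤n⇒m≤1+n; ≤-antisym;
  ≤-refl; ≤-reflexive; ≤-trans; ≤⇒≯; ≮⇒≥ )
open import Data.List.Membership.DecPropositional _≟_ using (_∈?_)
open import Data.Product using (∃; ∃-syntax; _×_; _,_; proj₁; proj₂)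
open import Data.Sum as Sum using (_⊎_; inj₁; inj₂; [_,_]′)
open import Data.Unit.Base using (⊤; tt)
open import Function.Base using (_∘_; case_of_)
open import Relation.Binary.Definitions using (DecidableEquality; Tri; tri<; tri≈; tri>)
open import Relation.Binary.PropositionalEquality
  using (_≡_; _≢_; refl; sym; trans; cong; cong₂; subst; subst₂; module ≡-Reasoning)
open import Relation.Nullary using (¬_; Dec; yes; no; ¬?; _×-dec_; _⊎-dec_; _→-dec_; contradiction; map′)
open import Relation.Nullary.Decidable using (decidable-stable)
open import Relation.Unary as Pred using (Pred; Decidable; _∪_; _≐_; ｛_｝; ∅)
open import Relation.Unary.Properties using (≐-trans; ≐-sym)
open import Defs

-- The obstacle is infinite play: neither `Prev` nor `Next` is the negation of the other, and an
-- undecided node is given mainly by what it fails to be. So every outcome is inductive, proofs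
-- descend along derivations, and the positive content of being undecided (a gap and an escape) is
-- extracted from the failure of all rules. Two levels of outcome are needed because the mex
-- collects labels (`Inside`), while an unassigned option only has to be won (`Next`). The levels
-- meet again when a chain is decided differently for two integers, or when a derivation in the sum
-- bounds the play. A fresh integer, the value of no node, separates chains that end in a moon or a
-- terminal node from chains that depend on a particular integer at their end. The subscripts obey
-- one formula: if an integer n is given the set of forcing values `{n}`, then the forcing values of
-- a sum are the nim-sums of those of its components, and the direct values are the nim-sums of the
-- direct values of an infinity with the forcing values of the other component, unless that one is
-- full.

-- Nim-addition by binary digits

n<2⇒n≡0∨1 : ∀ {n} → n < 2 → n ≡ 0 ⊎ n ≡ 1
n<2⇒n≡0∨1 {zero} _ = inj₁ refl
n<2⇒n≡0∨1 {suc zero} _ = inj₂ refl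
n<2⇒n≡0∨1 {suc (suc n)} (s≤s (s≤s ()))

half≤ : ∀ {m f} → m ≤ suc f → m / 2 ≤ f
half≤ {zero}  _ = z≤n
half≤ {suc m} m≤f = s≤s⁻¹ (<-≤-trans (m/n<m (suc m) 2 (s≤s (s≤s z≤n))) m≤f)

digits-injective : ∀ {m n} → m % 2 ≡ n % 2 → m / 2 ≡ n / 2 → m ≡ n
digits-injective {m} {n} p q = begin
  m                 ≡⟨ m≡m%n+[m/n]*n m 2 ⟩
  m % 2 + m / 2 * 2 ≡⟨ cong₂ (λ r s → r + s * 2) p q ⟩
  n % 2 + n / 2 * 2 ≡⟨ m≡m%n+[m/n]*n n 2 ⟨
  n                 ∎
  where open ≡-Reasoning

-- Halving exhausts both arguments before the fuel, so any surplus fuel only adds zero digits.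
xorBits-fuel : ∀ f g {m n} → m ≤ f → n ≤ f → m ≤ g → n ≤ g → xorBits f m n ≡ xorBits g m n
xorBits-fuel zero    zero    _ _ _ _ = refl
xorBits-fuel zero    (suc g) z≤n z≤n _ _ = cong (2 *_) (xorBits-fuel zero g z≤n z≤n z≤n z≤n)
xorBits-fuel (suc f) zero    _ _ z≤n z≤n = cong (2 *_) (xorBits-fuel f zero z≤n z≤n z≤n z≤n)
xorBits-fuel (suc f) (suc g) {m} {n} p q r s =
  cong (λ h → (m % 2 + n % 2) % 2 + 2 * h)
    (xorBits-fuel f g (half≤ p) (half≤ q) (half≤ r) (half≤ s))

-- Frees the recursion from the fuel; the laws below then follow by comparing last digits and
-- halves.
⊕-unfold : ∀ m n → m ⊕ n ≡ (m % 2 + n % 2) % 2 + 2 * (m / 2 ⊕ n / 2)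
⊕-unfold m n = trans
  (xorBits-fuel (m + n) (suc (m + n)) m≤ n≤ (m≤n⇒m≤1+n m≤) (m≤n⇒m≤1+n n≤))
  (cong (λ h → (m % 2 + n % 2) % 2 + 2 * h)
    (xorBits-fuel (m + n) _ (half≤ (m≤n⇒m≤1+n m≤)) (half≤ (m≤n⇒m≤1+n n≤))
      (m≤m+n _ _) (m≤n+m _ _)))
  where
  m≤ = m≤m+n m n
  n≤ = m≤n+m n m

⊕-% : ∀ m n → (m ⊕ n) % 2 ≡ (m + n) % 2
⊕-% m n = begin
  (m ⊕ n) % 2                                          ≡⟨ cong (_% 2) (⊕-unfold m n) ⟩
  ((m % 2 + n % 2) % 2 + 2 * (m / 2 ⊕ n / 2)) % 2      ≡⟨ cong (λ h → ((m % 2 + n % 2) % 2 + h) % 2) (*-comm 2 (m / 2 ⊕ n / 2)) ⟩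
  ((m % 2 + n % 2) % 2 + (m / 2 ⊕ n / 2) * 2) % 2      ≡⟨ [m+kn]%n≡m%n ((m % 2 + n % 2) % 2) (m / 2 ⊕ n / 2) 2 ⟩
  (m % 2 + n % 2) % 2 % 2                              ≡⟨ m%n%n≡m%n (m % 2 + n % 2) 2 ⟩
  (m % 2 + n % 2) % 2                                  ≡⟨ %-distribˡ-+ m n 2 ⟨
  (m + n) % 2                                          ∎
  where open ≡-Reasoning

⊕-/ : ∀ m n → (m ⊕ n) / 2 ≡ m / 2 ⊕ n / 2
⊕-/ m n = begin
  (m ⊕ n) / 2                       ≡⟨ cong (_/ 2) (⊕-unfold m n) ⟩
  (r + 2 * q) / 2                   ≡⟨ cong (λ h → (r + h) / 2) (*-comm 2 q) ⟩
  (r + q * 2) / 2                   ≡⟨ +-distrib-/-∣ʳ r (divides q refl) ⟩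
  r / 2 + q * 2 / 2                 ≡⟨ cong₂ _+_ (m<n⇒m/n≡0 (m%n<n (m % 2 + n % 2) 2)) (m*n/n≡m q 2) ⟩
  q                                 ∎
  where
  open ≡-Reasoning
  r = (m % 2 + n % 2) % 2
  q = m / 2 ⊕ n / 2

⊕-comm : ∀ m n → m ⊕ n ≡ n ⊕ m
⊕-comm m n = comm (m + n) (m≤m+n m n) (m≤n+m n m)
  where
  comm : ∀ f {m n} → m ≤ f → n ≤ f → m ⊕ n ≡ n ⊕ m
  comm zero    z≤n z≤n = refl
  comm (suc f) {m} {n} p q = digits-injective
    (trans (⊕-% m n) (trans (cong (_% 2) (+-comm m n)) (sym (⊕-% n m))))
    (trans (⊕-/ m n) (trans (comm f (half≤ p) (half≤ q)) (sym (⊕-/ n m))))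

⊕-identityʳ : ∀ m → m ⊕ 0 ≡ m
⊕-identityʳ m = identity m ≤-refl
  where
  identity : ∀ f {m} → m ≤ f → m ⊕ 0 ≡ m
  identity zero    z≤n = refl
  identity (suc f) {m} p = digits-injective
    (trans (⊕-% m 0) (cong (_% 2) (+-identityʳ m)))
    (trans (⊕-/ m 0) (identity f (half≤ p)))

⊕-self : ∀ m → m ⊕ m ≡ 0
⊕-self m = self m ≤-refl
  where
  self : ∀ f {m} → m ≤ f → m ⊕ m ≡ 0
  self zero    z≤n = refl
  self (suc f) {m} p = digits-injective {n = 0}
    (trans (⊕-% m m) (trans (cong (λ h → (m + h) % 2) (sym (+-identityʳ m)))
      (trans (cong (_% 2) (*-comm 2 m)) (m*n%n≡0 m 2))))
    (trans (⊕-/ m m) (self f (half≤ p)))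

⊕-assoc : ∀ a b c → (a ⊕ b) ⊕ c ≡ a ⊕ (b ⊕ c)
⊕-assoc a b c = assoc (a + (b + c)) (m≤m+n a _)
  (≤-trans (m≤m+n b c) (m≤n+m _ a)) (≤-trans (m≤n+m c b) (m≤n+m _ a))
  where
  open ≡-Reasoning
  sum-% : ∀ a a′ c c′ → a % 2 ≡ a′ % 2 → c % 2 ≡ c′ % 2 → (a + c) % 2 ≡ (a′ + c′) % 2
  sum-% a a′ c c′ p q = trans (%-distribˡ-+ a c 2)
    (trans (cong₂ (λ r s → (r + s) % 2) p q) (sym (%-distribˡ-+ a′ c′ 2)))
  assoc : ∀ f {a b c} → a ≤ f → b ≤ f → c ≤ f → (a ⊕ b) ⊕ c ≡ a ⊕ (b ⊕ c)
  assoc zero    z≤n z≤n z≤n = refl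
  assoc (suc f) {a} {b} {c} p q r = digits-injective
    (begin
      ((a ⊕ b) ⊕ c) % 2   ≡⟨ ⊕-% (a ⊕ b) c ⟩
      ((a ⊕ b) + c) % 2   ≡⟨ sum-% (a ⊕ b) (a + b) c c (⊕-% a b) refl ⟩
      ((a + b) + c) % 2   ≡⟨ cong (_% 2) (+-assoc a b c) ⟩
      (a + (b + c)) % 2   ≡⟨ sum-% a a (b ⊕ c) (b + c) refl (⊕-% b c) ⟨
      (a + (b ⊕ c)) % 2   ≡⟨ ⊕-% a (b ⊕ c) ⟨
      (a ⊕ (b ⊕ c)) % 2   ∎)
    (begin
      ((a ⊕ b) ⊕ c) / 2           ≡⟨ ⊕-/ (a ⊕ b) c ⟩
      (a ⊕ b) / 2 ⊕ c / 2         ≡⟨ cong (_⊕ c / 2) (⊕-/ a b) ⟩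
      (a / 2 ⊕ b / 2) ⊕ c / 2     ≡⟨ assoc f (half≤ p) (half≤ q) (half≤ r) ⟩
      a / 2 ⊕ (b / 2 ⊕ c / 2)     ≡⟨ cong (a / 2 ⊕_) (⊕-/ b c) ⟨
      a / 2 ⊕ (b ⊕ c) / 2         ≡⟨ ⊕-/ a (b ⊕ c) ⟨
      (a ⊕ (b ⊕ c)) / 2           ∎)

⊕-cancel : ∀ a b → (a ⊕ b) ⊕ b ≡ a
⊕-cancel a b = trans (⊕-assoc a b b) (trans (cong (a ⊕_) (⊕-self b)) (⊕-identityʳ a))

half-<⇒< : ∀ m n → m / 2 < n / 2 → m < n
half-<⇒< m n p with <-cmp m n
... | tri< m<n _ _ = m<n
... | tri≈ _ refl _ = contradiction p (<-irrefl refl)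
... | tri> _ _ n<m = contradiction p (≤⇒≯ (/-monoˡ-≤ 2 (≤-trans (m≤n⇒m≤1+n ≤-refl) n<m)))

half-≡⇒< : ∀ m n → m / 2 ≡ n / 2 → m % 2 < n % 2 → m < n
half-≡⇒< m n e p = subst₂ _<_ (sym (m≡m%n+[m/n]*n m 2)) (sym (m≡m%n+[m/n]*n n 2))
  (subst (λ h → m % 2 + m / 2 * 2 < n % 2 + h * 2) e (+-monoˡ-< (m / 2 * 2) p))

-- At the highest binary digit in which k and a ⊕ b differ, exactly one of a, b has the digit 1.
<-⊕ : ∀ {k} a b → k < a ⊕ b → k ⊕ b < a ⊎ k ⊕ a < b
<-⊕ {k} a b = go (k + (a + b)) (m≤m+n k _) (≤-trans (m≤m+n a b) (m≤n+m _ k)) (≤-trans (m≤n+m b a) (m≤n+m _ k))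
  where
  open ≡-Reasoning
  halves : ∀ k a b → k / 2 ≡ (a ⊕ b) / 2 → (k ⊕ b) / 2 ≡ a / 2
  halves k a b e = begin
    (k ⊕ b) / 2              ≡⟨ ⊕-/ k b ⟩
    k / 2 ⊕ b / 2            ≡⟨ cong (_⊕ b / 2) (trans e (⊕-/ a b)) ⟩
    (a / 2 ⊕ b / 2) ⊕ b / 2  ≡⟨ ⊕-cancel (a / 2) (b / 2) ⟩
    a / 2                    ∎

  odd : ∀ k a b → k % 2 ≡ 0 → b % 2 ≡ 0 → a % 2 ≡ 1 → (k ⊕ b) % 2 < a % 2
  odd k a b k₀ b₀ a₁ = subst₂ _<_ (sym even) (sym a₁) z<s
    where
    even : (k ⊕ b) % 2 ≡ 0
    even = trans (⊕-% k b) (trans (%-distribˡ-+ k b 2) (cong₂ (λ r s → (r + s) % 2) k₀ b₀))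

  parity : ∀ a b {r s} → a % 2 ≡ r → b % 2 ≡ s → (a ⊕ b) % 2 ≡ (r + s) % 2
  parity a b p q = trans (⊕-% a b) (trans (%-distribˡ-+ a b 2) (cong₂ (λ r s → (r + s) % 2) p q))

  low : ∀ k a b → k / 2 ≡ (a ⊕ b) / 2 → k % 2 < (a ⊕ b) % 2 → k ⊕ b < a ⊎ k ⊕ a < b
  low k a b e p with n<2⇒n≡0∨1 (m%n<n k 2) | n<2⇒n≡0∨1 (m%n<n (a ⊕ b) 2)
                     | n<2⇒n≡0∨1 (m%n<n a 2) | n<2⇒n≡0∨1 (m%n<n b 2)
  ... | inj₂ k₁ | inj₂ c₁ | _ | _ = contradiction (subst₂ _<_ k₁ c₁ p) (<-irrefl refl)
  ... | _ | inj₁ c₀ | _ | _ with () ← subst (k % 2 <_) c₀ p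
  ... | inj₁ k₀ | inj₂ c₁ | inj₁ a₀ | inj₁ b₀ with () ← trans (sym c₁) (parity a b a₀ b₀)
  ... | inj₁ k₀ | inj₂ c₁ | inj₂ a₁ | inj₂ b₁ with () ← trans (sym c₁) (parity a b a₁ b₁)
  ... | inj₁ k₀ | inj₂ c₁ | inj₂ a₁ | inj₁ b₀ = inj₁ (half-≡⇒< (k ⊕ b) a (halves k a b e) (odd k a b k₀ b₀ a₁))
  ... | inj₁ k₀ | inj₂ c₁ | inj₁ a₀ | inj₂ b₁ =
    inj₂ (half-≡⇒< (k ⊕ a) b (halves k b a (trans e (cong (_/ 2) (⊕-comm a b)))) (odd k b a k₀ a₀ b₁))

  go : ∀ f {k a b} → k ≤ f → a ≤ f → b ≤ f → k < a ⊕ b → k ⊕ b < a ⊎ k ⊕ a < b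
  go zero    z≤n z≤n z≤n ()
  go (suc f) {k} {a} {b} p q r k<c with <-cmp (k / 2) ((a ⊕ b) / 2)
  ... | tri> _ _ gt = contradiction k<c (≤⇒≯ (<⇒≤ (half-<⇒< (a ⊕ b) k gt)))
  ... | tri≈ _ e _ = low k a b e digit
    where
    digit : k % 2 < (a ⊕ b) % 2
    digit with <-cmp (k % 2) ((a ⊕ b) % 2)
    ... | tri< lt _ _ = lt
    ... | tri≈ _ d _  = contradiction k<c (<-irrefl (digits-injective d e))
    ... | tri> _ _ gt = contradiction k<c (≤⇒≯ (<⇒≤ (half-≡⇒< (a ⊕ b) k (sym e) gt)))
  ... | tri< lt _ _ with go f (half≤ p) (half≤ q) (half≤ r) (subst (k / 2 <_) (⊕-/ a b) lt)
  ...   | inj₁ l = inj₁ (half-<⇒< (k ⊕ b) a (subst (_< a / 2) (sym (⊕-/ k b)) l))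
  ...   | inj₂ l = inj₂ (half-<⇒< (k ⊕ a) b (subst (_< b / 2) (sym (⊕-/ k a)) l))

-- A record rather than the bare equation, so that unification can read off `a`, `b` and `c`; `_⊕_`
-- itself unfolds and is not injective.
record NimSum (a b c : ℕ) : Set where
  constructor nimSum
  field
    equation : a ⊕ b ≡ c

⊕-nimSum : ∀ a b → NimSum a b (a ⊕ b)
⊕-nimSum a b = nimSum refl

swap-nimSum : ∀ {a b c} → NimSum a b c → NimSum b a c
swap-nimSum {a} {b} (nimSum e) = nimSum (trans (⊕-comm b a) e)

rotate-nimSum : ∀ {a b c} → NimSum a b c → NimSum c b a
rotate-nimSum {a} {b} (nimSum refl) = nimSum (⊕-cancel a b)

nimSum-unique : ∀ {a b c c′} → NimSum a b c → NimSum a b c′ → c ≡ c′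
nimSum-unique (nimSum e) (nimSum e′) = trans (sym e) e′

nimSum-uniqueˡ : ∀ {a a′ b c} → NimSum a b c → NimSum a′ b c → a ≡ a′
nimSum-uniqueˡ s s′ = nimSum-unique (rotate-nimSum s) (rotate-nimSum s′)

nimSum-< : ∀ {a b c k} → NimSum a b c → k < c →
  (∃[ a′ ] a′ < a × NimSum a′ b k) ⊎ (∃[ b′ ] b′ < b × NimSum a b′ k)
nimSum-< {a} {b} {k = k} (nimSum refl) k<c with <-⊕ a b k<c
... | inj₁ lt = inj₁ (k ⊕ b , lt , rotate-nimSum (⊕-nimSum k b))
... | inj₂ lt = inj₂ (k ⊕ a , lt , swap-nimSum (rotate-nimSum (⊕-nimSum k a)))

-- Outcomes of positions

gray≢white : ∀ {c} → c ≡ gray → c ≡ white → ⊥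
gray≢white refl ()

white⊎gray : ∀ c → (c ≡ white) ⊎ (c ≡ gray)
white⊎gray white = inj₁ refl
white⊎gray gray  = inj₂ refl

-- Positions x + *k, without step numbers.  `Inside k x` and `Outside k x` say
-- that x gets a label which contains, or does not contain, k as a set (an
-- integer n counting as {n} and a moon as ∅); `Prev k x` and `Next k x` say
-- that the previous or the next player wins x + *k.  A gray node can be won by
-- one of the players for some k without ever getting a label.
module Outcome (V : Digraph) where
  open Digraph V

  mutual
    data IntValue (n : ℕ) (x : Node) : Set where
      intValue : White x → (∀ {k} → k < n → Covered k x) → (∀ {x′} → x ⟶ x′ → Next n x′) → IntValue n x

    data Covered (k : ℕ) (x : Node) : Set where
      covered : ∀ {x′} → x ⟶ x′ → Inside k x′ → Covered k x

    data Inside (k : ℕ) (x : Node) : Set where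
      int  : IntValue k x → Inside k x
      gray : Gray x → (∀ {x′} → x ⟶ x′ → Outside k x′) → Inside k x

    data Outside (k : ℕ) (x : Node) : Set where
      int   : ∀ {j} → IntValue j x → j ≢ k → Outside k x
      lunar : Lunar x → Outside k x
      gray  : ∀ {x′} → Gray x → x ⟶ x′ → Inside k x′ → Outside k x

    data Lunar (x : Node) : Set where
      lunar : White x → (∀ k → Covered k x) → Lunar x

    data Prev (k : ℕ) (x : Node) : Set where
      int  : IntValue k x → Prev k x
      gray : Gray x → (∀ {x′} → x ⟶ x′ → Next k x′) → Prev k x

    data Next (k : ℕ) (x : Node) : Set where
      int   : ∀ {j} → IntValue j x → j ≢ k → Next k x
      lunar : Lunar x → Next k x
      move  : ∀ {x′} → x ⟶ x′ → Prev k x′ → Next k x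

  mutual
    -- Full and Moon are both empty as sets and both `Lunar`, so telling them apart takes predicates
    -- of its own.
    data NewMoon (x : Node) : Set where
      new : Gray x → (∀ {x′} → x ⟶ x′ → FullMoon x′) → NewMoon x

    data FullMoon (x : Node) : Set where
      full : ∀ {x′} → x ⟶ x′ → NewMoon x′ → FullMoon x

  data Forces (k : ℕ) (x : Node) : Set where
    here  : ∀ {x′ x″} → x ⟶ x′ → Gray x′ → x′ ⟶ x″ → IntValue k x″ → Forces k x
    later : ∀ {x′ x″} → x ⟶ x′ → Gray x′ → x′ ⟶ x″ → Forces k x″ → Forces k x

  data Directs (k : ℕ) (x : Node) : Set where
    via-white : ∀ {x′} → x ⟶ x′ → IntValue k x′ → Directs k x
    via-gray  : ∀ {x′} → x ⟶ x′ → Gray x′ → (∀ {x″} → x′ ⟶ x″ → Directs k x″) → Directs k x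

  -- Including the node's own integer gives an integer n the set `{n}`, just as a nymphet f has
  -- `{f}`; integers then need no separate treatment in the subscripts.
  Forces⁼ : ℕ → Node → Set
  Forces⁼ k x = IntValue k x ⊎ Forces k x

  int-white : ∀ {n x} → IntValue n x → White x
  int-white (intValue w _ _) = w

  lunar-white : ∀ {x} → Lunar x → White x
  lunar-white (lunar w _) = w

  mutual
    inside⇒prev : ∀ {k x} → Inside k x → Prev k x
    inside⇒prev (int i)    = int i
    inside⇒prev (gray g f) = gray g λ a → outside⇒next (f a)

    outside⇒next : ∀ {k x} → Outside k x → Next k x
    outside⇒next (int i n)    = int i n
    outside⇒next (lunar l)    = lunar l
    outside⇒next (gray _ a i) = move a (inside⇒prev i)

  mutual
    -- The strategies of the two supposed winners are played against each other. The derivations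
    -- shrink until incompatible end positions meet; hence exclusivity, uniqueness of integers and
    -- their incompatibility with moons are proved together.
    inside∧next⇒⊥ : ∀ {k x} → Inside k x → Next k x → ⊥
    inside∧next⇒⊥ (int i) (int j n) = n (int-unique j i)
    inside∧next⇒⊥ (int i) (lunar l) = int∧lunar⇒⊥ i l
    inside∧next⇒⊥ (int (intValue _ _ o)) (move a p) = prev∧next⇒⊥ p (o a)
    inside∧next⇒⊥ (gray g _) (int i _) = gray≢white g (int-white i)
    inside∧next⇒⊥ (gray g _) (lunar (lunar w _)) = gray≢white g w
    inside∧next⇒⊥ (gray g f) (move a p) = prev∧outside⇒⊥ p (f a)

    prev∧outside⇒⊥ : ∀ {k x} → Prev k x → Outside k x → ⊥
    prev∧outside⇒⊥ (int i) (int j n) = n (int-unique j i)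
    prev∧outside⇒⊥ (int i) (lunar l) = int∧lunar⇒⊥ i l
    prev∧outside⇒⊥ (int i) (gray g _ _) = gray≢white g (int-white i)
    prev∧outside⇒⊥ (gray g _) (int i _) = gray≢white g (int-white i)
    prev∧outside⇒⊥ (gray g _) (lunar (lunar w _)) = gray≢white g w
    prev∧outside⇒⊥ (gray _ f) (gray _ a i) = inside∧next⇒⊥ i (f a)

    prev∧next⇒⊥ : ∀ {k x} → Prev k x → Next k x → ⊥
    prev∧next⇒⊥ (int i) (int j n) = n (int-unique j i)
    prev∧next⇒⊥ (int i) (lunar l) = int∧lunar⇒⊥ i l
    prev∧next⇒⊥ (int (intValue _ _ o)) (move a p) = prev∧next⇒⊥ p (o a)
    prev∧next⇒⊥ (gray g _) (int i _) = gray≢white g (int-white i)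
    prev∧next⇒⊥ (gray g _) (lunar (lunar w _)) = gray≢white g w
    prev∧next⇒⊥ (gray _ f) (move a p) = prev∧next⇒⊥ p (f a)

    int∧lunar⇒⊥ : ∀ {k x} → IntValue k x → Lunar x → ⊥
    int∧lunar⇒⊥ {k} i (lunar _ f) = int∧covered⇒⊥ i (f k)

    int∧covered⇒⊥ : ∀ {k x} → IntValue k x → Covered k x → ⊥
    int∧covered⇒⊥ (intValue _ _ o) (covered a i) = inside∧next⇒⊥ i (o a)

    int-unique : ∀ {j k x} → IntValue j x → IntValue k x → j ≡ k
    int-unique {j} {k} = int-unique-by (<-cmp j k)

    int-unique-by : ∀ {j k x} → Tri (j < k) (j ≡ k) (k < j) → IntValue j x → IntValue k x → j ≡ k
    int-unique-by (tri≈ _ e _)  _ _ = e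
    int-unique-by (tri< lt _ _) i (intValue _ c _) = ⊥-elim (int∧covered⇒⊥ i (c lt))
    int-unique-by (tri> _ _ gt) (intValue _ c _) i = ⊥-elim (int∧covered⇒⊥ i (c gt))

  mutual
    new⇒inside : ∀ {k x} → NewMoon x → Inside k x
    new⇒inside (new g f) = gray g λ a → full⇒outside (f a)

    full⇒outside : ∀ {k x} → FullMoon x → Outside k x
    full⇒outside {k} {x} (full a n) with white⊎gray (colour x)
    ... | inj₁ w = lunar (lunar w λ _ → covered a (new⇒inside n))
    ... | inj₂ g = gray g a (new⇒inside n)

  full⇒lunar : ∀ {x} → White x → FullMoon x → Lunar x
  full⇒lunar w (full a n) = lunar w λ _ → covered a (new⇒inside n)

  covered∧prev⇒⊥ : ∀ {k x} → Covered k x → (∀ {x′} → x ⟶ x′ → Next k x′) → ⊥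
  covered∧prev⇒⊥ (covered a i) o = inside∧next⇒⊥ i (o a)

  -- A chain of gray nodes won by different players for two values of k ends in
  -- a node with a label.
  mutual
    prev∧next⇒inside : ∀ {j k x} → Prev k x → Next j x → j ≢ k → Inside k x
    prev∧next⇒inside (int i) _ _ = int i
    prev∧next⇒inside (gray g _) (int i _) _ = ⊥-elim (gray≢white g (int-white i))
    prev∧next⇒inside (gray g _) (lunar (lunar w _)) _ = ⊥-elim (gray≢white g w)
    prev∧next⇒inside (gray g f) (move {x′} a p) j≢k =
      gray g λ {x″} a′ → subst (Outside _) (gray-outdegree≤1 g a a′) (next∧prev⇒outside (f a) p j≢k)

    next∧prev⇒outside : ∀ {j k x} → Next k x → Prev j x → j ≢ k → Outside k x
    next∧prev⇒outside _ (int i) j≢k = int i j≢k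
    next∧prev⇒outside (int i _) (gray g _) _ = ⊥-elim (gray≢white g (int-white i))
    next∧prev⇒outside (lunar (lunar w _)) (gray g _) _ = ⊥-elim (gray≢white g w)
    next∧prev⇒outside (move a p) (gray g f) j≢k = gray g a (prev∧next⇒inside p (f a) j≢k)

  prev-option : ∀ {k x x′} → Prev k x → x ⟶ x′ → Next k x′
  prev-option (int (intValue _ _ o)) = o
  prev-option (gray _ o)             = o

  prev-white : ∀ {k x} → White x → Prev k x → IntValue k x
  prev-white _ (int i)    = i
  prev-white w (gray g _) = ⊥-elim (gray≢white g w)

  next-gray : ∀ {k x} → Gray x → Next k x → ∃[ x′ ] x ⟶ x′ × Prev k x′
  next-gray g (int i _)           = ⊥-elim (gray≢white g (int-white i))
  next-gray g (lunar (lunar w _)) = ⊥-elim (gray≢white g w)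
  next-gray g (move a p)          = _ , a , p

  -- A forcing move leaves a single reply, so the winner at j must still be winning after it; the
  -- integer k at the end of the forced sequence is then won at j as well.
  prev∧forces⇒≡ : ∀ {j k x} → Prev j x → Forces k x → k ≡ j
  prev∧forces⇒≡ p (here a g a′ i) with y , b , q ← next-gray g (prev-option p a)
    rewrite gray-outdegree≤1 g b a′ = int-unique i (prev-white (int-white i) q)
  prev∧forces⇒≡ p (later a g a′ f) with y , b , q ← next-gray g (prev-option p a)
    rewrite gray-outdegree≤1 g b a′ = prev∧forces⇒≡ q f

  int∧forces⁼⇒≡ : ∀ {j k x} → IntValue j x → Forces⁼ k x → k ≡ j
  int∧forces⁼⇒≡ i (inj₁ i′) = int-unique i′ i
  int∧forces⁼⇒≡ i (inj₂ f)  = prev∧forces⇒≡ (int i) f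

  forces⁼⇒forces : ∀ {k x x′ x″} → x ⟶ x′ → Gray x′ → x′ ⟶ x″ → Forces⁼ k x″ → Forces k x
  forces⁼⇒forces a g a′ (inj₁ i) = here a g a′ i
  forces⁼⇒forces a g a′ (inj₂ f) = later a g a′ f

  inside-all⇒outside-all : ∀ {x x′} → x ⟶ x′ → (∀ k → Inside k x′) → ∀ k → Outside k x
  inside-all⇒outside-all {x} a i k with white⊎gray (colour x)
  ... | inj₁ w = lunar (lunar w λ k → covered a (i k))
  ... | inj₂ g = gray g a (i k)

  -- A white node without a label: some option does not revert to the mex (the
  -- gap) of the labels of the options.
  record Undecided (x : Node) : Set where
    field
      isWhite    : White x
      ¬int       : ∀ {n} → ¬ IntValue n x
      ¬lunar     : ¬ Lunar x
      gap        : ℕ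
      gap-free   : ¬ Covered gap x
      escape     : Node
      escape-arc : x ⟶ escape
      escape-gap : ¬ Next gap escape

  undecided-next : ∀ {k x} → Undecided x → Next k x → ∃[ x′ ] x ⟶ x′ × Prev k x′
  undecided-next u (int i _)  = ⊥-elim (Undecided.¬int u i)
  undecided-next u (lunar l)  = ⊥-elim (Undecided.¬lunar u l)
  undecided-next u (move a p) = _ , a , p

  data Kind (x : Node) : Set where
    int       : ∀ {n} → IntValue n x → Kind x
    lunar     : Lunar x → Kind x
    undecided : Undecided x → Kind x

-- Stationarity and bounded search

monotone-bounded⇒stationary : (f : ℕ → ℕ) (b : ℕ) → (∀ n → f n ≤ f (suc n)) → (∀ n → f n ≤ b) →
  ∃[ n ] f n ≡ f (suc n)
monotone-bounded⇒stationary f b mono bound = go b 0 (m≤n+m b (f 0))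
  where
  -- `slack` bounds the strict increases still possible after step n.
  go : ∀ slack n → b ≤ f n + slack → ∃[ n ] f n ≡ f (suc n)
  go slack n le with m≤n⇒m<n∨m≡n (mono n)
  ... | inj₂ e = n , e
  go zero n le | inj₁ lt =
    contradiction (≤-trans lt (bound (suc n))) (<⇒≱ (s≤s (≤-trans le (≤-reflexive (+-identityʳ _)))))
  go (suc slack) n le | inj₁ lt = go slack (suc n)
    (≤-trans le (≤-trans (≤-reflexive (+-suc (f n) slack)) (+-monoˡ-≤ slack lt)))

module _ {A : Set} where

  sum-mono : (f g : A → ℕ) → (∀ x → f x ≤ g x) → ∀ xs → sum (map f xs) ≤ sum (map g xs)
  sum-mono f g le []       = z≤n
  sum-mono f g le (x ∷ xs) = +-mono-≤ (le x) (sum-mono f g le xs)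

  sum-≡⇒pointwise : (f g : A → ℕ) → (∀ x → f x ≤ g x) → ∀ xs → sum (map f xs) ≡ sum (map g xs) →
    ∀ {x} → x ∈ xs → f x ≡ g x
  sum-≡⇒pointwise f g le (x ∷ xs) e (here refl) = ≤-antisym (le x)
    (+-cancelʳ-≤ (sum (map f xs)) (g x) (f x) (≤-trans (+-monoʳ-≤ (g x) (sum-mono f g le xs)) (≤-reflexive (sym e))))
  sum-≡⇒pointwise f g le (y ∷ xs) e (there i) = sum-≡⇒pointwise f g le xs
    (≤-antisym (sum-mono f g le xs)
      (+-cancelˡ-≤ (f y) _ _ (≤-trans (+-monoˡ-≤ (sum (map g xs)) (le y)) (≤-reflexive (sym e))))) i

  -- Summing over the list turns simultaneous stabilisation at all its members into that of one
  -- bounded sequence. It serves both for the steps of the algorithm and for the depth of the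
  -- evaluation of `Cr`.
  stationary : (xs : List A) (r : ℕ → A → ℕ) (b : ℕ) → (∀ n x → r n x ≤ r (suc n) x) → (∀ n x → r n x ≤ b) →
    ∃[ n ] ∀ {x} → x ∈ xs → r n x ≡ r (suc n) x
  stationary xs r b mono bound =
    let n , e = monotone-bounded⇒stationary (λ n → sum (map (r n) xs)) (sum (map (λ _ → b) xs))
                  (λ n → sum-mono (r n) (r (suc n)) (mono n) xs)
                  (λ n → sum-mono (r n) (λ _ → b) (bound n) xs)
    in n , sum-≡⇒pointwise (r n) (r (suc n)) (mono n) xs e

mex? : {Q : Pred ℕ 0ℓ} → Decidable Q → ∀ n → (∀ k → k < n → Q k) ⊎ ∃[ m ] IsMex m Q
mex? Q? zero = inj₁ λ _ ()
mex? {Q} Q? (suc n) with mex? Q? n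
... | inj₂ m = inj₂ m
... | inj₁ below with Q? n
...   | no ¬q = inj₂ (n , ¬q , below)
...   | yes q = inj₁ λ k k<1+n → case m≤n⇒m<n∨m≡n k<1+n of λ where
          (inj₁ lt)   → below k (s≤s⁻¹ lt)
          (inj₂ refl) → q

-- Labels as sets and their order

infix 4 _⊑_

-- A label can only be replaced later by a larger one.
data _⊑_ : GrayLabel → GrayLabel → Set where
  ⊑-refl   : ∀ {ℓ} → ℓ ⊑ ℓ
  ∞⊑       : ∀ {ℓ} → ∞ ⊑ ℓ
  none⊑    : finite [] ⊑ Full
  all⊑     : cofinite [] ⊑ New

⊑-reflexive : ∀ {ℓ ℓ′} → ℓ ≡ ℓ′ → ℓ ⊑ ℓ′
⊑-reflexive refl = ⊑-refl

⊑-trans : ∀ {ℓ ℓ′ ℓ″} → ℓ ⊑ ℓ′ → ℓ′ ⊑ ℓ″ → ℓ ⊑ ℓ″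
⊑-trans ⊑-refl q = q
⊑-trans ∞⊑ q = ∞⊑
⊑-trans none⊑ ⊑-refl = none⊑
⊑-trans all⊑ ⊑-refl = all⊑

rank : GrayLabel → ℕ
rank New          = 2
rank Full         = 2
rank (finite _)   = 1
rank (cofinite _) = 1
rank ∞            = 0

rank≤2 : ∀ ℓ → rank ℓ ≤ 2
rank≤2 New          = ≤-refl
rank≤2 Full         = ≤-refl
rank≤2 (finite _)   = s≤s z≤n
rank≤2 (cofinite _) = s≤s z≤n
rank≤2 ∞            = z≤n

rank-mono : ∀ {ℓ ℓ′} → ℓ ⊑ ℓ′ → rank ℓ ≤ rank ℓ′
rank-mono ⊑-refl = ≤-refl
rank-mono ∞⊑     = z≤n
rank-mono none⊑  = s≤s z≤n
rank-mono all⊑   = s≤s z≤n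

⊑∧rank≡⇒≡ : ∀ {ℓ ℓ′} → ℓ ⊑ ℓ′ → rank ℓ ≡ rank ℓ′ → ℓ ≡ ℓ′
⊑∧rank≡⇒≡ ⊑-refl _ = refl
⊑∧rank≡⇒≡ (∞⊑ {∞}) _ = refl

complement : GrayLabel → GrayLabel
complement New          = Full
complement Full         = New
complement (finite F)   = cofinite F
complement (cofinite F) = finite F
complement ∞            = ∞

complement-mono : ∀ {ℓ ℓ′} → ℓ ⊑ ℓ′ → complement ℓ ⊑ complement ℓ′
complement-mono ⊑-refl = ⊑-refl
complement-mono ∞⊑     = ∞⊑
complement-mono none⊑  = all⊑
complement-mono all⊑   = none⊑

-- Once white labels are sets too, all rules for gray nodes become one: complement the label of the
-- option.
asSet : WhiteLabel → GrayLabel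
asSet (int k) = finite [ k ]
asSet Full    = Full
asSet Moon    = finite []
asSet ∞       = ∞

asSet-injective : ∀ {ℓ ℓ′} → asSet ℓ ≡ asSet ℓ′ → ℓ ≡ ℓ′
asSet-injective {int k} {int .k} refl = refl
asSet-injective {Full}  {Full}   _ = refl
asSet-injective {Moon}  {Moon}   _ = refl
asSet-injective {∞}     {∞}      _ = refl

_∈ᶜ?_ : ∀ k ℓ → Dec (k ∈ᶜ ℓ)
k ∈ᶜ? New        = no λ ()
k ∈ᶜ? Full       = no λ ()
k ∈ᶜ? finite F   = k ∈? F
k ∈ᶜ? cofinite F = ¬? (k ∈? F)
k ∈ᶜ? ∞          = no λ ()

_≟ʷ_ : DecidableEquality WhiteLabel
int j ≟ʷ int k = map′ (cong int) (λ { refl → refl }) (j ≟ k)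
int _ ≟ʷ Full  = no λ ()
int _ ≟ʷ Moon  = no λ ()
int _ ≟ʷ ∞     = no λ ()
Full  ≟ʷ int _ = no λ ()
Full  ≟ʷ Full  = yes refl
Full  ≟ʷ Moon  = no λ ()
Full  ≟ʷ ∞     = no λ ()
Moon  ≟ʷ int _ = no λ ()
Moon  ≟ʷ Full  = no λ ()
Moon  ≟ʷ Moon  = yes refl
Moon  ≟ʷ ∞     = no λ ()
∞     ≟ʷ int _ = no λ ()
∞     ≟ʷ Full  = no λ ()
∞     ≟ʷ Moon  = no λ ()
∞     ≟ʷ ∞     = yes refl

∞? : ∀ ℓ → Dec (ℓ ≡ GrayLabel.∞)
∞? New          = no λ ()
∞? Full         = no λ ()
∞? (finite _)   = no λ ()
∞? (cofinite _) = no λ ()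
∞? ∞            = yes refl

New? : ∀ ℓ → Dec (ℓ ≡ GrayLabel.New)
New? New          = yes refl
New? Full         = no λ ()
New? (finite _)   = no λ ()
New? (cofinite _) = no λ ()
New? ∞            = no λ ()

elements : GrayLabel → List ℕ
elements (finite F)   = F
elements (cofinite F) = F
elements New          = []
elements Full         = []
elements ∞            = []

-- Numbers that a label does not mention behave alike, so a single test beyond all mentioned numbers
-- settles membership from there on.
∈ᶜ-stable : ∀ ℓ {j k} → j ∉ elements ℓ → k ∉ elements ℓ → j ∈ᶜ ℓ → k ∈ᶜ ℓ
∈ᶜ-stable (finite F)   j∉ _  j∈ = ⊥-elim (j∉ j∈)
∈ᶜ-stable (cofinite F) _  k∉ _  = k∉

-- Finite search over the nodes

module Finite (V : Digraph) where
  open Digraph V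

  anyNode? : {Q : Pred Node 0ℓ} → Decidable Q → Dec (∃ Q)
  anyNode? Q? = map′ Any.satisfied (λ (x , q) → lose (nodes-complete x) q) (Any.any? Q? nodes)

  allNodes? : {Q : Pred Node 0ℓ} → Decidable Q → Dec (∀ x → Q x)
  allNodes? Q? = map′ (λ all x → All.lookup all (nodes-complete x)) (λ q → All.tabulate λ {x} _ → q x)
    (All.all? Q? nodes)

  option⊎terminal : ∀ x → (∃[ x′ ] x ⟶ x′) ⊎ Terminal x
  option⊎terminal x with anyNode? (x ⟶?_)
  ... | yes o = inj₁ o
  ... | no ¬o = inj₂ λ x′ a → ¬o (x′ , a)

  the-option : ∀ {x x′} → Gray x → x ⟶ x′ → (Q : Pred Node 0ℓ) → Q x′ → ∀ {x″} → x ⟶ x″ → Q x″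
  the-option g a Q q a′ = subst Q (gray-outdegree≤1 g a a′) q

-- The rules of the algorithm in uniform terms

module Labels (V : Digraph) where
  open Digraph V
  open Finite V
  open Outcome V
  open Algorithm V
  open Labelling

  label : Labelling → Node → GrayLabel
  label L x with colour x
  ... | white = asSet (𝒢 L x)
  ... | gray  = 𝒞 L x

  label-white : ∀ L {x} → White x → label L x ≡ asSet (𝒢 L x)
  label-white L w rewrite w = refl

  label-gray : ∀ L {x} → Gray x → label L x ≡ 𝒞 L x
  label-gray L g rewrite g = refl

  grayRule⇒complement : ∀ {L x x′ ℓ} → Gray x → x ⟶ x′ → GrayRule L x ℓ → ℓ ≡ complement (label L x′)
  grayRule⇒complement {L} {x} g a = λ where
      (white-Full b w e)    → by b (label-white L w) (cong asSet e)
      (white-int b w e)     → by b (label-white L w) (cong asSet e)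
      (white-Moon b w e)    → by b (label-white L w) (cong asSet e)
      (gray-Full b h e)     → by b (label-gray L h) e
      (gray-New b h e)      → by b (label-gray L h) e
      (gray-finite b h e)   → by b (label-gray L h) e
      (gray-cofinite b h e) → by b (label-gray L h) e
    where
    by : ∀ {y ℓ ℓ′} → x ⟶ y → label L y ≡ ℓ → ℓ ≡ ℓ′ → complement ℓ′ ≡ complement (label L _)
    by b e e′ = cong complement (trans (sym (trans e e′)) (cong (label L) (gray-outdegree≤1 g b a)))

  grayRule-option : ∀ {L x ℓ} → GrayRule L x ℓ → ∃[ x′ ] x ⟶ x′
  grayRule-option (white-Full a _ _)    = _ , a
  grayRule-option (white-int a _ _)     = _ , a
  grayRule-option (white-Moon a _ _)    = _ , a
  grayRule-option (gray-Full a _ _)     = _ , a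
  grayRule-option (gray-New a _ _)      = _ , a
  grayRule-option (gray-finite a _ _)   = _ , a
  grayRule-option (gray-cofinite a _ _) = _ , a

  complement⇒grayRule : ∀ L {x x′} → x ⟶ x′ → label L x′ ≢ ∞ → GrayRule L x (complement (label L x′))
  complement⇒grayRule L {x′ = x′} a ≢∞ with white⊎gray (colour x′)
  ... | inj₁ w rewrite label-white L w with 𝒢 L x′ in e
  ...   | int k = white-int a w e
  ...   | Full  = white-Full a w e
  ...   | Moon  = white-Moon a w e
  ...   | ∞     = ⊥-elim (≢∞ refl)
  complement⇒grayRule L {x′ = x′} a ≢∞ | inj₂ g rewrite label-gray L g with 𝒞 L x′ in e
  ...   | New        = gray-New a g e
  ...   | Full       = gray-Full a g e
  ...   | finite F   = gray-finite a g e
  ...   | cofinite F = gray-cofinite a g e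
  ...   | ∞          = ⊥-elim (≢∞ refl)

  isMex-unique : ∀ {S : Pred ℕ 0ℓ} {m n} → IsMex m S → IsMex n S → m ≡ n
  isMex-unique {m = m} {n} (m∉ , <m) (n∉ , <n) with <-cmp m n
  ... | tri< lt _ _ = ⊥-elim (m∉ (<n m lt))
  ... | tri≈ _ e _  = e
  ... | tri> _ _ gt = ⊥-elim (n∉ (<m n gt))

  whiteRule-unique : ∀ {L x ℓ ℓ′} → WhiteRule L x ℓ → WhiteRule L x ℓ′ → ℓ ≡ ℓ′
  whiteRule-unique (full n)     (full _)      = refl
  whiteRule-unique (full n)     (moon ¬n _)   = ⊥-elim (¬n n)
  whiteRule-unique (full n)     (mex ¬n _ _)  = ⊥-elim (¬n n)
  whiteRule-unique (moon ¬n _)  (full n)      = ⊥-elim (¬n n)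
  whiteRule-unique (moon _ _)   (moon _ _)    = refl
  whiteRule-unique (moon _ u)   (mex _ m _)   = ⊥-elim (proj₁ m (u _))
  whiteRule-unique (mex ¬n _ _) (full n)      = ⊥-elim (¬n n)
  whiteRule-unique (mex _ m _)  (moon _ u)    = ⊥-elim (proj₁ m (u _))
  whiteRule-unique (mex _ m _)  (mex _ m′ _)  = cong int (isMex-unique m m′)

  -- Soundness

  -- During the run ∞ asserts nothing, since it may still be replaced; its meaning at a stationary
  -- labelling is given by `Describes`.
  WhiteMeans : WhiteLabel → Pred Node 0ℓ
  WhiteMeans (int k) = IntValue k
  WhiteMeans Full    = FullMoon
  WhiteMeans Moon    = Lunar
  WhiteMeans ∞       = Pred.U

  Means : GrayLabel → Pred Node 0ℓ
  Means New          x = NewMoon x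
  Means Full         x = FullMoon x
  Means (finite F)   x = (∀ {k} → k ∈ F → Inside k x) × (∀ {k} → k ∉ F → Outside k x)
  Means (cofinite F) x = (∀ {k} → k ∉ F → Inside k x) × (∀ {k} → k ∈ F → Outside k x)
  Means ∞            x = ⊤

  whiteMeans⇒means : ∀ ℓ {x} → WhiteMeans ℓ x → Means (asSet ℓ) x
  whiteMeans⇒means (int k) i = (λ { (here refl) → int i }) , λ k∉ → int i λ { refl → k∉ (here refl) }
  whiteMeans⇒means Full    f = f
  whiteMeans⇒means Moon    l = (λ ()) , λ _ → lunar l
  whiteMeans⇒means ∞       _ = tt

  means-complement : ∀ ℓ {x x′} → Gray x → x ⟶ x′ → Means ℓ x′ → Means (complement ℓ) x
  means-complement New  g a n = full a n
  means-complement Full g a f = new g (the-option g a FullMoon f)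
  means-complement (finite F) g a (i , o) =
    (λ k∉ → gray g (the-option g a (Outside _) (o k∉))) , λ k∈ → gray g a (i k∈)
  means-complement (cofinite F) g a (i , o) =
    (λ k∈ → gray g (the-option g a (Outside _) (o k∈))) , λ k∉ → gray g a (i k∉)
  means-complement ∞ g a _ = tt

  means-inside : ∀ ℓ {k x} → Means ℓ x → k ∈ᶜ ℓ → Inside k x
  means-inside (finite F)   (i , _) k∈ = i k∈
  means-inside (cofinite F) (i , _) k∉ = i k∉

  -- `New` must be excluded: `_∈ᶜ_` treats it as empty, although a new moon is `Inside` every k.
  means-outside : ∀ ℓ {k x} → Means ℓ x → ℓ ≢ New → ℓ ≢ ∞ → ¬ k ∈ᶜ ℓ → Outside k x
  means-outside New          _ ≢New _ _ = ⊥-elim (≢New refl)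
  means-outside Full         f _ _ _    = full⇒outside f
  means-outside (finite F)   (_ , o) _ _ k∉  = o k∉
  means-outside (cofinite F) {k} (_ , o) _ _ ¬k∉ = o (decidable-stable (k ∈? F) ¬k∉)
  means-outside ∞            _ _ ≢∞ _   = ⊥-elim (≢∞ refl)

  record Sound (L : Labelling) : Set where
    field
      white-sound : ∀ {x} → White x → WhiteMeans (𝒢 L x) x
      gray-sound  : ∀ {x} → Gray x → Means (𝒞 L x) x

    label-sound : ∀ x → Means (label L x) x
    label-sound x with white⊎gray (colour x)
    ... | inj₁ w rewrite label-white L w = whiteMeans⇒means (𝒢 L x) (white-sound w)
    ... | inj₂ g rewrite label-gray L g  = gray-sound g

  OptionLabels : Labelling → Node → Pred ℕ 0ℓ
  OptionLabels L x k = ∃[ x′ ] x ⟶ x′ × k ∈ᶜ label L x′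

  optionLabels⁺ : ∀ L {x k} → (D L x ∪ P L x) k → OptionLabels L x k
  optionLabels⁺ L (inj₁ (x′ , a , w , e)) = x′ , a , subst (_ ∈ᶜ_) (sym (trans (label-white L w) (cong asSet e))) (here refl)
  optionLabels⁺ L (inj₂ (x′ , a , g , k∈)) = x′ , a , subst (_ ∈ᶜ_) (sym (label-gray L g)) k∈

  optionLabels⁻ : ∀ L {x k} → OptionLabels L x k → (D L x ∪ P L x) k
  optionLabels⁻ L (x′ , a , k∈) with white⊎gray (colour x′)
  ... | inj₂ g = inj₂ (x′ , a , g , subst (_ ∈ᶜ_) (label-gray L g) k∈)
  ... | inj₁ w with 𝒢 L x′ in e | subst (_ ∈ᶜ_) (label-white L w) k∈
  ...   | int j | here refl = inj₁ (x′ , a , w , e)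

  unassigned : ∀ L {x} → label L x ≡ ∞ → Unassigned L x
  unassigned L {x} e with white⊎gray (colour x)
  ... | inj₁ w = inj₁ (w , asSet-injective (trans (sym (label-white L w)) e))
  ... | inj₂ g = inj₂ (g , trans (sym (label-gray L g)) e)

  unassigned⇒∞ : ∀ L {x} → Unassigned L x → label L x ≡ ∞
  unassigned⇒∞ L (inj₁ (w , e)) = trans (label-white L w) (cong asSet e)
  unassigned⇒∞ L (inj₂ (g , e)) = trans (label-gray L g) e

  newOption⁺ : ∀ L {x x′} → x ⟶ x′ → label L x′ ≡ New → NewOption L x
  newOption⁺ L {x′ = x′} a e with white⊎gray (colour x′)
  ... | inj₂ g = x′ , a , g , trans (sym (label-gray L g)) e
  ... | inj₁ w with 𝒢 L x′ | trans (sym (label-white L w)) e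
  ...   | int _ | ()
  ...   | Full  | ()
  ...   | Moon  | ()
  ...   | ∞     | ()

  module _ {L : Labelling} (sound : Sound L) where
    open Sound sound

    mutual
      cr-sound : ∀ {k x} → Cr L k x → Prev k x
      cr-sound (cr g o) = gray g λ {x′} a → crOption-sound (o x′ a)

      crOption-sound : ∀ {k x} → CrOption L k x → Next k x
      crOption-sound (white-Moon w e)  = lunar (subst (λ ℓ → WhiteMeans ℓ _) e (white-sound w))
      crOption-sound (white-Full w e)  = outside⇒next (full⇒outside (subst (λ ℓ → WhiteMeans ℓ _) e (white-sound w)))
      crOption-sound (white-int w e n) = int (subst (λ ℓ → WhiteMeans ℓ _) e (white-sound w)) n
      crOption-sound (to-white a w e)  = move a (int (subst (λ ℓ → WhiteMeans ℓ _) e (white-sound w)))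
      crOption-sound (to-gray a g c)   = move a (cr-sound c)

    reverts-sound : ∀ {m x} → Reverts L m x → Next m x
    reverts-sound (x′ , a , inj₁ (w , e)) = crOption-sound (to-white a w e)
    reverts-sound (x′ , a , inj₂ (g , c)) = crOption-sound (to-gray a g c)

    covered-sound : ∀ {k x} → (D L x ∪ P L x) k → Covered k x
    covered-sound u with x′ , a , k∈ ← optionLabels⁺ L u = covered a (means-inside (label L x′) (label-sound x′) k∈)

    newOption-sound : ∀ {x} → NewOption L x → FullMoon x
    newOption-sound (x′ , a , g , e) = full a (subst (λ ℓ → Means ℓ x′) e (gray-sound g))

    whiteRule-sound : ∀ {x ℓ} → White x → WhiteRule L x ℓ → WhiteMeans ℓ x
    whiteRule-sound w (full n)       = newOption-sound n
    whiteRule-sound w (moon _ u)     = lunar w λ k → covered-sound (u k)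
    whiteRule-sound w (mex {m} ¬n (m∉ , <m) r) = intValue w (λ {k} lt → covered-sound (<m k lt)) wins
      where
      wins : ∀ {x′} → _ ⟶ x′ → Next m x′
      -- The mex rule asks only unassigned options to revert. An assigned option is not `New`, and
      -- its label omits m because m is the mex, so it is `Outside`.
      wins {x′} a with ∞? (label L x′)
      ... | yes e = reverts-sound (r x′ a (unassigned L e))
      ... | no ≢∞ = outside⇒next (means-outside (label L x′) (label-sound x′)
              (λ e → ¬n (newOption⁺ L a e)) ≢∞ λ m∈ → m∉ (optionLabels⁻ L (x′ , a , m∈)))

    grayRule-sound : ∀ {x ℓ} → Gray x → GrayRule L x ℓ → Means ℓ x
    grayRule-sound {x} g r with option⊎terminal x
    ... | inj₁ (x′ , a) rewrite grayRule⇒complement g a r = means-complement (label L x′) g a (label-sound x′)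
    ... | inj₂ t = ⊥-elim (t _ (proj₂ (grayRule-option r)))

    step-sound : ∀ {L′} → Step L L′ → Sound L′
    step-sound {L′} step = record { white-sound = white′ ; gray-sound = gray′ }
      where
      open Step step
      white′ : ∀ {x} → White x → WhiteMeans (𝒢 L′ x) x
      white′ w with white-step w
      ... | inj₁ r       = whiteRule-sound w r
      ... | inj₂ (_ , e) = subst (λ ℓ → WhiteMeans ℓ _) (sym e) (white-sound w)
      gray′ : ∀ {x} → Gray x → Means (𝒞 L′ x) x
      gray′ g with gray-step g
      ... | inj₁ r       = grayRule-sound g r
      ... | inj₂ (_ , e) = subst (λ ℓ → Means ℓ _) (sym e) (gray-sound g)

  -- Existence of the final labelling

  -- Soundness alone would let Full fall back to Moon, since a full moon is lunar. The other fields
  -- keep the causes of labels: Full retains a `New` option, and a gray label may lag behind the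
  -- complement of its option's label but never contradicts it.
  record Invariant (L : Labelling) : Set where
    field
      sound          : Sound L
      full-justified : ∀ {x} → White x → 𝒢 L x ≡ Full → NewOption L x
      gray-terminal  : ∀ {x} → Gray x → Terminal x → 𝒞 L x ≡ New
      gray-justified : ∀ {x x′} → Gray x → x ⟶ x′ → 𝒞 L x ⊑ complement (label L x′)
    open Sound sound public

  _⊑ᴸ_ : Labelling → Labelling → Set
  L ⊑ᴸ L′ = ∀ x → label L x ⊑ label L′ x

  initial-invariant : ∀ {L} → Initial L → Invariant L
  initial-invariant {L} init = record
    { sound          = record { white-sound = white′ ; gray-sound = gray′ }
    ; full-justified = full′
    ; gray-terminal  = gray-terminal
    ; gray-justified = λ {x} {x′} g a →
        subst (_⊑ complement (label L x′)) (sym (gray-nonterminal g λ t → t _ a)) ∞⊑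
    }
    where
    open Initial init
    white′ : ∀ {x} → White x → WhiteMeans (𝒢 L x) x
    white′ {x} w with option⊎terminal x
    ... | inj₁ (x′ , a) rewrite white-nonterminal w (λ t → t x′ a) = tt
    ... | inj₂ t rewrite white-terminal w t = intValue w (λ ()) λ a → ⊥-elim (t _ a)
    gray′ : ∀ {x} → Gray x → Means (𝒞 L x) x
    gray′ {x} g with option⊎terminal x
    ... | inj₁ (x′ , a) rewrite gray-nonterminal g (λ t → t x′ a) = tt
    ... | inj₂ t rewrite gray-terminal g t = new g λ a → ⊥-elim (t _ a)
    full′ : ∀ {x} → White x → 𝒢 L x ≡ Full → NewOption L x
    full′ {x} w e with option⊎terminal x
    ... | inj₁ (x′ , a) with () ← trans (sym e) (white-nonterminal w (λ t → t x′ a))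
    ... | inj₂ t with () ← trans (sym e) (white-terminal w t)

  rule-≢∞ : ∀ {L x} → ¬ WhiteRule L x ∞
  rule-≢∞ ()

  module _ {L L′ : Labelling} (inv : Invariant L) (step : Step L L′) where
    open Invariant inv
    open Step step
    private module S′ = Sound (step-sound sound step)

    step-full : ∀ {x} → White x → NewOption L x → 𝒢 L′ x ≡ Full
    step-full w n with white-step w
    ... | inj₁ r       = whiteRule-unique r (full n)
    ... | inj₂ (¬r , _) = ⊥-elim (¬r _ (full n))

    -- The outcomes exclude most changes, as integers are unique and incompatible with moons. What
    -- remains is a first assignment, the passage from Moon to Full, and Full itself, which persists
    -- by `full-justified`.
    step-white : ∀ {x} → White x → asSet (𝒢 L x) ⊑ asSet (𝒢 L′ x)
    step-white {x} w with white-step w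
    ... | inj₂ (_ , e) = ⊑-reflexive (cong asSet (sym e))
    ... | inj₁ r with 𝒢 L x in e | 𝒢 L′ x in e′ | white-sound w | S′.white-sound w
    ... | int j | int k | i | i′ = ⊑-reflexive (cong (asSet ∘ int) (int-unique i i′))
    ... | int j | Full  | i | f  = ⊥-elim (int∧lunar⇒⊥ i (full⇒lunar w f))
    ... | int j | Moon  | i | l  = ⊥-elim (int∧lunar⇒⊥ i l)
    ... | Full  | ℓ     | _ | _  =
      ⊑-reflexive (cong asSet (trans (sym (step-full w (full-justified w e))) e′))
    ... | Moon  | int k | l | i  = ⊥-elim (int∧lunar⇒⊥ i l)
    ... | Moon  | Full  | _ | _  = none⊑
    ... | Moon  | Moon  | _ | _  = ⊑-refl
    ... | ∞     | _     | _ | _  = ∞⊑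
    ... | int j | ∞     | _ | _  = ⊥-elim (rule-≢∞ r)
    ... | Moon  | ∞     | _ | _  = ⊥-elim (rule-≢∞ r)

    step-gray : ∀ {x x′} → Gray x → x ⟶ x′ → 𝒞 L x ⊑ 𝒞 L′ x × 𝒞 L′ x ⊑ complement (label L x′)
    step-gray {x} g a with gray-step g
    ... | inj₁ r       = subst (𝒞 L x ⊑_) (sym e) (gray-justified g a) , ⊑-reflexive e
      where e = grayRule⇒complement g a r
    ... | inj₂ (_ , e) = ⊑-reflexive (sym e) , subst (_⊑ _) (sym e) (gray-justified g a)

    step-terminal : ∀ {x} → Gray x → Terminal x → 𝒞 L′ x ≡ New
    step-terminal g t with gray-step g
    ... | inj₂ (_ , e) = trans e (gray-terminal g t)
    ... | inj₁ r       = ⊥-elim (t _ (proj₂ (grayRule-option r)))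

    step-⊑ : L ⊑ᴸ L′
    step-⊑ x with white⊎gray (colour x)
    ... | inj₁ w rewrite label-white L w | label-white L′ w = step-white w
    ... | inj₂ g rewrite label-gray L g | label-gray L′ g with option⊎terminal x
    ...   | inj₁ (x′ , a) = proj₁ (step-gray g a)
    ...   | inj₂ t        = ⊑-reflexive (trans (gray-terminal g t) (sym (step-terminal g t)))

    step-newOption : ∀ {x} → NewOption L x → NewOption L′ x
    step-newOption (x′ , a , g , e) = newOption⁺ L′ a (new-⊑ (subst (_⊑ _) (trans (label-gray L g) e) (step-⊑ x′)))
      where
      new-⊑ : ∀ {ℓ} → New ⊑ ℓ → ℓ ≡ New
      new-⊑ ⊑-refl = refl

    step-invariant : Invariant L′
    step-invariant = record
      { sound          = step-sound sound step
      ; full-justified = λ w e → step-newOption (justified w e)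
      ; gray-terminal  = step-terminal
      ; gray-justified = λ {_} {x′} g a → ⊑-trans (proj₂ (step-gray g a)) (complement-mono (step-⊑ x′))
      }
      where
      justified : ∀ {x} → White x → 𝒢 L′ x ≡ Full → NewOption L x
      justified w e with white-step w
      ... | inj₂ (_ , e′) = full-justified w (trans (sym e′) e)
      ... | inj₁ r with full n ← subst (WhiteRule L _) e r = n

  atStep-invariant : ∀ {n L} → AtStep n L → Invariant L
  atStep-invariant (start i)   = initial-invariant i
  atStep-invariant (next at s) = step-invariant (atStep-invariant at) s

  module _ (L : Labelling) where

    -- The cases of `CrOption` without a recursive call, which finite search decides directly.
    Immediate : ℕ → Node → Set
    Immediate k x′ = (White x′ × 𝒢 L x′ ≢ ∞ × 𝒢 L x′ ≢ int k)
                   ⊎ (∃[ x″ ] x′ ⟶ x″ × White x″ × 𝒢 L x″ ≡ int k)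

    immediate? : ∀ k → Decidable (Immediate k)
    immediate? k x′ =
      (colour x′ ≟ᶜ white ×-dec ¬? (𝒢 L x′ ≟ʷ ∞) ×-dec ¬? (𝒢 L x′ ≟ʷ int k))
      ⊎-dec anyNode? λ x″ → x′ ⟶? x″ ×-dec colour x″ ≟ᶜ white ×-dec 𝒢 L x″ ≟ʷ int k

    immediate-crOption : ∀ {k x′} → Immediate k x′ → CrOption L k x′
    immediate-crOption {k} {x′} (inj₁ (w , ≢∞ , ≢k)) with 𝒢 L x′ in e
    ... | int j = white-int w e λ { refl → ≢k refl }
    ... | Full  = white-Full w e
    ... | Moon  = white-Moon w e
    ... | ∞     = ⊥-elim (≢∞ refl)
    immediate-crOption (inj₂ (x″ , a , w , e)) = to-white a w e

    CrWithin : ℕ → ℕ → Node → Set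
    CrWithin k zero    x = ⊥
    CrWithin k (suc d) x =
      Gray x × (∀ x′ → x ⟶ x′ → Immediate k x′ ⊎ (∃[ x″ ] x′ ⟶ x″ × Gray x″ × CrWithin k d x″))

    crWithin? : ∀ k d → Decidable (CrWithin k d)
    crWithin? k zero    x = no λ ()
    crWithin? k (suc d) x = colour x ≟ᶜ gray ×-dec allNodes? λ x′ → (x ⟶? x′) →-dec
      (immediate? k x′ ⊎-dec anyNode? λ x″ → x′ ⟶? x″ ×-dec colour x″ ≟ᶜ gray ×-dec crWithin? k d x″)

    crWithin-suc : ∀ k d {x} → CrWithin k d x → CrWithin k (suc d) x
    crWithin-suc k (suc d) (g , o) = g , λ x′ a → Sum.map₂
      (λ (x″ , a′ , g′ , c) → x″ , a′ , g′ , crWithin-suc k d c) (o x′ a)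

    crWithin-cr : ∀ k d {x} → CrWithin k d x → Cr L k x
    crWithin-cr k (suc d) (g , o) = cr g λ x′ a →
      [ immediate-crOption , (λ (x″ , a′ , g′ , c) → to-gray a′ g′ (crWithin-cr k d c)) ]′ (o x′ a)

    -- With cycles present, `Cr` cannot be decided by recursion along arcs. Bounding the nesting
    -- gives an increasing family of decidable sets; where two consecutive ones agree, the set is
    -- closed under the clauses of `Cr` and so contains it.
    cr? : ∀ k → Decidable (Cr L k)
    cr? k x = map′ (crWithin-cr k depth) cr-within (crWithin? k depth x)
      where
      size : ∀ {A : Set} → Dec A → ℕ
      size (yes _) = 1
      size (no _)  = 0

      size-mono : ∀ {A B : Set} (a? : Dec A) (b? : Dec B) → (A → B) → size a? ≤ size b?
      size-mono (no _)  _       _ = z≤n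
      size-mono (yes _) (yes _) _ = ≤-refl
      size-mono (yes a) (no ¬b) f = ⊥-elim (¬b (f a))

      size≤1 : ∀ {A : Set} (a? : Dec A) → size a? ≤ 1
      size≤1 (yes _) = ≤-refl
      size≤1 (no _)  = z≤n

      size-≡ : ∀ {A B : Set} (a? : Dec A) (b? : Dec B) → size a? ≡ size b? → B → A
      size-≡ (yes a) _       _ _ = a
      size-≡ (no _)  (no ¬b) _ b = ⊥-elim (¬b b)

      stable = stationary nodes (λ d x → size (crWithin? k d x)) 1
        (λ d x → size-mono (crWithin? k d x) (crWithin? k (suc d) x) (crWithin-suc k d))
        (λ d x → size≤1 (crWithin? k d x))

      depth = proj₁ stable

      shrink : ∀ {x} → CrWithin k (suc depth) x → CrWithin k depth x
      shrink {x} = size-≡ (crWithin? k depth x) (crWithin? k (suc depth) x) (proj₂ stable (nodes-complete x))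

      mutual
        cr-within : ∀ {x} → Cr L k x → CrWithin k depth x
        cr-within (cr g o) = shrink (g , λ x′ a → crOption-within (o x′ a))

        crOption-within : ∀ {x′} → CrOption L k x′ →
          Immediate k x′ ⊎ (∃[ x″ ] x′ ⟶ x″ × Gray x″ × CrWithin k depth x″)
        crOption-within (white-Moon w e) =
          inj₁ (inj₁ (w , (λ e′ → case trans (sym e) e′ of λ ()) , λ e′ → case trans (sym e) e′ of λ ()))
        crOption-within (white-Full w e) =
          inj₁ (inj₁ (w , (λ e′ → case trans (sym e) e′ of λ ()) , λ e′ → case trans (sym e) e′ of λ ()))
        crOption-within (white-int w e ≢k) =
          inj₁ (inj₁ (w , (λ e′ → case trans (sym e) e′ of λ ()) , λ e′ → case trans (sym e) e′ of λ { refl → ≢k refl }))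
        crOption-within (to-white a w e) = inj₁ (inj₂ (_ , a , w , e))
        crOption-within (to-gray a g c) = inj₂ (_ , a , g , cr-within c)

    reverts? : ∀ m → Decidable (Reverts L m)
    reverts? m x′ = anyNode? λ x″ → x′ ⟶? x″ ×-dec
      ((colour x″ ≟ᶜ white ×-dec 𝒢 L x″ ≟ʷ int m) ⊎-dec (colour x″ ≟ᶜ gray ×-dec cr? m x″))

    newOption? : Decidable (NewOption L)
    newOption? x = anyNode? λ x′ → x ⟶? x′ ×-dec colour x′ ≟ᶜ gray ×-dec New? (𝒞 L x′)

    optionLabels? : ∀ x → Decidable (OptionLabels L x)
    optionLabels? x k = anyNode? λ x′ → x ⟶? x′ ×-dec k ∈ᶜ? label L x′

    -- Exceeds every number mentioned by a label. At a stationary labelling it is therefore no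
    -- node's value, which makes it the fresh integer of `Solution`.
    bound : ℕ
    bound = suc (max 0 (concatMap (elements ∘ label L) nodes))

    bound≤⇒∉ : ∀ {k} x → bound ≤ k → k ∉ elements (label L x)
    bound≤⇒∉ x b≤k k∈ = <⇒≱ b≤k (All.lookup (xs≤max 0 (concatMap (elements ∘ label L) nodes))
      (∈-concatMap⁺ (elements ∘ label L) (lose (nodes-complete x) k∈)))

    optionLabels-mex : ∀ x → Pred.Universal (OptionLabels L x) ⊎ (∃[ m ] IsMex m (OptionLabels L x))
    -- The search includes `bound` itself: a label that contains it contains all larger numbers as
    -- well.
    optionLabels-mex x with mex? (optionLabels? x) (suc bound)
    ... | inj₂ m     = inj₂ m
    ... | inj₁ below = inj₁ everything
      where
      everything : Pred.Universal (OptionLabels L x)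
      everything k with k <? bound | below bound ≤-refl
      ... | yes lt | _ = below k (m≤n⇒m≤1+n lt)
      ... | no ≮   | x′ , a , b∈ =
        x′ , a , ∈ᶜ-stable (label L x′) (bound≤⇒∉ x′ ≤-refl) (bound≤⇒∉ x′ (≮⇒≥ ≮)) b∈

    isMex⁻ : ∀ {m x} → IsMex m (OptionLabels L x) → IsMex m (D L x ∪ P L x)
    isMex⁻ (m∉ , <m) = (λ m∈ → m∉ (optionLabels⁺ L m∈)) , λ k k<m → optionLabels⁻ L (<m k k<m)

    -- The failure of all rules in positive form; its mex and its unanswered option become the gap
    -- and the escape of `Undecided`.
    data Stuck (x : Node) : Set where
      stuck : ∀ {m x′} → ¬ NewOption L x → IsMex m (D L x ∪ P L x) →
              x ⟶ x′ → Unassigned L x′ → ¬ Reverts L m x′ → Stuck x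

    stuck⇒noRule : ∀ {x} → Stuck x → ∀ ℓ → ¬ WhiteRule L x ℓ
    stuck⇒noRule (stuck ¬n _ _ _ _) _ (full n)   = ¬n n
    stuck⇒noRule (stuck _ m _ _ _)  _ (moon _ u) = proj₁ m (u _)
    stuck⇒noRule (stuck _ m a u ¬r) _ (mex _ m′ r) rewrite isMex-unique m m′ = ¬r (r _ a u)

    whiteRule? : ∀ x → (∃[ ℓ ] WhiteRule L x ℓ) ⊎ Stuck x
    whiteRule? x with newOption? x
    ... | yes n = inj₁ (Full , full n)
    ... | no ¬n with optionLabels-mex x
    ...   | inj₁ u = inj₁ (Moon , moon ¬n λ k → optionLabels⁻ L (u k))
    ...   | inj₂ (m , m∉ , <m) with anyNode? (λ x′ → x ⟶? x′ ×-dec ∞? (label L x′) ×-dec ¬? (reverts? m x′))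
    ...     | yes (x′ , a , e , ¬r) = inj₂ (stuck ¬n (isMex⁻ (m∉ , <m)) a (unassigned L e) ¬r)
    ...     | no ¬u = inj₁ (int m , mex ¬n (isMex⁻ (m∉ , <m)) λ x′ a u →
                decidable-stable (reverts? m x′) λ ¬r → ¬u (x′ , a , unassigned⇒∞ L u , ¬r))

    grayRule? : ∀ x → Gray x → (∃[ ℓ ] GrayRule L x ℓ) ⊎ (∀ ℓ → ¬ GrayRule L x ℓ)
    grayRule? x g with option⊎terminal x
    ... | inj₂ t = inj₂ λ ℓ r → t _ (proj₂ (grayRule-option r))
    ... | inj₁ (x′ , a) with ∞? (label L x′)
    ...   | no ≢∞ = inj₁ (_ , complement⇒grayRule L a ≢∞)
    ...   | yes e = inj₂ λ ℓ r → noRule r (trans (grayRule⇒complement g a r) (cong complement e))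
      where
      noRule : ∀ {ℓ} → GrayRule L x ℓ → ℓ ≢ ∞
      noRule (white-Full _ _ _) ()
      noRule (white-int _ _ _) ()
      noRule (white-Moon _ _ _) ()
      noRule (gray-Full _ _ _) ()
      noRule (gray-New _ _ _) ()
      noRule (gray-finite _ _ _) ()
      noRule (gray-cofinite _ _ _) ()

    updated : Labelling
    updated = record
      { 𝒢 = λ x → [ proj₁ , (λ _ → 𝒢 L x) ]′ (whiteRule? x)
      ; 𝒞 = 𝒞′
      }
      where
      𝒞′ : Node → GrayLabel
      𝒞′ x with white⊎gray (colour x)
      ... | inj₁ _ = 𝒞 L x
      ... | inj₂ g = [ proj₁ , (λ _ → 𝒞 L x) ]′ (grayRule? x g)

    updated-step : Step L updated
    updated-step = record { white-step = white′ ; gray-step = gray′ }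
      where
      white′ : ∀ {x} → White x → Update (WhiteRule L x) (𝒢 L x) (𝒢 updated x)
      white′ {x} _ with whiteRule? x
      ... | inj₁ (ℓ , r) = inj₁ r
      ... | inj₂ s       = inj₂ (stuck⇒noRule s , refl)
      gray′ : ∀ {x} → Gray x → Update (GrayRule L x) (𝒞 L x) (𝒞 updated x)
      gray′ {x} g with white⊎gray (colour x)
      ... | inj₁ w = ⊥-elim (gray≢white g w)
      ... | inj₂ g′ with grayRule? x g′
      ...   | inj₁ (ℓ , r) = inj₁ r
      ...   | inj₂ ¬r      = inj₂ (¬r , refl)

  initial : Labelling
  initial = record
    { 𝒢 = λ x → [ (λ _ → ∞) , (λ _ → int 0) ]′ (option⊎terminal x)
    ; 𝒞 = λ x → [ (λ _ → ∞) , (λ _ → New) ]′ (option⊎terminal x)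
    }

  initial-isInitial : Initial initial
  initial-isInitial = record
    { white-terminal    = λ {x} _ t → terminal x t
    ; white-nonterminal = λ {x} _ ¬t → nonterminal x ¬t
    ; gray-terminal     = λ {x} _ t → terminal x t
    ; gray-nonterminal  = λ {x} _ ¬t → nonterminal x ¬t
    }
    where
    terminal : ∀ {A : Set} {a b : A} x → Terminal x → [ (λ _ → a) , (λ _ → b) ]′ (option⊎terminal x) ≡ b
    terminal x t with option⊎terminal x
    ... | inj₁ (_ , a) = ⊥-elim (t _ a)
    ... | inj₂ _       = refl
    nonterminal : ∀ {A : Set} {a b : A} x → ¬ Terminal x → [ (λ _ → a) , (λ _ → b) ]′ (option⊎terminal x) ≡ a
    nonterminal x ¬t with option⊎terminal x
    ... | inj₁ _ = refl
    ... | inj₂ t = ⊥-elim (¬t t)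

  run : ℕ → Labelling
  run zero    = initial
  run (suc n) = updated (run n)

  run-atStep : ∀ n → AtStep n (run n)
  run-atStep zero    = start initial-isInitial
  run-atStep (suc n) = next (run-atStep n) (updated-step (run n))

  run-⊑ : ∀ n → run n ⊑ᴸ run (suc n)
  run-⊑ n = step-⊑ (atStep-invariant (run-atStep n)) (updated-step (run n))

  final-exists : ∃[ L ] Final L
  final-exists =
    let n , e = stationary nodes (λ n x → rank (label (run n) x)) 2
                  (λ n x → rank-mono (run-⊑ n x)) (λ n x → rank≤2 (label (run n) x))
        same : ∀ x → label (run n) x ≡ label (run (suc n)) x
        same x = ⊑∧rank≡⇒≡ (run-⊑ n x) (e (nodes-complete x))
    in run (suc n) , n , run n , run-atStep n , updated-step (run n) , record
         { white-unchanged = λ {x} w → asSet-injective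
             (trans (sym (label-white (run (suc n)) w)) (trans (sym (same x)) (label-white (run n) w)))
         ; gray-unchanged  = λ {x} g →
             trans (sym (label-gray (run (suc n)) g)) (trans (sym (same x)) (label-gray (run n) g))
         }

  -- Completeness of stationary labellings

  -- Unlike `_∈ᶜ_`, this reading gives `New` every integer, as `Inside` does. At ∞ both predicates
  -- fail, so each of them shows that a label has been assigned.
  Contains Excludes : ℕ → GrayLabel → Set
  Contains k New          = ⊤
  Contains k Full         = ⊥
  Contains k (finite F)   = k ∈ F
  Contains k (cofinite F) = k ∉ F
  Contains k ∞            = ⊥
  Excludes k ℓ = Contains k (complement ℓ)

  contains-∈ᶜ : ∀ ℓ {k} → ℓ ≢ New → Contains k ℓ → k ∈ᶜ ℓ
  contains-∈ᶜ New          ≢New _ = ⊥-elim (≢New refl)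
  contains-∈ᶜ (finite F)   _ k∈ = k∈
  contains-∈ᶜ (cofinite F) _ k∉ = k∉

  complement-involutive : ∀ ℓ → complement (complement ℓ) ≡ ℓ
  complement-involutive New          = refl
  complement-involutive Full         = refl
  complement-involutive (finite F)   = refl
  complement-involutive (cofinite F) = refl
  complement-involutive ∞            = refl

  Describes : WhiteLabel → Node → Set
  Describes (int k) x = IntValue k x
  Describes Full    x = FullMoon x
  Describes Moon    x = Lunar x × ¬ FullMoon x
  Describes ∞       x = Undecided x

  -- All that is used of a final labelling from here on: white labels are determined by outcomes,
  -- and step numbers no longer occur.
  record Solution (L : Labelling) : Set where
    field
      describes : ∀ {x} → White x → Describes (𝒢 L x) x
      fresh     : ℕ
      fresh-int : ∀ {x} → ¬ IntValue fresh x

    kind : ∀ {x} → White x → Kind x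
    kind {x} w with 𝒢 L x | describes w
    ... | int _ | i     = int i
    ... | Full  | f     = lunar (full⇒lunar w f)
    ... | Moon  | l , _ = lunar l
    ... | ∞     | u     = undecided u

    full-label : ∀ {x} → White x → FullMoon x → 𝒢 L x ≡ Full
    full-label {x} w f with 𝒢 L x | describes w
    ... | int k | i       = ⊥-elim (int∧lunar⇒⊥ i (full⇒lunar w f))
    ... | Full  | _       = refl
    ... | Moon  | _ , ¬f  = ⊥-elim (¬f f)
    ... | ∞     | u       = ⊥-elim (Undecided.¬lunar u (full⇒lunar w f))

    moon-label : ∀ {x} → Lunar x → ¬ FullMoon x → 𝒢 L x ≡ Moon
    moon-label {x} l@(lunar w _) ¬f with 𝒢 L x | describes w
    ... | int k | i  = ⊥-elim (int∧lunar⇒⊥ i l)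
    ... | Full  | f  = ⊥-elim (¬f f)
    ... | Moon  | _  = refl
    ... | ∞     | u  = ⊥-elim (Undecided.¬lunar u l)

    int-label : ∀ {k x} → IntValue k x → 𝒢 L x ≡ int k
    int-label {x = x} i with 𝒢 L x | describes (int-white i)
    ... | int j | i′ = cong int (int-unique i′ i)
    ... | Full  | f  = ⊥-elim (int∧lunar⇒⊥ i (full⇒lunar (int-white i) f))
    ... | Moon  | l , _ = ⊥-elim (int∧lunar⇒⊥ i l)
    ... | ∞     | u  = ⊥-elim (Undecided.¬int u i)

    undecided-label : ∀ {x} → White x → (∀ {n} → ¬ IntValue n x) → ¬ Lunar x → 𝒢 L x ≡ ∞
    undecided-label {x} w ¬i ¬l with 𝒢 L x | describes w
    ... | int j | i     = ⊥-elim (¬i i)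
    ... | Full  | f     = ⊥-elim (¬l (full⇒lunar w f))
    ... | Moon  | l , _ = ⊥-elim (¬l l)
    ... | ∞     | _     = refl

    label-describes : ∀ {x ℓ} → White x → 𝒢 L x ≡ ℓ → Describes ℓ x
    label-describes w e = subst (λ ℓ → Describes ℓ _) e (describes w)

    forces⁺ : ∀ {k x} → 𝐅 L x k → Forces k x
    forces⁺ (here a g a′ w e)  = here a g a′ (label-describes w e)
    forces⁺ (later a g a′ f)   = later a g a′ (forces⁺ f)

    forces⁻ : ∀ {k x} → Forces k x → 𝐅 L x k
    forces⁻ (here a g a′ i)  = here a g a′ (int-white i) (int-label i)
    forces⁻ (later a g a′ f) = later a g a′ (forces⁻ f)

    directs⁺ : ∀ {k x} → 𝐃 L x k → Directs k x
    directs⁺ (via-white a w e) = via-white a (label-describes w e)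
    directs⁺ (via-gray a g o)  = via-gray a g λ {x″} a′ → directs⁺ (o x″ a′)

    directs⁻ : ∀ {k x} → Directs k x → 𝐃 L x k
    directs⁻ (via-white a i)  = via-white a (int-white i) (int-label i)
    directs⁻ (via-gray a g o) = via-gray a g λ x″ a′ → directs⁻ (o a′)

  module _ {L : Labelling} (inv : Invariant L) (step : Step L L) where
    open Invariant inv
    open Step step

    white-rule : ∀ {x ℓ} → White x → WhiteRule L x ℓ → 𝒢 L x ≡ ℓ
    white-rule w r with white-step w
    ... | inj₁ r′       = whiteRule-unique r′ r
    ... | inj₂ (¬r , _) = ⊥-elim (¬r _ r)

    -- At a stationary labelling the lag allowed by the invariant disappears. If no rule applies,
    -- the option is unassigned, and `gray-justified` then forces ∞ on x.
    option-label : ∀ {x x′} → Gray x → x ⟶ x′ → label L x ≡ complement (label L x′)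
    option-label {x} {x′} g a rewrite label-gray L g with gray-step g | gray-justified g a
    ... | inj₁ r | _ = grayRule⇒complement g a r
    ... | inj₂ (¬r , _) | j with ∞? (label L x′)
    ...   | no ≢∞ = ⊥-elim (¬r _ (complement⇒grayRule L a ≢∞))
    ...   | yes e rewrite e with 𝒞 L x | j
    ...     | _ | ⊑-refl = refl
    ...     | _ | ∞⊑     = refl

    terminal-label : ∀ {x} → Gray x → Terminal x → label L x ≡ New
    terminal-label g t = trans (label-gray L g) (gray-terminal g t)

    mutual
      new-label : ∀ {x} → NewMoon x → label L x ≡ New
      new-label {x} (new g o) with option⊎terminal x
      ... | inj₁ (x′ , a) = trans (option-label g a) (cong complement (fullMoon-label (o a)))
      ... | inj₂ t        = terminal-label g t

      fullMoon-label : ∀ {x} → FullMoon x → label L x ≡ Full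
      fullMoon-label {x} (full a n) with white⊎gray (colour x)
      ... | inj₁ w = trans (label-white L w) (cong asSet (white-rule w (full (newOption⁺ L a (new-label n)))))
      ... | inj₂ g = trans (option-label g a) (cong complement (new-label n))

    option-contains : ∀ {k x x′} → Gray x → x ⟶ x′ → Excludes k (label L x′) → Contains k (label L x)
    option-contains {k} g a = subst (Contains k) (sym (option-label g a))

    option-excludes : ∀ {k x x′} → Gray x → x ⟶ x′ → Contains k (label L x′) → Excludes k (label L x)
    option-excludes {k} g a c = subst (λ ℓ → Contains k ℓ)
      (sym (trans (cong complement (option-label g a)) (complement-involutive (label L _)))) c

    assigned : ∀ {x ℓ} → White x → 𝒢 L x ≡ ℓ → ℓ ≢ ∞ → ¬ Unassigned L x
    assigned w e ≢∞ (inj₁ (_ , e′)) = ≢∞ (trans (sym e) e′)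
    assigned w e ≢∞ (inj₂ (g , _))  = gray≢white g w

    -- A win at an option may rest on the option's own label, but the mex rule demands a reversal;
    -- for an unassigned option the first kind of win is void.
    crOption-reverts : ∀ {m x} → CrOption L m x → Unassigned L x → Reverts L m x
    crOption-reverts (white-Moon w e)  u = ⊥-elim (assigned w e (λ ()) u)
    crOption-reverts (white-Full w e)  u = ⊥-elim (assigned w e (λ ()) u)
    crOption-reverts (white-int w e _) u = ⊥-elim (assigned w e (λ ()) u)
    crOption-reverts (to-white a w e)  _ = _ , a , inj₁ (w , e)
    crOption-reverts (to-gray a g c)   _ = _ , a , inj₂ (g , c)

    mutual
      int-complete : ∀ {n x} → IntValue n x → 𝒢 L x ≡ int n
      int-complete {n} {x} i@(intValue w c o) = white-rule w
          (mex ¬new (¬n , below) λ x′ a → crOption-reverts (next-complete (o a)))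
        where
        ¬new : ¬ NewOption L x
        ¬new n = int∧lunar⇒⊥ i (full⇒lunar w (newOption-sound sound n))
        ¬n : ¬ (D L x ∪ P L x) n
        ¬n n∈ = int∧covered⇒⊥ i (covered-sound sound n∈)
        below : ∀ k → k < n → (D L x ∪ P L x) k
        below k k<n with covered {x′} a c′ ← c k<n = optionLabels⁻ L (x′ , a ,
          contains-∈ᶜ (label L x′) (λ e → ¬new (newOption⁺ L a e)) (inside-complete c′))

      lunar-complete : ∀ {x} → Lunar x → (𝒢 L x ≡ Full) ⊎ (𝒢 L x ≡ Moon)
      lunar-complete {x} (lunar w c) with white-step w
      ... | inj₁ r = by-rule r refl
        where
        by-rule : ∀ {ℓ} → WhiteRule L x ℓ → ℓ ≡ 𝒢 L x → (𝒢 L x ≡ Full) ⊎ (𝒢 L x ≡ Moon)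
        by-rule (full _)    e = inj₁ (sym e)
        by-rule (moon _ _)  e = inj₂ (sym e)
        -- A lunar node covers the supposed mex too, and without a `New` option the covering label
        -- contributes m to D ∪ P.
        by-rule (mex {m} ¬n (m∉ , _) _) _ with covered {x′} a i ← c m =
          ⊥-elim (m∉ (optionLabels⁻ L (x′ , a ,
            contains-∈ᶜ (label L x′) (λ e → ¬n (newOption⁺ L a e)) (inside-complete i))))
      -- If no rule applied, there would be no `New` option, and then the moon rule would apply.
      ... | inj₂ (¬r , _) = ⊥-elim (¬r Moon (moon ¬new everything))
        where
        ¬new : ¬ NewOption L x
        ¬new n = ¬r Full (full n)
        everything : Pred.Universal (D L x ∪ P L x)
        everything k with covered {x′} a i ← c k = optionLabels⁻ L (x′ , a ,
          contains-∈ᶜ (label L x′) (λ e → ¬new (newOption⁺ L a e)) (inside-complete i))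

      inside-complete : ∀ {k x} → Inside k x → Contains k (label L x)
      inside-complete {k} (int i) rewrite label-white L (int-white i) | int-complete i = here refl
      inside-complete {k} {x} (gray g o) with option⊎terminal x
      ... | inj₁ (x′ , a) = option-contains g a (outside-complete (o a))
      ... | inj₂ t rewrite terminal-label g t = tt

      outside-complete : ∀ {k x} → Outside k x → Excludes k (label L x)
      outside-complete (int i ≢k) rewrite label-white L (int-white i) | int-complete i = λ { (here e) → ≢k (sym e) }
      outside-complete (lunar l@(lunar w _)) rewrite label-white L w with lunar-complete l
      ... | inj₁ e rewrite e = tt
      ... | inj₂ e rewrite e = λ ()
      outside-complete (gray g a i) = option-excludes g a (inside-complete i)

      prev-complete : ∀ {k x} → Prev k x → (White x × 𝒢 L x ≡ int k) ⊎ (Gray x × Cr L k x)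
      prev-complete (int i)    = inj₁ (int-white i , int-complete i)
      prev-complete (gray g o) = inj₂ (g , cr g λ x′ a → next-complete (o a))

      next-complete : ∀ {k x} → Next k x → CrOption L k x
      next-complete (int i ≢k) = white-int (int-white i) (int-complete i) ≢k
      next-complete (lunar l@(lunar w _)) = [ white-Full w , white-Moon w ]′ (lunar-complete l)
      next-complete (move a p) = [ (λ (w , e) → to-white a w e) , (λ (g , c) → to-gray a g c) ]′ (prev-complete p)

    stationary-describes : ∀ {x} → White x → Describes (𝒢 L x) x
    stationary-describes {x} w with 𝒢 L x in e | white-sound w
    ... | int k | i = i
    ... | Full  | f = f
    ... | Moon  | l = l , λ f → case trans (sym (label-white L w)) (fullMoon-label f) of λ e′ →
            case trans (sym e) (asSet-injective {ℓ′ = Full} e′) of λ ()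
    ... | ∞     | _ with whiteRule? L x
    ...   | inj₁ (ℓ , r) = ⊥-elim (rule-≢∞ (subst (WhiteRule L x) (trans (sym (white-rule w r)) e) r))
    ...   | inj₂ (stuck {m} {x′} ¬n (m∉ , _) a u ¬r) = record
            { isWhite    = w
            ; ¬int       = λ i → case trans (sym e) (int-complete i) of λ ()
            ; ¬lunar     = λ l → [ (λ e′ → case trans (sym e) e′ of λ ()) , (λ e′ → case trans (sym e) e′ of λ ()) ]′
                (lunar-complete l)
            ; gap        = m
            ; gap-free   = λ { (covered {y} b i) → m∉ (optionLabels⁻ L (y , b ,
                contains-∈ᶜ (label L y) (λ e → ¬n (newOption⁺ L b e)) (inside-complete i))) }
            ; escape     = x′
            ; escape-arc = a
            ; escape-gap = λ next → ¬r (crOption-reverts (next-complete next) u)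
            }

  -- By the ending condition the last step is a step from L₀ to itself, so completeness applies to
  -- L₀, whose labels are those of L.
  final-solution : ∀ {L} → Final L → Solution L
  final-solution {L} (n , L₀ , at , step , same) = record
    { describes = λ w → subst (λ ℓ → Describes ℓ _) (sym (white-unchanged w)) (stationary-describes inv step₀ w)
    ; fresh     = bound L₀
    ; fresh-int = λ {x} i → bound≤⇒∉ L₀ x ≤-refl (subst (λ ℓ → bound L₀ ∈ elements ℓ)
        (sym (trans (label-white L₀ (int-white i)) (cong asSet (int-complete inv step₀ i)))) (here refl))
    }
    where
    open Unchanged same
    open Step step
    inv = atStep-invariant at
    step₀ : Step L₀ L₀
    step₀ = record
      { white-step = λ w → subst (Update (WhiteRule L₀ _) (𝒢 L₀ _)) (white-unchanged w) (white-step w)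
      ; gray-step  = λ g → subst (Update (GrayRule L₀ _) (𝒞 L₀ _)) (gray-unchanged g) (gray-step g)
      }

-- Sums of two games

open Digraph using (Node; White; Gray; Terminal; colour)
open Outcome

-- The properties of the cartproduct W of V and U are stated symmetrically, so
-- that `flip` gives the mirror image of every lemma.
module SumTheory (W : Digraph) where

  -- Indexed by the node reached, so that matching on a move of the sum also identifies its target.
  data Move (V U : Digraph) (node : ∀ x y → .(Cartproduct.NotBothGray V U x y) → Node W)
            (x : Node V) (y : Node U) : Node W → Set where
    left  : ∀ {x′} → White U y → Digraph._⟶_ V x x′ → .(q : Cartproduct.NotBothGray V U x′ y) →
            Move V U node x y (node x′ y q)
    right : ∀ {y′} → White V x → Digraph._⟶_ U y y′ → .(q : Cartproduct.NotBothGray V U x y′) →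
            Move V U node x y (node x y′ q)

  record SumOf : Set₁ where
    field
      V U : Digraph
    open Digraph V using () renaming (_⟶_ to _⟶ⱽ_)
    open Digraph U using () renaming (_⟶_ to _⟶ᵁ_)
    open Digraph W using () renaming (_⟶_ to _⟶ᵂ_)
    NBG = Cartproduct.NotBothGray V U
    field
      node       : ∀ x y → .(NBG x y) → Node W
      white-node : ∀ {x y} .{p} → White V x → White U y → White W (node x y p)
      gray-left  : ∀ {x y} .{p} → Gray V x → Gray W (node x y p)
      gray-right : ∀ {x y} .{p} → Gray U y → Gray W (node x y p)
      move-left  : ∀ {x x′ y} .{p} .{q} → White U y → x ⟶ⱽ x′ → node x y p ⟶ᵂ node x′ y q
      move-right : ∀ {x y y′} .{p} .{q} → White V x → y ⟶ᵁ y′ → node x y p ⟶ᵂ node x y′ q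
      moves      : ∀ {x y w} .{p} → node x y p ⟶ᵂ w → Move V U node x y w
      kind-left  : ∀ {x} → White V x → Kind V x
      kind-right : ∀ {y} → White U y → Kind U y
      fresh-left fresh-right : ℕ
      fresh-left-int  : ∀ {x} → ¬ IntValue V fresh-left x
      fresh-right-int : ∀ {y} → ¬ IntValue U fresh-right y

  open SumOf

  swap-nbg : ∀ V U {x y} → Cartproduct.NotBothGray V U x y → Cartproduct.NotBothGray U V y x
  swap-nbg V U p (g , h) = p (h , g)

  -- Since the proof of not being both gray is irrelevant, `node (flip c) y x` and `node c x y` are
  -- definitionally equal, and lemmas about `flip c` apply without transport.
  flip : SumOf → SumOf
  flip c = record
    { V = U c ; U = V c
    ; node = λ y x p → node c x y (swap-nbg (U c) (V c) p)
    ; white-node = λ wy wx → white-node c wx wy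
    ; gray-left = gray-right c
    ; gray-right = gray-left c
    ; move-left = move-right c
    ; move-right = move-left c
    ; moves = λ a → flip-move (moves c a)
    ; kind-left = kind-right c
    ; kind-right = kind-left c
    ; fresh-left = fresh-right c
    ; fresh-right = fresh-left c
    ; fresh-left-int = fresh-right-int c
    ; fresh-right-int = fresh-left-int c
    }
    where
    flip-move : ∀ {x y w} → Move (V c) (U c) (node c) x y w →
      Move (U c) (V c) (λ y x p → node c x y (swap-nbg (U c) (V c) p)) y x w
    flip-move (left wy a q)  = right wy a (swap-nbg (V c) (U c) q)
    flip-move (right wx a q) = left wx a (swap-nbg (V c) (U c) q)

  white-leftᵂ : ∀ c {x y} .{p} → White W (node c x y p) → White (V c) x
  white-leftᵂ c {x} w with white⊎gray (colour (V c) x)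
  ... | inj₁ wx = wx
  ... | inj₂ gx = ⊥-elim (gray≢white (gray-left c gx) w)

  white-rightᵂ : ∀ c {x y} .{p} → White W (node c x y p) → White (U c) y
  white-rightᵂ c {p = p} w = white-leftᵂ (flip c) {p = swap-nbg (V c) (U c) p} w

  nbg-left : ∀ c {x y} → White (V c) x → NBG c x y
  nbg-left c w (g , _) = gray≢white g w

  nbg-right : ∀ c {x y} → White (U c) y → NBG c x y
  nbg-right c w (_ , g) = gray≢white g w

  gray-leftᵂ : ∀ c {x y} .{p} → White (U c) y → Gray W (node c x y p) → Gray (V c) x
  gray-leftᵂ c {x} wy g with white⊎gray (colour (V c) x)
  ... | inj₁ wx = ⊥-elim (gray≢white g (white-node c wx wy))
  ... | inj₂ gx = gx

  gray-rightᵂ : ∀ c {x y} .{p} → White (V c) x → Gray W (node c x y p) → Gray (U c) y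
  gray-rightᵂ c wx g = gray-leftᵂ (flip c) {p = nbg-right (flip c) wx} wx g

  -- A gray component blocks the other one, so every move from here is made in x.
  on-left : ∀ c {x y} .{p} → Gray (V c) x → (Q : Node W → Set) →
    (∀ {x′} → Digraph._⟶_ (V c) x x′ → .(q : NBG c x′ y) → Q (node c x′ y q)) →
    ∀ {w} → Digraph._⟶_ W (node c x y p) w → Q w
  on-left c g Q f a with moves c a
  ... | left _ b q   = f b q
  ... | right wx _ _ = ⊥-elim (gray≢white g wx)

  -- Adding an integer

  mutual
    -- An integer below m is covered through the component whose integer can be lowered to reach it.
    -- An option is won by combining the win in the component that moved with the integer of the
    -- other.
    add-int : ∀ c {a b m x y} .{p} → NimSum a b m → IntValue (V c) a x → IntValue (U c) b y →
      IntValue W m (node c x y p)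
    add-int c s i j = intValue (white-node c (int-white _ i) (int-white _ j))
      (λ lt → add-below c (nimSum-< s lt) i j) (λ a → add-option c s (moves c a) i j)

    add-below : ∀ c {a b k x y} .{p} → (∃[ a′ ] a′ < a × NimSum a′ b k) ⊎ (∃[ b′ ] b′ < b × NimSum a b′ k) →
      IntValue (V c) a x → IntValue (U c) b y → Covered W k (node c x y p)
    add-below c (inj₁ (_ , lt , s)) (intValue _ f _) j = add-covered c s (f lt) j
    add-below c (inj₂ (_ , lt , s)) i (intValue _ f _) =
      add-covered (flip c) {p = nbg-right (flip c) (int-white _ i)} (swap-nimSum s) (f lt) i

    add-covered : ∀ c {a b m x y} .{p} → NimSum a b m → Covered (V c) a x → IntValue (U c) b y → Covered W m (node c x y p)
    add-covered c s (covered a i) j =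
      covered (move-left c {q = nbg-right c (int-white _ j)} (int-white _ j) a) (add-inside c s i j)

    add-option : ∀ c {a b m x y w} → NimSum a b m → Move (V c) (U c) (node c) x y w →
      IntValue (V c) a x → IntValue (U c) b y → Next W m w
    add-option c s (left _ a _)  (intValue _ _ o) j = add-next c s (o a) j
    add-option c s (right _ a _) i (intValue _ _ o) =
      add-next (flip c) {p = nbg-right (flip c) (int-white _ i)} (swap-nimSum s) (o a) i

    add-inside : ∀ c {a b m x y} .{p} → NimSum a b m → Inside (V c) a x → IntValue (U c) b y → Inside W m (node c x y p)
    add-inside c s (int i) j    = int (add-int c s i j)
    add-inside c s (gray g o) j = gray (gray-left c g) (on-left c g (Outside W _) λ a _ → add-outside c s (o a) j)

    add-outside : ∀ c {a b m x y} .{p} → NimSum a b m → Outside (V c) a x → IntValue (U c) b y → Outside W m (node c x y p)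
    add-outside c s (int i ≢a) j = int (add-int c (⊕-nimSum _ _) i j) (sum-≢ s ≢a)
    add-outside c s (lunar l) j  = lunar (add-lunar c l j)
    add-outside c s (gray g a i) j =
      gray (gray-left c g) (move-left c {q = nbg-right c (int-white _ j)} (int-white _ j) a) (add-inside c s i j)

    sum-≢ : ∀ {a a′ b m} → NimSum a b m → a′ ≢ a → a′ ⊕ b ≢ m
    sum-≢ s ≢a e = ≢a (nimSum-uniqueˡ (nimSum e) s)

    -- Nim-addition of b permutes the integers, so covering all of them persists.
    add-lunar : ∀ c {b x y} .{p} → Lunar (V c) x → IntValue (U c) b y → Lunar W (node c x y p)
    add-lunar c (lunar w f) j = lunar (white-node c w (int-white _ j))
      λ k → add-covered c (rotate-nimSum (⊕-nimSum k _)) (f _) j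

    add-prev : ∀ c {a b m x y} .{p} → NimSum a b m → Prev (V c) a x → IntValue (U c) b y → Prev W m (node c x y p)
    add-prev c s (int i) j    = int (add-int c s i j)
    add-prev c s (gray g o) j = gray (gray-left c g) (on-left c g (Next W _) λ a _ → add-next c s (o a) j)

    add-next : ∀ c {a b m x y} .{p} → NimSum a b m → Next (V c) a x → IntValue (U c) b y → Next W m (node c x y p)
    add-next c s (int i ≢a) j = int (add-int c (⊕-nimSum _ _) i j) (sum-≢ s ≢a)
    add-next c s (lunar l) j  = lunar (add-lunar c l j)
    add-next c s (move a p) j = move (move-left c {q = nbg-right c (int-white _ j)} (int-white _ j) a) (add-prev c s p j)

  -- Adding moons

  mutual
    add-full : ∀ c {x y} .{p} → FullMoon (V c) x → White (U c) y → FullMoon W (node c x y p)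
    add-full c (full a n) wy = full (move-left c {q = nbg-right c wy} wy a) (add-new c n wy)

    add-new : ∀ c {x y} .{p} → NewMoon (V c) x → White (U c) y → NewMoon W (node c x y p)
    add-new c (new g o) wy = new (gray-left c g) (on-left c g (FullMoon W) λ a _ → add-full c (o a) wy)

  -- A moon covers fresh-left c, which no node has as its value, so it has a gray
  -- option that ends up forcing the opponent to move to an integer or a moon.
  mutual
    lunar+lunar : ∀ c {x y} .{p} → Lunar (V c) x → Lunar (U c) y → Lunar W (node c x y p)
    lunar+lunar c (lunar w f) l@(lunar wy _) = lunar (white-node c w wy)
      λ k → covered+lunar c (f (fresh-left c)) l k

    covered+lunar : ∀ c {x y} .{p} → Covered (V c) (fresh-left c) x → Lunar (U c) y → ∀ k → Covered W k (node c x y p)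
    covered+lunar c (covered a i) l@(lunar wy _) k =
      covered (move-left c {q = nbg-right c wy} wy a) (inside+lunar c i l)

    inside+lunar : ∀ c {x y k} .{p} → Inside (V c) (fresh-left c) x → Lunar (U c) y → Inside W k (node c x y p)
    inside+lunar c (int i) l    = ⊥-elim (fresh-left-int c i)
    inside+lunar c (gray g o) l = gray (gray-left c g) (on-left c g (Outside W _) λ a _ → outside+lunar c (o a) l)

    outside+lunar : ∀ c {x y k} .{p} → Outside (V c) (fresh-left c) x → Lunar (U c) y → Outside W k (node c x y p)
    outside+lunar c (int i _) l    = lunar (add-lunar (flip c) {p = nbg-right (flip c) (int-white _ i)} l i)
    outside+lunar c (lunar l′) l   = lunar (lunar+lunar c l′ l)
    outside+lunar c (gray g a i) l@(lunar wy _) =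
      gray (gray-left c g) (move-left c {q = nbg-right c wy} wy a) (inside+lunar c i l)

  mutual
    -- The forcing sequence of y is played beside the moon. It ends at a moon plus an integer, which
    -- is lunar, and each earlier position passes this back through a gray node with a single reply.
    lunar+forces : ∀ c {f x y} .{p} → Lunar (V c) x → Forces (U c) f y → White (U c) y → Lunar W (node c x y p)
    lunar+forces c l@(lunar wx _) f wy = lunar (white-node c wx wy) λ k → lunar+forces-covered c l f k

    lunar+forces-covered : ∀ c {f x y} .{p} → Lunar (V c) x → Forces (U c) f y → ∀ k → Covered W k (node c x y p)
    lunar+forces-covered c l@(lunar wx _) (here a g a′ i) k =
      covered (move-right c {q = q} wx a) (gray gW (Finite.the-option W gW
        (move-right c {q = nbg-left c wx} wx a′) (Outside W k) (lunar (add-lunar c l i))))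
      where
      q = nbg-left c wx
      gW = gray-right c {p = q} g
    lunar+forces-covered c l@(lunar wx _) (later a g a′ f) k =
      covered (move-right c {q = q} wx a) (gray gW (Finite.the-option W gW
        (move-right c {q = nbg-left c wx} wx a′) (Outside W k) (lunar+forces-outside c l f k)))
      where
      q = nbg-left c wx
      gW = gray-right c {p = q} g

    lunar+forces-outside : ∀ c {f x y} .{p} → Lunar (V c) x → Forces (U c) f y → ∀ k → Outside W k (node c x y p)
    lunar+forces-outside c {y = y} {p} l f k with lunar+forces-covered c {p = p} l f k | white⊎gray (colour (U c) y)
    ... | _           | inj₁ wy = lunar (lunar+forces c l f wy)
    ... | covered a i | inj₂ gy = gray (gray-right c gy) a i

  mutual
    -- Each move to a gray node and its reply stay in one component. The component whose terminal
    -- gray node ends the play is full, by its own moves alone; those of the other are dropped.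
    split-full : ∀ c {x y} .{p} → FullMoon W (node c x y p) → White (U c) y → FullMoon (V c) x ⊎ FullMoon (U c) y
    split-full c (full a n) wy with moves c a
    ... | left _ b _   = Sum.map₁ (full b) (split-new c n wy)
    ... | right wx b _ = Sum.swap (Sum.map₁ (full b) (split-new (flip c) {p = nbg-right (flip c) wx} n wx))

    split-new : ∀ c {x y} .{p} → NewMoon W (node c x y p) → White (U c) y → NewMoon (V c) x ⊎ FullMoon (U c) y
    split-new c {x} (new gW o) wy with Finite.option⊎terminal (V c) x
    ... | inj₂ t       = inj₁ (new g λ a → ⊥-elim (t _ a))
      where g = gray-leftᵂ c wy gW
    ... | inj₁ (_ , a) = Sum.map₁ (λ f → new g (Finite.the-option (V c) g a (FullMoon (V c)) f))
        (split-full c (o (move-left c {q = nbg-right c wy} wy a)) wy)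
      where g = gray-leftᵂ c wy gW

  -- From a sum back to its components

  module Converse (fresh : ℕ) (fresh-int : ∀ {w} → ¬ IntValue W fresh w) where

    NonInteger : (V : Digraph) → Node V → Set
    NonInteger V x = White V x × (∀ {n} → ¬ IntValue V n x)

    lunar⇒nonInteger : ∀ {V x} → Lunar V x → NonInteger V x
    lunar⇒nonInteger l@(lunar w _) = w , λ i → int∧lunar⇒⊥ _ i l

    undecided⇒nonInteger : ∀ {V x} → Undecided V x → NonInteger V x
    undecided⇒nonInteger u = Undecided.isWhite u , Undecided.¬int u

    mutual
      sub-prev : ∀ c {a b m x y} .{p} → NimSum a b m → Prev W m (node c x y p) → IntValue (U c) b y → Prev (V c) a x
      sub-prev c s (int i) j     = int (sub-int c s i j)
      sub-prev c s (gray gW o) j = gray (gray-leftᵂ c wy gW)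
        λ a → sub-next c s (o (move-left c {q = nbg-right c wy} wy a)) (int j)
        where wy = int-white _ j

      sub-int : ∀ c {a b m x y} .{p} → NimSum a b m → IntValue W m (node c x y p) → IntValue (U c) b y → IntValue (V c) a x
      sub-int c s i j = sub-int-kind c s i j (kind-left c (white-leftᵂ c (int-white _ i)))

      -- Every option of x is won at a by the next player, so x cannot cover a; this excludes a moon
      -- and an integer above a. If x were undecided, it would cover everything below a and thus be
      -- the integer a.
      sub-int-kind : ∀ c {a b m x y} .{p} → NimSum a b m → IntValue W m (node c x y p) → IntValue (U c) b y →
        Kind (V c) x → IntValue (V c) a x
      sub-int-kind c s i j (int i′) = sub-int-compare c s i j i′ (<-cmp _ _)
      sub-int-kind c s i j (lunar (lunar _ f)) = ⊥-elim (covered∧prev⇒⊥ _ (f _) λ a → sub-int-option c s i j a)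
      sub-int-kind c s i j (undecided u) = intValue (Undecided.isWhite u)
        (λ lt → sub-undecided-below c s lt u i j (nimSum-< (rotate-nimSum s) lt)) λ a → sub-int-option c s i j a

      sub-int-option : ∀ c {a b m x x′ y} .{p} → NimSum a b m → IntValue W m (node c x y p) → IntValue (U c) b y →
        Digraph._⟶_ (V c) x x′ → Next (V c) a x′
      sub-int-option c s (intValue _ _ o) j a =
        sub-next c s (o (move-left c {q = nbg-right c (int-white _ j)} (int-white _ j) a)) (int j)

      sub-int-compare : ∀ c {a a′ b m x y} .{p} → NimSum a b m → IntValue W m (node c x y p) → IntValue (U c) b y →
        IntValue (V c) a′ x → Tri (a′ < a) (a′ ≡ a) (a < a′) → IntValue (V c) a x
      sub-int-compare c s i j i′ (tri≈ _ refl _) = i′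
      sub-int-compare c s i j i′@(intValue _ f _) (tri> _ _ gt) =
        ⊥-elim (covered∧prev⇒⊥ _ (f gt) λ a → sub-int-option c s i j a)
      -- As a = m ⊕ b, the smaller a′ arises by lowering m or b; either x + y covers the lowered m,
      -- or y covers the lowered b.
      sub-int-compare c s i j i′ (tri< lt _ _) = ⊥-elim (sub-int-below c s i j i′ (nimSum-< (rotate-nimSum s) lt))

      sub-int-below : ∀ c {a a′ b m x y} .{p} → NimSum a b m → IntValue W m (node c x y p) → IntValue (U c) b y →
        IntValue (V c) a′ x → (∃[ m′ ] m′ < m × NimSum m′ b a′) ⊎ (∃[ b′ ] b′ < b × NimSum m b′ a′) → ⊥
      sub-int-below c s (intValue _ f _) j i′ (inj₁ (m′ , lt , s′)) = sub-covered-int c (rotate-nimSum s′) (f lt) j i′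
      sub-int-below c s (intValue _ _ o) (intValue _ g _) i′ (inj₂ (b′ , lt , s′)) with covered a ins ← g lt =
        prev∧next⇒⊥ _ (int i′) (sub-next c (rotate-nimSum s′)
          (o (move-right c {q = nbg-left c (int-white _ i′)} (int-white _ i′) a)) (inside⇒prev _ ins))

      sub-covered-int : ∀ c {a b m x y} .{p} → NimSum a b m → Covered W m (node c x y p) → IntValue (U c) b y →
        IntValue (V c) a x → ⊥
      sub-covered-int c s (covered a ins) j i = sub-move-int c s (moves c a) ins j i

      sub-move-int : ∀ c {a b m x y w} → NimSum a b m → Move (V c) (U c) (node c) x y w → Inside W m w →
        IntValue (U c) b y → IntValue (V c) a x → ⊥
      sub-move-int c s (left wy a _) ins j (intValue _ _ o) = inside∧next⇒⊥ _ (sub-inside c s ins j) (o a)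
      sub-move-int c s (right wx a _) ins (intValue _ _ o) i =
        inside∧next⇒⊥ _ (sub-inside (flip c) {p = nbg-right (flip c) wx} (swap-nimSum s) ins i) (o a)

      sub-undecided-below : ∀ c {a b k m x y} .{p} → NimSum a b m → k < a → Undecided (V c) x →
        IntValue W m (node c x y p) → IntValue (U c) b y →
        (∃[ m′ ] m′ < m × NimSum m′ b k) ⊎ (∃[ b′ ] b′ < b × NimSum m b′ k) → Covered (V c) k x
      sub-undecided-below c s lt u (intValue _ f _) j (inj₁ (m′ , lt′ , s′)) =
        sub-covered-undecided c (rotate-nimSum s′) u (f lt′) j
      sub-undecided-below c s lt u i (intValue wy g o) (inj₂ (b′ , lt′ , s′)) = sub-undecided-right c s lt u i
        (intValue wy g o) s′ (g lt′)

      sub-undecided-right : ∀ c {a b b′ k m x y} .{p} → NimSum a b m → k < a → Undecided (V c) x →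
        IntValue W m (node c x y p) → IntValue (U c) b y → NimSum m b′ k → Covered (U c) b′ y → Covered (V c) k x
      sub-undecided-right c s lt u i j s′ (covered a ins) = sub-undecided-reply c s lt u i j
        (undecided-next _ u (sub-undecided-option c u s′ i a ins))

      sub-undecided-option : ∀ c {b′ k m x y y′} .{p} → Undecided (V c) x → NimSum m b′ k → IntValue W m (node c x y p) →
        Digraph._⟶_ (U c) y y′ → Inside (U c) b′ y′ → Next (V c) k x
      sub-undecided-option c u s′ (intValue _ _ o) a ins = sub-next c (rotate-nimSum s′)
        (o (move-right c {q = nbg-left c (Undecided.isWhite u)} (Undecided.isWhite u) a)) (inside⇒prev _ ins)

      -- The option of x won at k by the previous player is won at a by the next one, since x + y is
      -- worth m. Different outcomes for the two integers give it a label, which contains k.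
      sub-undecided-reply : ∀ c {a b k m x y} .{p} → NimSum a b m → k < a → Undecided (V c) x →
        IntValue W m (node c x y p) → IntValue (U c) b y →
        ∃[ x′ ] Digraph._⟶_ (V c) x x′ × Prev (V c) k x′ → Covered (V c) k x
      sub-undecided-reply c s lt u i j (x′ , a , q) =
        covered a (prev∧next⇒inside _ q (sub-int-option c s i j a) λ { refl → <-irrefl refl lt })

      sub-covered-undecided : ∀ c {a b m x y} .{p} → NimSum a b m → Undecided (V c) x → Covered W m (node c x y p) →
        IntValue (U c) b y → Covered (V c) a x
      sub-covered-undecided c s u (covered a ins) j = sub-move-undecided c s u (moves c a) ins j

      sub-move-undecided : ∀ c {a b m x y w} → NimSum a b m → Undecided (V c) x →
        Move (V c) (U c) (node c) x y w → Inside W m w → IntValue (U c) b y → Covered (V c) a x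
      sub-move-undecided c s u (left wy a _) ins j = covered a (sub-inside c s ins j)
      sub-move-undecided c s u (right wx a _) ins (intValue _ _ o) = ⊥-elim (undecided-inside c u ins (o a))

      -- Here y need only be won at b by the previous player. A move to y′ in the sum is answered by
      -- an option of y′ again won at b, which restores the hypotheses with a smaller derivation in
      -- W; a play ending in an integer sum gives x an integer other than a.
      sub-next : ∀ c {a b m x y} .{p} → NimSum a b m → Next W m (node c x y p) → Prev (U c) b y → Next (V c) a x
      sub-next c s (int i ≢m) q = int (sub-int c (rotate-nimSum (⊕-nimSum _ _)) i j) λ e → ≢m
          (nimSum-unique (rotate-nimSum (⊕-nimSum _ _)) (subst (λ a → NimSum a _ _) (sym e) s))
        where j = prev-white _ (white-rightᵂ c (int-white _ i)) q
      sub-next c s (lunar l@(lunar w _)) q = lunar (sub-lunar c l (prev-white _ (white-rightᵂ c w) q))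
      sub-next c s (move a p) q = sub-next-move c s (moves c a) p q

      sub-next-move : ∀ c {a b m x y w} → NimSum a b m → Move (V c) (U c) (node c) x y w → Prev W m w →
        Prev (U c) b y → Next (V c) a x
      sub-next-move c s (left wy a _) p q  = move a (sub-prev c s p (prev-white _ wy q))
      sub-next-move c s (right wx a _) p q = sub-prev-next c s p (prev-option _ q a) wx

      sub-prev-next : ∀ c {a b m x y} .{p} → NimSum a b m → Prev W m (node c x y p) → Next (U c) b y → White (V c) x →
        Next (V c) a x
      sub-prev-next c s (int i) n wx with a′ , b′ , i′ , j′ , s′ ← split-int c i =
        int i′ λ { refl → prev∧next⇒⊥ _ (int j′) (subst (λ b → Next (U c) b _)
          (nimSum-uniqueˡ (swap-nimSum s) (swap-nimSum s′)) n) }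
      sub-prev-next c s (gray gW o) n wx with y′ , a , q ← next-gray _ (gray-rightᵂ c wx gW) n =
        sub-next c s (o (move-right c {q = nbg-left c wx} wx a)) q

      sub-inside : ∀ c {a b m x y} .{p} → NimSum a b m → Inside W m (node c x y p) → IntValue (U c) b y → Inside (V c) a x
      sub-inside c s (int i) j     = int (sub-int c s i j)
      sub-inside c s (gray gW o) j = gray (gray-leftᵂ c wy gW)
        λ a → sub-outside c s (o (move-left c {q = nbg-right c wy} wy a)) j
        where wy = int-white _ j

      sub-outside : ∀ c {a b m x y} .{p} → NimSum a b m → Outside W m (node c x y p) → IntValue (U c) b y → Outside (V c) a x
      sub-outside c s (int i ≢m) j = int (sub-int c (rotate-nimSum (⊕-nimSum _ _)) i j) λ e → ≢m
          (nimSum-unique (rotate-nimSum (⊕-nimSum _ _)) (subst (λ a → NimSum a _ _) (sym e) s))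
      sub-outside c s (lunar l) j = lunar (sub-lunar c l j)
      sub-outside c s (gray gW a ins) j = sub-outside-move c s gW (moves c a) ins j

      sub-outside-move : ∀ c {a b m x y w} .{p} → NimSum a b m → Gray W (node c x y p) →
        Move (V c) (U c) (node c) x y w → Inside W m w → IntValue (U c) b y → Outside (V c) a x
      sub-outside-move c s gW (left wy a _) ins j = gray (gray-leftᵂ c wy gW) a (sub-inside c s ins j)
      sub-outside-move c s gW (right wx _ _) _ j  = ⊥-elim (gray≢white gW (white-node c wx (int-white _ j)))

      sub-lunar : ∀ c {b x y} .{p} → Lunar W (node c x y p) → IntValue (U c) b y → Lunar (V c) x
      sub-lunar c (lunar w f) j with kind-left c (white-leftᵂ c w)
      ... | lunar l     = l
      ... | int i       = ⊥-elim (sub-covered-int c (⊕-nimSum _ _) (f _) j i)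
      ... | undecided u = ⊥-elim (Undecided.gap-free u (sub-covered-undecided c (⊕-nimSum _ _) u (f _) j))

      -- The gray nodes of y are followed beside the untouched x. A white end is an integer sum,
      -- which makes x an integer, or a lunar sum over an integer end of y, which makes x lunar.
      undecided-inside : ∀ c {b k x y} .{p} → Undecided (V c) x → Inside W k (node c x y p) → Next (U c) b y → ⊥
      undecided-inside c u (int i) n with _ , _ , i′ , _ ← split-int c i = Undecided.¬int u i′
      undecided-inside c u (gray gW o) n with y′ , a , q ← next-gray _ (gray-rightᵂ c (Undecided.isWhite u) gW) n =
        undecided-outside c u (o (move-right c {q = nbg-left c (Undecided.isWhite u)} (Undecided.isWhite u) a)) q

      undecided-outside : ∀ c {b k x y} .{p} → Undecided (V c) x → Outside W k (node c x y p) → Prev (U c) b y → ⊥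
      undecided-outside c u (int i _) q with _ , _ , i′ , _ ← split-int c i = Undecided.¬int u i′
      undecided-outside c u (lunar l@(lunar w _)) q =
        Undecided.¬lunar u (sub-lunar c l (prev-white _ (white-rightᵂ c w) q))
      undecided-outside c u (gray gW a ins) q = undecided-outside-move c u gW (moves c a) ins q

      undecided-outside-move : ∀ c {b k x y w} .{p} → Undecided (V c) x → Gray W (node c x y p) →
        Move (V c) (U c) (node c) x y w → Inside W k w → Prev (U c) b y → ⊥
      undecided-outside-move c u gW (right _ a _) ins q = undecided-inside c u ins (prev-option _ q a)
      undecided-outside-move c u gW (left wy _ _) _ _   = gray≢white gW (white-node c (Undecided.isWhite u) wy)

      split-int : ∀ c {m x y} .{p} → IntValue W m (node c x y p) →
        ∃[ a ] ∃[ b ] IntValue (V c) a x × IntValue (U c) b y × NimSum a b m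
      split-int c i = split-int-kinds c i
        (kind-left c (white-leftᵂ c (int-white _ i))) (kind-right c (white-rightᵂ c (int-white _ i)))

      split-int-kinds : ∀ c {m x y} .{p} → IntValue W m (node c x y p) → Kind (V c) x → Kind (U c) y →
        ∃[ a ] ∃[ b ] IntValue (V c) a x × IntValue (U c) b y × NimSum a b m
      split-int-kinds c i _ (int j) = _ , _ , sub-int c s i j , j , s
        where s = rotate-nimSum (⊕-nimSum _ _)
      split-int-kinds c i (int j) _ =
        _ , _ , j , sub-int (flip c) {p = nbg-right (flip c) (int-white _ j)} s i j , swap-nimSum s
        where s = rotate-nimSum (⊕-nimSum _ _)
      split-int-kinds c i (lunar l) (lunar l′) = ⊥-elim (lunar-int⇒⊥ c l (lunar⇒nonInteger l′) i)
      split-int-kinds c i (lunar l) (undecided u) = ⊥-elim (lunar-int⇒⊥ c l (undecided⇒nonInteger u) i)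
      split-int-kinds c i (undecided u) (lunar l@(lunar w _)) =
        ⊥-elim (lunar-int⇒⊥ (flip c) {p = nbg-left (flip c) w} l (undecided⇒nonInteger u) i)
      split-int-kinds c i (undecided u) (undecided u′) = ⊥-elim (undecided-int⇒⊥ c u u′ i)

      -- The moon covers the fresh integer. Followed against the win of the sum beside the
      -- non-integer y, the covering option could only lead to a node of V with the fresh value.
      lunar-int⇒⊥ : ∀ c {m x y} .{p} → Lunar (V c) x → NonInteger (U c) y → IntValue W m (node c x y p) → ⊥
      lunar-int⇒⊥ c (lunar _ f) ny@(wy , _) (intValue _ _ o) with covered a ins ← f (fresh-left c) =
        fresh-left-int c (proj₂ (proj₂ (inside-next c (⊕-nimSum _ _) ny ins
          (o (move-left c {q = nbg-right c wy} wy a)))))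

      -- The second component shows that e is not fresh.
      inside-next : ∀ c {e f m x y} .{p} → NimSum e m f → NonInteger (U c) y →
        Inside (V c) e x → Next W m (node c x y p) → (Next (U c) f y × ∃[ z ] IntValue (V c) e z)
      inside-next c s ny (int i) n =
        sub-next (flip c) {p = nbg-right (flip c) (int-white _ i)} (rotate-nimSum (swap-nimSum s)) n (int i) , _ , i
      inside-next c s ny (gray g _) (int i _) = ⊥-elim (gray≢white (gray-left c g) (int-white _ i))
      inside-next c s ny (gray g _) (lunar (lunar w _)) = ⊥-elim (gray≢white (gray-left c g) w)
      inside-next c s ny (gray g o) (move a q) = inside-next-move c s ny g o (moves c a) q

      inside-next-move : ∀ c {e f m x y w} → NimSum e m f → NonInteger (U c) y → Gray (V c) x →
        (∀ {x′} → Digraph._⟶_ (V c) x x′ → Outside (V c) e x′) → Move (V c) (U c) (node c) x y w → Prev W m w →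
        Next (U c) f y × ∃[ z ] IntValue (V c) e z
      inside-next-move c s ny g o (left _ a _) q   = outside-prev c s ny (o a) q
      inside-next-move c s ny g o (right wx _ _) q = ⊥-elim (gray≢white g wx)

      outside-prev : ∀ c {e f m x y} .{p} → NimSum e m f → NonInteger (U c) y →
        Outside (V c) e x → Prev W m (node c x y p) → (Next (U c) f y × ∃[ z ] IntValue (V c) e z)
      outside-prev c s ny _ (int i) = ⊥-elim (nonInteger-int⇒⊥ c ny i)
      outside-prev c s ny (int i _) (gray gW _) = ⊥-elim (gray≢white gW (white-node c (int-white _ i) (proj₁ ny)))
      outside-prev c s ny (lunar (lunar w _)) (gray gW _) = ⊥-elim (gray≢white gW (white-node c w (proj₁ ny)))
      outside-prev c s ny (gray g a ins) (gray gW o) =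
        inside-next c s ny ins (o (move-left c {q = nbg-right c (proj₁ ny)} (proj₁ ny) a))

      nonInteger-int⇒⊥ : ∀ c {m x y} .{p} → NonInteger (U c) y → IntValue W m (node c x y p) → ⊥
      nonInteger-int⇒⊥ c (_ , ¬j) i with _ , _ , _ , j , _ ← split-int c i = ¬j j

      -- Even for different k and m, the derivations claim opposite winners on one gray chain of x.
      -- A white end would have to be an integer sum for one of them, which y excludes; at a
      -- terminal end the other would still need a move.
      nonInteger-inside⇒⊥ : ∀ c {k m x y} .{p} → NonInteger (U c) y →
        Inside W k (node c x y p) → Next W m (node c x y p) → ⊥
      nonInteger-inside⇒⊥ c ny (int i) _ = nonInteger-int⇒⊥ c ny i
      nonInteger-inside⇒⊥ c ny (gray gW _) (int i _) = gray≢white gW (int-white _ i)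
      nonInteger-inside⇒⊥ c ny (gray gW _) (lunar (lunar w _)) = gray≢white gW w
      nonInteger-inside⇒⊥ c ny (gray gW o) (move a q) =
        nonInteger-move⇒⊥ c ny (gray-leftᵂ c (proj₁ ny) gW) (moves c a) (o a) q

      nonInteger-move⇒⊥ : ∀ c {k m x y w} → NonInteger (U c) y → Gray (V c) x →
        Move (V c) (U c) (node c) x y w → Outside W k w → Prev W m w → ⊥
      nonInteger-move⇒⊥ c ny g (left _ _ _) out q   = nonInteger-outside⇒⊥ c ny out q
      nonInteger-move⇒⊥ c ny g (right wx _ _) out q = gray≢white g wx

      nonInteger-outside⇒⊥ : ∀ c {k m x y} .{p} → NonInteger (U c) y →
        Outside W k (node c x y p) → Prev W m (node c x y p) → ⊥
      nonInteger-outside⇒⊥ c ny _ (int i) = nonInteger-int⇒⊥ c ny i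
      nonInteger-outside⇒⊥ c ny (int i _) (gray gW _) = gray≢white gW (int-white _ i)
      nonInteger-outside⇒⊥ c ny (lunar (lunar w _)) (gray gW _) = gray≢white gW w
      nonInteger-outside⇒⊥ c ny (gray gW a ins) (gray _ o) =
        nonInteger-outside-move⇒⊥ c ny (gray-leftᵂ c (proj₁ ny) gW) (moves c a) ins (o a)

      nonInteger-outside-move⇒⊥ : ∀ c {k m x y w} → NonInteger (U c) y → Gray (V c) x →
        Move (V c) (U c) (node c) x y w → Inside W k w → Next W m w → ⊥
      nonInteger-outside-move⇒⊥ c ny g (left _ _ _) ins n   = nonInteger-inside⇒⊥ c ny ins n
      nonInteger-outside-move⇒⊥ c ny g (right wx _ _) ins n = gray≢white g wx

      -- `Prev` without a label occurs on gray chains with an undecided white end. Beside the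
      -- non-integer y such an end is impossible, as the sum there would have to be an integer; the
      -- derivation in W bounds the descent.
      prev-next⇒inside : ∀ c {e m x y} .{p} → NonInteger (U c) y →
        Prev (V c) e x → Next W m (node c x y p) → Inside (V c) e x
      prev-next⇒inside c ny (int i) _ = int i
      prev-next⇒inside c ny (gray g _) (int i _) = ⊥-elim (gray≢white (gray-left c g) (int-white _ i))
      prev-next⇒inside c ny (gray g _) (lunar (lunar w _)) = ⊥-elim (gray≢white (gray-left c g) w)
      prev-next⇒inside c ny (gray g o) (move a q) = prev-next-move c ny g o (moves c a) q

      prev-next-move : ∀ c {e m x y w} → NonInteger (U c) y → Gray (V c) x →
        (∀ {x′} → Digraph._⟶_ (V c) x x′ → Next (V c) e x′) → Move (V c) (U c) (node c) x y w → Prev W m w →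
        Inside (V c) e x
      prev-next-move c ny g o (left _ a _) q   =
        gray g (Finite.the-option (V c) g a (Outside (V c) _) (next-prev⇒outside c ny (o a) q))
      prev-next-move c ny g o (right wx _ _) q = ⊥-elim (gray≢white g wx)

      next-prev⇒outside : ∀ c {e m x y} .{p} → NonInteger (U c) y →
        Next (V c) e x → Prev W m (node c x y p) → Outside (V c) e x
      next-prev⇒outside c ny _ (int i) = ⊥-elim (nonInteger-int⇒⊥ c ny i)
      next-prev⇒outside c ny n (gray gW o) with x′ , a , q ← next-gray _ (gray-leftᵂ c (proj₁ ny) gW) n =
        gray (gray-leftᵂ c (proj₁ ny) gW) a
          (prev-next⇒inside c ny q (o (move-left c {q = nbg-right c (proj₁ ny)} (proj₁ ny) a)))

      -- Beside a gray y two non-integers are interchangeable: only y moves, and no white node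
      -- reached can be an integer, so the two sums cannot have different winners.
      nonIntegers-prev⇒⊥ : ∀ c {m x z y} .{p} .{q} → NonInteger (V c) z → NonInteger (V c) x →
        Prev W m (node c z y p) → Next W m (node c x y q) → ⊥
      nonIntegers-prev⇒⊥ c nz nx (int i) _ with _ , _ , j , _ ← split-int c i = proj₂ nz j
      nonIntegers-prev⇒⊥ c nz nx (gray gW _) (int i _) =
        gray≢white (gray-right c (gray-rightᵂ c (proj₁ nz) gW)) (int-white _ i)
      nonIntegers-prev⇒⊥ c nz nx (gray gW _) (lunar (lunar w _)) =
        gray≢white (gray-right c (gray-rightᵂ c (proj₁ nz) gW)) w
      nonIntegers-prev⇒⊥ c nz nx (gray gW o) (move a q) =
        nonIntegers-move⇒⊥ c nz nx (gray-rightᵂ c (proj₁ nz) gW) o (moves c a) q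

      nonIntegers-move⇒⊥ : ∀ c {m x z y w} .{p} → NonInteger (V c) z → NonInteger (V c) x → Gray (U c) y →
        (∀ {v} → Digraph._⟶_ W (node c z y p) v → Next W m v) → Move (V c) (U c) (node c) x y w → Prev W m w → ⊥
      nonIntegers-move⇒⊥ c nz nx g o (left wy _ _) q  = gray≢white g wy
      nonIntegers-move⇒⊥ c nz nx g o (right _ a _) q =
        nonIntegers-next⇒⊥ c nz nx (o (move-right c {q = nbg-left c (proj₁ nz)} (proj₁ nz) a)) q

      nonIntegers-next⇒⊥ : ∀ c {m x z y} .{p} .{q} → NonInteger (V c) z → NonInteger (V c) x →
        Next W m (node c z y p) → Prev W m (node c x y q) → ⊥
      nonIntegers-next⇒⊥ c nz nx _ (int i) with _ , _ , j , _ ← split-int c i = proj₂ nx j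
      nonIntegers-next⇒⊥ c nz nx (int i _) (gray gW _) =
        gray≢white (gray-right c (gray-rightᵂ c (proj₁ nx) gW)) (int-white _ i)
      nonIntegers-next⇒⊥ c nz nx (lunar (lunar w _)) (gray gW _) =
        gray≢white (gray-right c (gray-rightᵂ c (proj₁ nx) gW)) w
      nonIntegers-next⇒⊥ c nz nx (move a q) (gray gW o) =
        nonIntegers-next-move⇒⊥ c nz nx (gray-rightᵂ c (proj₁ nx) gW) (moves c a) q o

      nonIntegers-next-move⇒⊥ : ∀ c {m x z y w} .{p} → NonInteger (V c) z → NonInteger (V c) x → Gray (U c) y →
        Move (V c) (U c) (node c) z y w → Prev W m w → (∀ {v} → Digraph._⟶_ W (node c x y p) v → Next W m v) → ⊥
      nonIntegers-next-move⇒⊥ c nz nx g (left wy _ _) q o = gray≢white g wy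
      nonIntegers-next-move⇒⊥ c nz nx g (right _ a _) q o =
        nonIntegers-prev⇒⊥ c nz nx q (o (move-right c {q = nbg-left c (proj₁ nx)} (proj₁ nx) a))

      -- If x + y had the value 0, then y would behave in the sums z + y like the
      -- integer gap of x, and moving to the escape of x could not be answered.
      undecided-int⇒⊥ : ∀ c {m x y} .{p} → Undecided (V c) x → Undecided (U c) y → IntValue W m (node c x y p) → ⊥
      -- A positive integer covers 0, and its covering option is also won by the next player, which
      -- `nonInteger-inside⇒⊥` excludes.
      undecided-int⇒⊥ c {m = suc _} u u′ (intValue _ f o) with covered a ins ← f z<s =
        undecided-positive⇒⊥ c u u′ (moves c a) ins (o a)
      undecided-int⇒⊥ c {m = zero} u u′ i = Undecided.escape-gap u (follow-escape c u u′ i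
        (λ n → undecided-gap⇒⊥ c u u′ i (undecided-next _ u′ n)) i)

      follow-escape : ∀ c {x y} .{p} .{q} → (u : Undecided (V c) x) → Undecided (U c) y → IntValue W 0 (node c x y p) →
        ¬ Next (U c) (Undecided.gap u) y → IntValue W 0 (node c x y q) →
        Next (V c) (Undecided.gap u) (Undecided.escape u)
      follow-escape c u u′ i ¬n (intValue _ _ o) =
        follow-next c u u′ i ¬n (o (move-left c {q = nbg-right c wy} wy (Undecided.escape-arc u)))
        where wy = Undecided.isWhite u′

      undecided-positive⇒⊥ : ∀ c {k m x y w} → Undecided (V c) x → Undecided (U c) y →
        Move (V c) (U c) (node c) x y w → Inside W k w → Next W m w → ⊥
      undecided-positive⇒⊥ c u u′ (left _ _ _) ins n   = nonInteger-inside⇒⊥ c (undecided⇒nonInteger u′) ins n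
      undecided-positive⇒⊥ c u u′ (right wx _ _) ins n =
        nonInteger-inside⇒⊥ (flip c) {p = nbg-right (flip c) wx} (undecided⇒nonInteger u) ins n

      -- A move of y winning at the gap has the gap in its label, since x + y is worth 0, and
      -- therefore yields such a win for x. The winning move of x is labelled in the same way and
      -- covers the gap.
      undecided-gap⇒⊥ : ∀ c {x y} .{p} → (u : Undecided (V c) x) → Undecided (U c) y → IntValue W 0 (node c x y p) →
        ∃[ y′ ] Digraph._⟶_ (U c) y y′ × Prev (U c) (Undecided.gap u) y′ → ⊥
      undecided-gap⇒⊥ c u u′ i (y′ , a , q) = undecided-covered⇒⊥ c u u′ i (undecided-next _ u (undecided-reply c u i a q))

      undecided-reply : ∀ c {x y y′} .{p} → (u : Undecided (V c) x) → IntValue W 0 (node c x y p) →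
        Digraph._⟶_ (U c) y y′ → Prev (U c) (Undecided.gap u) y′ → Next (V c) (Undecided.gap u) x
      undecided-reply c u (intValue _ _ o) a q =
        proj₁ (inside-next (flip c) {p = nbg-right (flip c) wx} (nimSum (⊕-identityʳ _)) (undecided⇒nonInteger u)
          (prev-next⇒inside (flip c) {p = nbg-right (flip c) wx} (undecided⇒nonInteger u) q
            (o (move-right c {q = nbg-left c wx} wx a)))
          (o (move-right c {q = nbg-left c wx} wx a)))
        where wx = Undecided.isWhite u

      undecided-covered⇒⊥ : ∀ c {x y} .{p} → (u : Undecided (V c) x) → Undecided (U c) y → IntValue W 0 (node c x y p) →
        ∃[ x′ ] Digraph._⟶_ (V c) x x′ × Prev (V c) (Undecided.gap u) x′ → ⊥
      undecided-covered⇒⊥ c u u′ (intValue _ _ o) (x′ , a , q) = Undecided.gap-free u (covered a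
        (prev-next⇒inside c (undecided⇒nonInteger u′) q (o (move-left c {q = nbg-right c wy} wy a))))
        where wy = Undecided.isWhite u′

      follow-next : ∀ c {x y z} .{p} .{q} → (u : Undecided (V c) x) → Undecided (U c) y → IntValue W 0 (node c x y p) →
        ¬ Next (U c) (Undecided.gap u) y → Next W 0 (node c z y q) → Next (V c) (Undecided.gap u) z
      follow-next c {z = z} u u′ i ¬n n with white⊎gray (colour (V c) z)
      ... | inj₁ wz = follow-next-kind c u u′ i ¬n n (kind-left c wz)
      ... | inj₂ gz = follow-next-gray c u u′ i ¬n n gz

      follow-next-kind : ∀ c {x y z} .{p} .{q} → (u : Undecided (V c) x) → Undecided (U c) y → IntValue W 0 (node c x y p) →
        ¬ Next (U c) (Undecided.gap u) y → Next W 0 (node c z y q) → Kind (V c) z → Next (V c) (Undecided.gap u) z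
      follow-next-kind c u u′ i ¬n n (lunar l) = lunar l
      -- If z were worth the gap, subtracting it from z + y would give y a win at the gap, because
      -- the gap plus itself is 0.
      follow-next-kind c u u′ i ¬n n (int j)   = int j λ { refl → ¬n (sub-next (flip c)
        {p = nbg-right (flip c) (int-white _ j)} (nimSum (⊕-self (Undecided.gap u))) n (int j)) }
      follow-next-kind c u u′ i ¬n (int j _) (undecided _) = ⊥-elim (nonInteger-int⇒⊥ c (undecided⇒nonInteger u′) j)
      follow-next-kind c u u′ i ¬n (lunar l) (undecided v) = ⊥-elim (undecided-lunar⇒⊥ c v u′ l)
      follow-next-kind c u u′ i ¬n (move a q) (undecided v) = follow-next-move c u u′ i ¬n (moves c a) q v

      follow-next-move : ∀ c {x y z w} .{p} → (u : Undecided (V c) x) → Undecided (U c) y → IntValue W 0 (node c x y p) →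
        ¬ Next (U c) (Undecided.gap u) y → Move (V c) (U c) (node c) z y w → Prev W 0 w → Undecided (V c) z →
        Next (V c) (Undecided.gap u) z
      follow-next-move c u u′ i ¬n (left _ a _) q v = move a (follow-prev c u u′ i ¬n q)
      -- The same move in y made from x + y has the opposite winner, although z and x are both
      -- non-integers.
      follow-next-move c u u′ (intValue _ _ o) ¬n (right _ a _) q v = ⊥-elim (nonIntegers-prev⇒⊥ c
        (undecided⇒nonInteger v) (undecided⇒nonInteger u) q
        (o (move-right c {q = nbg-left c (Undecided.isWhite u)} (Undecided.isWhite u) a)))

      follow-next-gray : ∀ c {x y z} .{p} .{q} → (u : Undecided (V c) x) → Undecided (U c) y → IntValue W 0 (node c x y p) →
        ¬ Next (U c) (Undecided.gap u) y → Next W 0 (node c z y q) → Gray (V c) z → Next (V c) (Undecided.gap u) z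
      follow-next-gray c u u′ i ¬n (int j _) g = ⊥-elim (gray≢white (gray-left c g) (int-white _ j))
      follow-next-gray c u u′ i ¬n (lunar (lunar w _)) g = ⊥-elim (gray≢white (gray-left c g) w)
      follow-next-gray c u u′ i ¬n (move a q) g = follow-gray-move c u u′ i ¬n (moves c a) q g

      follow-gray-move : ∀ c {x y z w} .{p} → (u : Undecided (V c) x) → Undecided (U c) y → IntValue W 0 (node c x y p) →
        ¬ Next (U c) (Undecided.gap u) y → Move (V c) (U c) (node c) z y w → Prev W 0 w → Gray (V c) z →
        Next (V c) (Undecided.gap u) z
      follow-gray-move c u u′ i ¬n (left _ a _) q g   = move a (follow-prev c u u′ i ¬n q)
      follow-gray-move c u u′ i ¬n (right wz _ _) q g = ⊥-elim (gray≢white g wz)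

      follow-prev : ∀ c {x y z} .{p} .{q} → (u : Undecided (V c) x) → Undecided (U c) y → IntValue W 0 (node c x y p) →
        ¬ Next (U c) (Undecided.gap u) y → Prev W 0 (node c z y q) → Prev (V c) (Undecided.gap u) z
      follow-prev c u u′ i ¬n (int j) = ⊥-elim (nonInteger-int⇒⊥ c (undecided⇒nonInteger u′) j)
      follow-prev c u u′ i ¬n (gray gW o) = gray (gray-leftᵂ c wy gW)
        λ a → follow-next c u u′ i ¬n (o (move-left c {q = nbg-right c wy} wy a))
        where wy = Undecided.isWhite u′

      -- A label containing the fresh integer owes this to a terminal node or a moon at the end of
      -- the gray chain, not to an integer. The component that moved would then cover every k by the
      -- same move.
      undecided-lunar⇒⊥ : ∀ c {x y} .{p} → Undecided (V c) x → Undecided (U c) y → Lunar W (node c x y p) → ⊥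
      undecided-lunar⇒⊥ c u u′ (lunar _ f) = undecided-fresh⇒⊥ c u u′ (f fresh)

      undecided-fresh⇒⊥ : ∀ c {x y} .{p} → Undecided (V c) x → Undecided (U c) y → Covered W fresh (node c x y p) → ⊥
      undecided-fresh⇒⊥ c u u′ (covered a ins) = undecided-fresh-move⇒⊥ c u u′ (moves c a) ins

      undecided-fresh-move⇒⊥ : ∀ c {x y w} → Undecided (V c) x → Undecided (U c) y →
        Move (V c) (U c) (node c) x y w → Inside W fresh w → ⊥
      undecided-fresh-move⇒⊥ c u u′ (left _ a _) ins =
        Undecided.¬lunar u (lunar (Undecided.isWhite u) λ k → covered a (fresh-inside c u′ ins k))
      undecided-fresh-move⇒⊥ c u u′ (right wx a _) ins =
        Undecided.¬lunar u′ (lunar (Undecided.isWhite u′)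
          λ k → covered a (fresh-inside (flip c) {p = nbg-right (flip c) wx} u ins k))

      fresh-inside : ∀ c {x y} .{p} → Undecided (U c) y → Inside W fresh (node c x y p) → ∀ k → Inside (V c) k x
      fresh-inside c u (int i) k = ⊥-elim (fresh-int i)
      fresh-inside c u (gray gW o) k = gray (gray-leftᵂ c wy gW)
        λ a → fresh-outside c u (o (move-left c {q = nbg-right c wy} wy a)) k
        where wy = Undecided.isWhite u

      fresh-outside : ∀ c {x y} .{p} → Undecided (U c) y → Outside W fresh (node c x y p) → ∀ k → Outside (V c) k x
      fresh-outside c u (int i _) k = ⊥-elim (nonInteger-int⇒⊥ c (undecided⇒nonInteger u) i)
      fresh-outside c u (lunar l@(lunar w _)) k = lunar (undecided-lunar c u l (kind-left c (white-leftᵂ c w)))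
      fresh-outside c u (gray gW a ins) k = fresh-outside-move c u gW (moves c a) ins k

      fresh-outside-move : ∀ c {x y w} .{p} → Undecided (U c) y → Gray W (node c x y p) →
        Move (V c) (U c) (node c) x y w → Inside W fresh w → ∀ k → Outside (V c) k x
      fresh-outside-move c u gW (left wy a _) ins k   = gray (gray-leftᵂ c wy gW) a (fresh-inside c u ins k)
      fresh-outside-move c u gW (right wx _ _) ins k = ⊥-elim (gray≢white gW (white-node c wx (Undecided.isWhite u)))

      undecided-lunar : ∀ c {x y} .{p} → Undecided (U c) y → Lunar W (node c x y p) → Kind (V c) x → Lunar (V c) x
      undecided-lunar c u l (lunar l′)    = l′
      undecided-lunar c u l (int i)       = ⊥-elim (Undecided.¬lunar u
        (sub-lunar (flip c) {p = nbg-right (flip c) (int-white _ i)} l i))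
      undecided-lunar c u l (undecided v) = ⊥-elim (undecided-lunar⇒⊥ c v u l)

    mutual
      -- The option covering the fresh integer starts a gray chain. In x, a terminal end would make
      -- x full. In y, an integer end is a forcing value, and a moon or a terminal end makes y
      -- lunar. Any other end is again a lunar sum of the same kind, with a smaller derivation.
      lunar-undecided⇒⊥ : ∀ c {x y} .{p} → ¬ FullMoon (V c) x → Undecided (U c) y → (∀ {f} → ¬ Forces (U c) f y) →
        Lunar W (node c x y p) → ⊥
      lunar-undecided⇒⊥ c ¬fx u ¬f l@(lunar w _) with kind-left c (white-leftᵂ c w)
      ... | undecided v = undecided-lunar⇒⊥ c v u l
      ... | int i       = Undecided.¬lunar u (sub-lunar (flip c) {p = nbg-right (flip c) (int-white _ i)} l i)
      lunar-undecided⇒⊥ c ¬fx u ¬f (lunar _ f) | lunar lx = lunar-undecided-covered⇒⊥ c ¬fx u ¬f lx (f fresh)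

      lunar-undecided-covered⇒⊥ : ∀ c {x y} .{p} → ¬ FullMoon (V c) x → Undecided (U c) y →
        (∀ {f} → ¬ Forces (U c) f y) → Lunar (V c) x → Covered W fresh (node c x y p) → ⊥
      lunar-undecided-covered⇒⊥ c ¬fx u ¬f lx (covered a ins) with moves c a
      ... | left _ b _  = fresh-left-inside⇒⊥ c (λ n → ¬fx (full b n)) u ¬f ins
      ... | right _ b _ = fresh-right-inside⇒⊥ c ¬fx lx
              (λ all → Undecided.¬lunar u (lunar (Undecided.isWhite u) λ k → covered b (all k)))
              (λ g b′ f → ¬f (forces⁼⇒forces _ b g b′ f)) ins

      fresh-left-inside⇒⊥ : ∀ c {x y} .{p} → ¬ NewMoon (V c) x → Undecided (U c) y → (∀ {f} → ¬ Forces (U c) f y) →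
        Inside W fresh (node c x y p) → ⊥
      fresh-left-inside⇒⊥ c ¬n u ¬f (int i) = fresh-int i
      fresh-left-inside⇒⊥ c {x} ¬n u ¬f (gray gW o) with Finite.option⊎terminal (V c) x
      ... | inj₂ t        = ¬n (new (gray-leftᵂ c (Undecided.isWhite u) gW) λ a → ⊥-elim (t _ a))
      ... | inj₁ (x′ , a) = fresh-left-outside⇒⊥ c
              (λ f → ¬n (new g (Finite.the-option (V c) g a (FullMoon (V c)) f))) u ¬f
              (o (move-left c {q = nbg-right c (Undecided.isWhite u)} (Undecided.isWhite u) a))
        where g = gray-leftᵂ c (Undecided.isWhite u) gW

      fresh-left-outside⇒⊥ : ∀ c {x y} .{p} → ¬ FullMoon (V c) x → Undecided (U c) y → (∀ {f} → ¬ Forces (U c) f y) →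
        Outside W fresh (node c x y p) → ⊥
      fresh-left-outside⇒⊥ c ¬fx u ¬f (int i _)  = nonInteger-int⇒⊥ c (undecided⇒nonInteger u) i
      fresh-left-outside⇒⊥ c ¬fx u ¬f (lunar l)  = lunar-undecided⇒⊥ c ¬fx u ¬f l
      fresh-left-outside⇒⊥ c ¬fx u ¬f (gray gW a ins) with moves c a
      ... | left _ b _   = fresh-left-inside⇒⊥ c (λ n → ¬fx (full b n)) u ¬f ins
      ... | right wx _ _ = gray≢white gW (white-node c wx (Undecided.isWhite u))

      fresh-right-inside⇒⊥ : ∀ c {x y} .{p} → ¬ FullMoon (V c) x → Lunar (V c) x → ¬ (∀ k → Inside (U c) k y) →
        (∀ {f y′} → Gray (U c) y → Digraph._⟶_ (U c) y y′ → ¬ Forces⁼ (U c) f y′) → Inside W fresh (node c x y p) → ⊥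
      fresh-right-inside⇒⊥ c ¬fx lx ¬all ¬f (int i) = fresh-int i
      fresh-right-inside⇒⊥ c {y = y} ¬fx lx@(lunar wx _) ¬all ¬f (gray gW o) with Finite.option⊎terminal (U c) y
      ... | inj₂ t        = ¬all λ k → gray (gray-rightᵂ c wx gW) λ a → ⊥-elim (t _ a)
      ... | inj₁ (y′ , a) = fresh-right-outside⇒⊥ c ¬fx lx
              (λ all → ¬all λ k → gray g (Finite.the-option (U c) g a (Outside (U c) k) (all k)))
              (λ f → ¬f g a f) (o (move-right c {q = nbg-left c wx} wx a))
        where g = gray-rightᵂ c wx gW

      fresh-right-outside⇒⊥ : ∀ c {x y} .{p} → ¬ FullMoon (V c) x → Lunar (V c) x → ¬ (∀ k → Outside (U c) k y) →
        (∀ {f} → ¬ Forces⁼ (U c) f y) → Outside W fresh (node c x y p) → ⊥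
      fresh-right-outside⇒⊥ c ¬fx lx ¬all ¬f (int i _) with _ , _ , j , _ ← split-int c i = int∧lunar⇒⊥ _ j lx
      fresh-right-outside⇒⊥ c ¬fx lx ¬all ¬f (lunar l) with kind-right c (white-rightᵂ c (lunar-white _ l))
      ... | int i       = ¬f (inj₁ i)
      ... | lunar l′    = ¬all λ k → lunar l′
      ... | undecided u = lunar-undecided⇒⊥ c ¬fx u (λ f → ¬f (inj₂ f)) l
      fresh-right-outside⇒⊥ c ¬fx lx@(lunar wx _) ¬all ¬f (gray gW a ins) with moves c a
      ... | left wy _ _ = gray≢white gW (white-node c wx wy)
      ... | right _ b _ = fresh-right-inside⇒⊥ c ¬fx lx (λ all → ¬all λ k → gray (gray-rightᵂ c wx gW) b (all k))
              (λ g b′ f → ¬f (inj₂ (forces⁼⇒forces _ b g b′ f))) ins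

    -- Forcing and direct values

    forces+int : ∀ c {a b k x y} .{p} → NimSum a b k → Forces (V c) a x → IntValue (U c) b y →
      Forces W k (node c x y p)
    forces+int c s (here a g a′ i) j = here (move-left c {q = q} wy a) (gray-left c g)
      (move-left c {q = nbg-right c wy} wy a′) (add-int c s i j)
      where
      wy = int-white _ j
      q = nbg-right c wy
    forces+int c s (later a g a′ f) j = later (move-left c {q = q} wy a) (gray-left c g)
      (move-left c {q = nbg-right c wy} wy a′) (forces+int c s f j)
      where
      wy = int-white _ j
      q = nbg-right c wy

    -- The forcing sequence of x is played out to its integer, then that of y beside this integer.
    forces+forces : ∀ c {a b k x y} .{p} → NimSum a b k → Forces (V c) a x → Forces (U c) b y → White (U c) y →
      Forces W k (node c x y p)
    forces+forces c s (here a g a′ i) f′ wy = later (move-left c {q = q} wy a) (gray-left c g)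
      (move-left c {q = nbg-right c wy} wy a′)
      (forces+int (flip c) {p = nbg-right (flip c) (int-white _ i)} (swap-nimSum s) f′ i)
      where q = nbg-right c wy
    forces+forces c s (later a g a′ f) f′ wy = later (move-left c {q = q} wy a) (gray-left c g)
      (move-left c {q = nbg-right c wy} wy a′) (forces+forces c s f f′ wy)
      where q = nbg-right c wy

    -- A move to a gray node and the reply to it lie in one component, because the gray component
    -- blocks the other.
    data GrayMoves (c : SumOf) (x : Node (V c)) (y : Node (U c)) : Node W → Set where
      left  : ∀ {x′ x″} → Digraph._⟶_ (V c) x x′ → Gray (V c) x′ → Digraph._⟶_ (V c) x′ x″ → White (U c) y →
              .(q : NBG c x″ y) → GrayMoves c x y (node c x″ y q)
      right : ∀ {y′ y″} → Digraph._⟶_ (U c) y y′ → Gray (U c) y′ → Digraph._⟶_ (U c) y′ y″ → White (V c) x →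
              .(q : NBG c x y″) → GrayMoves c x y (node c x y″ q)

    gray-moves : ∀ c {x y w w′} .{p} → Digraph._⟶_ W (node c x y p) w → Gray W w → Digraph._⟶_ W w w′ →
      GrayMoves c x y w′
    gray-moves c a gW a′ with moves c a
    gray-moves c a gW a′ | left wy b _ with moves c a′
    ... | left _ b′ q  = left b (gray-leftᵂ c wy gW) b′ wy q
    ... | right wx _ _ = ⊥-elim (gray≢white gW (white-node c wx wy))
    gray-moves c a gW a′ | right wx b _ with moves c a′
    ... | right _ b′ q = right b (gray-rightᵂ c wx gW) b′ wx q
    ... | left wy _ _  = ⊥-elim (gray≢white gW (white-node c wx wy))

    split-forces : ∀ c {k x y} .{p} → Forces W k (node c x y p) →
      ∃[ a ] ∃[ b ] Forces⁼ (V c) a x × Forces⁼ (U c) b y × NimSum a b k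
    split-forces c (here a gW a′ i) with gray-moves c a gW a′
    ... | left b g b′ _ _ with m , n , j , j′ , s ← split-int c i =
          m , n , inj₂ (here b g b′ j) , inj₁ j′ , s
    ... | right b g b′ _ _ with m , n , j , j′ , s ← split-int c i =
          m , n , inj₁ j , inj₂ (here b g b′ j′) , s
    split-forces c (later a gW a′ f) with gray-moves c a gW a′
    ... | left b g b′ _ _ with m , n , j , j′ , s ← split-forces c f =
          m , n , inj₂ (forces⁼⇒forces _ b g b′ j) , j′ , s
    ... | right b g b′ _ _ with m , n , j , j′ , s ← split-forces c f =
          m , n , j , inj₂ (forces⁼⇒forces _ b g b′ j′) , s

    directs+int : ∀ c {a b k x y} .{p} → NimSum a b k → Directs (V c) a x → IntValue (U c) b y →
      Directs W k (node c x y p)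
    directs+int c s (via-white a i) j =
      via-white (move-left c {q = nbg-right c (int-white _ j)} (int-white _ j) a) (add-int c s i j)
    directs+int c s (via-gray a g o) j =
      via-gray (move-left c {q = nbg-right c (int-white _ j)} (int-white _ j) a) (gray-left c g)
        (on-left c g (Directs W _) λ a′ _ → directs+int c s (o a′) j)

    -- The forcing sequence of y is played out before the direct value of x is used; a gray option
    -- with a single reply meets the condition on all replies.
    directs+forces : ∀ c {a b k x y} .{p} → NimSum a b k → Directs (V c) a x → Forces (U c) b y → White (V c) x →
      Directs W k (node c x y p)
    directs+forces c s d (here a g a′ i) wx = via-gray (move-right c {q = q} wx a) gW
      (Finite.the-option W gW (move-right c {q = nbg-left c wx} wx a′) (Directs W _) (directs+int c s d i))
      where
      q = nbg-left c wx
      gW = gray-right c {p = q} g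
    directs+forces c s d (later a g a′ f) wx = via-gray (move-right c {q = q} wx a) gW
      (Finite.the-option W gW (move-right c {q = nbg-left c wx} wx a′) (Directs W _) (directs+forces c s d f wx))
      where
      q = nbg-left c wx
      gW = gray-right c {p = q} g

    -- The hypotheses are chosen to pass through an exchange of two moves in either component, where
    -- x may become gray; being outside every j takes the place of being lunar. They rule out
    -- terminal gray options, at which every direct value holds vacuously.
    split-directs : ∀ c {k x y} .{p} → Directs W k (node c x y p) → (∀ {a} → ¬ Forces (V c) a x) →
      ¬ (∀ j → Outside (V c) j x) → (∀ {n} → ¬ IntValue (V c) n x) → ¬ FullMoon (U c) y →
      ∃[ a ] ∃[ b ] Directs (V c) a x × Forces⁼ (U c) b y × NimSum a b k
    split-directs c (via-white a i) ¬f ¬out ¬i ¬fy with moves c a | i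
    ... | left _ b _  | i with m , n , j , j′ , s ← split-int c i = m , n , via-white b j , inj₁ j′ , s
    ... | right _ _ _ | i with m , n , j , j′ , s ← split-int c i = ⊥-elim (¬i j)
    split-directs c (via-gray a gW o) ¬f ¬out ¬i ¬fy with moves c a
    split-directs c (via-gray a gW o) ¬f ¬out ¬i ¬fy | left {x′} wy b _ with Finite.option⊎terminal (V c) x′
    ... | inj₂ t = ⊥-elim (¬out (inside-all⇒outside-all _ b λ k → gray (gray-leftᵂ c wy gW) λ b′ → ⊥-elim (t _ b′)))
    ... | inj₁ (x″ , b′) with m , n , d , f , s ← split-directs c (o (move-left c {q = nbg-right c wy} wy b′))
              (λ f → ¬f (later b (gray-leftᵂ c wy gW) b′ f))
              (λ out → ¬out (inside-all⇒outside-all _ b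
                λ k → gray (gray-leftᵂ c wy gW) (Finite.the-option (V c) (gray-leftᵂ c wy gW) b′ (Outside (V c) k) (out k))))
              (λ i → ¬f (here b (gray-leftᵂ c wy gW) b′ i)) ¬fy =
            m , n , via-gray b (gray-leftᵂ c wy gW)
              (Finite.the-option (V c) (gray-leftᵂ c wy gW) b′ (Directs (V c) m) d) , f , s
    split-directs c (via-gray a gW o) ¬f ¬out ¬i ¬fy | right {y′} wx b _ with Finite.option⊎terminal (U c) y′
    ... | inj₂ t = ⊥-elim (¬fy (full b (new (gray-rightᵂ c wx gW) λ b′ → ⊥-elim (t _ b′))))
    ... | inj₁ (y″ , b′) with m , n , d , f , s ← split-directs c (o (move-right c {q = nbg-left c wx} wx b′)) ¬f ¬out ¬i
              (λ fy → ¬fy (full b (new (gray-rightᵂ c wx gW)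
                (Finite.the-option (U c) (gray-rightᵂ c wx gW) b′ (FullMoon (U c)) fy)))) =
            m , n , d , inj₂ (forces⁼⇒forces _ b (gray-rightᵂ c wx gW) b′ f) , s

-- Subscripts and Grundy values

Sums : Pred ℕ 0ℓ → Pred ℕ 0ℓ → Pred ℕ 0ℓ
Sums S T k = ∃[ a ] ∃[ b ] S a × T b × NimSum a b k

sums-cong : ∀ {S S′ T T′} → S ≐ S′ → T ≐ T′ → Sums S T ≐ Sums S′ T′
sums-cong (f , f′) (g , g′) =
  (λ (a , b , s , t , n) → a , b , f s , g t , n) , λ (a , b , s , t , n) → a , b , f′ s , g′ t , n

sums-⊕ˢ : ∀ {S T} → Sums S T ≐ S ⊕ˢ T
sums-⊕ˢ = (λ (a , b , s , t , nimSum e) → a , b , s , t , sym e) , λ (a , b , s , t , e) → a , b , s , t , nimSum (sym e)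

sums-⊕ˢ-swap : ∀ {S T} → Sums S T ≐ T ⊕ˢ S
sums-⊕ˢ-swap {S} {T} = ≐-trans
  ((λ (a , b , s , t , n) → b , a , t , s , swap-nimSum n) , λ (b , a , t , s , n) → a , b , s , t , swap-nimSum n)
  (sums-⊕ˢ {T} {S})

sums-｛｝ˡ : ∀ {n T} → Sums ｛ n ｝ T ≐ n ⊕ᵐ T
sums-｛｝ˡ = (λ { (_ , b , refl , t , nimSum e) → b , t , sym e }) , λ (b , t , e) → _ , b , refl , t , nimSum (sym e)

sums-｛｝ʳ : ∀ {S n} → Sums S ｛ n ｝ ≐ n ⊕ᵐ S
sums-｛｝ʳ {S} {n} = ≐-trans
  ((λ (a , b , s , t , n) → b , a , t , s , swap-nimSum n) , λ (b , a , t , s , n) → a , b , s , t , swap-nimSum n)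
  (sums-｛｝ˡ {n} {S})

sums-｛｝ : ∀ {m n} → Sums ｛ m ｝ ｛ n ｝ ≐ ｛ m ⊕ n ｝
sums-｛｝ = (λ { (_ , _ , refl , refl , nimSum e) → e }) , λ { refl → _ , _ , refl , refl , nimSum refl }

sums-∅ˡ : ∀ {T} → Sums ∅ T ≐ ∅
sums-∅ˡ = (λ ()) , λ ()

sums-∅ʳ : ∀ {S} → Sums S ∅ ≐ ∅
sums-∅ʳ = (λ ()) , λ ()

module Reading (V : Digraph) where
  private module V = Digraph V

  ForcesSet DirectsSet : Node V → Pred ℕ 0ℓ
  ForcesSet x k  = Forces⁼ V k x
  DirectsSet x k = Directs V k x

  Unlabelled : Node V → Set
  Unlabelled x = (∀ {n} → ¬ IntValue V n x) × ¬ Lunar V x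

  -- Grundy values expressed by outcomes alone, so that the table can be proved without any
  -- labelling.
  data Reads (x : Node V) : Value → Set₁ where
    full : FullMoon V x → Reads x Full
    int  : ∀ {n} → IntValue V n x → Reads x (int n)
    moon : ∀ {F} → Lunar V x → ¬ FullMoon V x → ForcesSet x ≐ F → Reads x Moon[ F ]
    nym  : ∀ {f} → Unlabelled x → ForcesSet x ≐ ｛ f ｝ → Reads x (Nym f)
    inf  : ∀ {D} → Unlabelled x → ForcesSet x ≐ ∅ → DirectsSet x ≐ D → Reads x ∞[ D ]

  int-set : ∀ {n x} → IntValue V n x → ForcesSet x ≐ ｛ n ｝
  int-set i = (λ f → sym (int∧forces⁼⇒≡ V i f)) , λ { refl → inj₁ i }

  nonInt-set : ∀ {x L} → Labels.Solution V L → (∀ {n} → ¬ IntValue V n x) → Algorithm.𝐅 V L x ≐ ForcesSet x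
  nonInt-set solution ¬i = (λ f → inj₂ (forces⁺ f)) , [ (λ i → ⊥-elim (¬i i)) , forces⁻ ]′
    where open Labels.Solution solution

  directsSet : ∀ {x L} → Labels.Solution V L → Algorithm.𝐃 V L x ≐ DirectsSet x
  directsSet solution = directs⁺ , directs⁻
    where open Labels.Solution solution

  module _ {L x} (solution : Labels.Solution V L) (w : White V x) where
    open Labels.Solution solution

    readsAs⇒reads : ∀ {v} → ReadsAs {V} L x v → Reads x v
    readsAs⇒reads (full e) = full (label-describes w e)
    readsAs⇒reads (int e)  = int (label-describes w e)
    readsAs⇒reads (moon e s) with l , ¬f ← label-describes w e =
      moon l ¬f (≐-trans (≐-sym (nonInt-set solution λ i → int∧lunar⇒⊥ V i l)) s)
    readsAs⇒reads (nym e s) with u ← label-describes w e =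
      nym (Undecided.¬int u , Undecided.¬lunar u) (≐-trans (≐-sym (nonInt-set solution (Undecided.¬int u))) s)
    readsAs⇒reads (inf e s d) with u ← label-describes w e =
      inf (Undecided.¬int u , Undecided.¬lunar u) (≐-trans (≐-sym (nonInt-set solution (Undecided.¬int u))) s)
        (≐-trans (≐-sym (directsSet solution)) d)

    reads⇒readsAs : ∀ {v} → Reads x v → ReadsAs {V} L x v
    reads⇒readsAs (full f) = full (full-label w f)
    reads⇒readsAs (int i)  = int (int-label i)
    reads⇒readsAs (moon l ¬f s) = moon (moon-label l ¬f) (≐-trans (nonInt-set solution λ i → int∧lunar⇒⊥ V i l) s)
    reads⇒readsAs (nym (¬i , ¬l) s) = nym (undecided-label w ¬i ¬l) (≐-trans (nonInt-set solution ¬i) s)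
    reads⇒readsAs (inf (¬i , ¬l) s d) =
      inf (undecided-label w ¬i ¬l) (≐-trans (nonInt-set solution ¬i) s) (≐-trans (directsSet solution) d)

open Reading

module Table (W : Digraph) (fresh : ℕ) (fresh-int : ∀ {w} → ¬ IntValue W fresh w) where
  open SumTheory W
  open SumOf
  open Converse fresh fresh-int

  undecided-left : ∀ c {x} → White (V c) x → Unlabelled (V c) x → Undecided (V c) x
  undecided-left c w (¬i , ¬l) with kind-left c w
  ... | int i       = ⊥-elim (¬i i)
  ... | lunar l     = ⊥-elim (¬l l)
  ... | undecided u = u

  forcesSet-sum : ∀ c {x y} .{p} → White (V c) x → White (U c) y →
    ForcesSet W (node c x y p) ≐ Sums (ForcesSet (V c) x) (ForcesSet (U c) y)
  forcesSet-sum c {x} {y} {p} wx wy =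
    [ (λ i → let a , b , i′ , j , s = split-int c i in a , b , inj₁ i′ , inj₁ j , s) , split-forces c ]′ , backward
    where
    backward : ∀ {k} → Sums (ForcesSet (V c) x) (ForcesSet (U c) y) k → ForcesSet W (node c x y p) k
    backward (_ , _ , inj₁ i , inj₁ j , s) = inj₁ (add-int c s i j)
    backward (_ , _ , inj₁ i , inj₂ g , s) = inj₂ (forces+int (flip c) {p = nbg-left (flip c) wy} (swap-nimSum s) g i)
    backward (_ , _ , inj₂ f , inj₁ j , s) = inj₂ (forces+int c s f j)
    backward (_ , _ , inj₂ f , inj₂ g , s) = inj₂ (forces+forces c s f g wy)

  directsSet-sum : ∀ c {x y} .{p} → White (V c) x → Unlabelled (V c) x → ForcesSet (V c) x ≐ ∅ → ¬ FullMoon (U c) y →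
    DirectsSet W (node c x y p) ≐ Sums (DirectsSet (V c) x) (ForcesSet (U c) y)
  directsSet-sum c {x} {y} {p} wx (¬i , ¬l) (¬f , _) ¬fy =
    (λ d → split-directs c d (λ f → ¬f (inj₂ f)) ¬out ¬i ¬fy) , backward
    where
    -- For a white node, being outside a single integer already means being an integer or a moon, so
    -- testing 0 is enough.
    ¬out : ¬ (∀ j → Outside (V c) j x)
    ¬out out with out 0
    ... | int i _    = ¬i i
    ... | lunar l    = ¬l l
    ... | gray g _ _ = gray≢white g wx
    backward : ∀ {k} → Sums (DirectsSet (V c) x) (ForcesSet (U c) y) k → DirectsSet W (node c x y p) k
    backward (_ , _ , d , inj₁ j , s) = directs+int c s d j
    backward (_ , _ , d , inj₂ f , s) = directs+forces c s d f wx

  sum-¬full : ∀ c {x y} .{p} → White (U c) y → ¬ FullMoon (V c) x → ¬ FullMoon (U c) y → ¬ FullMoon W (node c x y p)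
  sum-¬full c wy ¬fx ¬fy f = [ ¬fx , ¬fy ]′ (split-full c f wy)

  int⇒¬full : ∀ {V n x} → IntValue V n x → ¬ FullMoon V x
  int⇒¬full i f = int∧lunar⇒⊥ _ i (full⇒lunar _ (int-white _ i) f)

  unlabelled⇒¬full : ∀ {V x} → White V x → Unlabelled V x → ¬ FullMoon V x
  unlabelled⇒¬full w (_ , ¬l) f = ¬l (full⇒lunar _ w f)

  sum-¬int : ∀ c {n x y} .{p} → (∀ {n} → ¬ IntValue (V c) n x) → ¬ IntValue W n (node c x y p)
  sum-¬int c ¬i i = ¬i (proj₁ (proj₂ (proj₂ (split-int c i))))

  unlabelled+int : ∀ c {n x y} .{p} → Unlabelled (V c) x → IntValue (U c) n y → Unlabelled W (node c x y p)
  unlabelled+int c (¬i , ¬l) j = sum-¬int c ¬i , λ l → ¬l (sub-lunar c l j)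

  unlabelled+unlabelled : ∀ c {x y} .{p} → White (V c) x → White (U c) y → Unlabelled (V c) x → Unlabelled (U c) y →
    Unlabelled W (node c x y p)
  unlabelled+unlabelled c wx wy u u′ =
    sum-¬int c (proj₁ u) , undecided-lunar⇒⊥ c (undecided-left c wx u) (undecided-left (flip c) wy u′)

  unlabelled+lunar : ∀ c {x y} .{p} → White (V c) x → White (U c) y → Unlabelled (V c) x → ForcesSet (V c) x ≐ ∅ →
    ¬ FullMoon (U c) y → Unlabelled W (node c x y p)
  unlabelled+lunar c wx wy u (¬f , _) ¬fy = sum-¬int c (proj₁ u) ,
    lunar-undecided⇒⊥ (flip c) {p = nbg-left (flip c) wy} ¬fy (undecided-left c wx u) (λ f → ¬f (inj₂ f))

  forced : ∀ {V f x} → Unlabelled V x → ForcesSet V x ≐ ｛ f ｝ → Forces V f x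
  forced (¬i , _) (_ , g) = [ (λ i → ⊥-elim (¬i i)) , (λ f → f) ]′ (g refl)

  reads-sum : ∀ c {x y v w} .{p} → White (V c) x → White (U c) y → Reads (V c) x v → Reads (U c) y w →
    Reads W (node c x y p) (v ⊞ w)
  reads-sum c {x} {y} {p = p} wx wy = cell
    where
    fl = flip c
    q : NBG fl y x
    q = nbg-left fl wy

    sets : ∀ {S T R} → ForcesSet (V c) x ≐ S → ForcesSet (U c) y ≐ T → Sums S T ≐ R → ForcesSet W (node c x y p) ≐ R
    sets f g e = ≐-trans (forcesSet-sum c wx wy) (≐-trans (sums-cong f g) e)

    directsˡ : ∀ {S T R} → Unlabelled (V c) x → ForcesSet (V c) x ≐ ∅ → DirectsSet (V c) x ≐ S →
      ForcesSet (U c) y ≐ T → ¬ FullMoon (U c) y → Sums S T ≐ R → DirectsSet W (node c x y p) ≐ R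
    directsˡ u f d g ¬fy e = ≐-trans (directsSet-sum c wx u f ¬fy) (≐-trans (sums-cong d g) e)

    directsʳ : ∀ {S T R} → Unlabelled (U c) y → ForcesSet (U c) y ≐ ∅ → DirectsSet (U c) y ≐ T →
      ForcesSet (V c) x ≐ S → ¬ FullMoon (V c) x → Sums T S ≐ R → DirectsSet W (node c x y p) ≐ R
    directsʳ u f d g ¬fx e = ≐-trans (directsSet-sum fl {p = q} wy u f ¬fx) (≐-trans (sums-cong d g) e)

    cell : ∀ {v w} → Reads (V c) x v → Reads (U c) y w → Reads W (node c x y p) (v ⊞ w)
    cell (full f) (full _)     = full (add-full c f wy)
    cell (full f) (int _)      = full (add-full c f wy)
    cell (full f) (moon _ _ _) = full (add-full c f wy)
    cell (full f) (nym _ _)    = full (add-full c f wy)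
    cell (full f) (inf _ _ _)  = full (add-full c f wy)
    cell (int _)      (full f) = full (add-full fl {p = q} f wx)
    cell (moon _ _ _) (full f) = full (add-full fl {p = q} f wx)
    cell (nym _ _)    (full f) = full (add-full fl {p = q} f wx)
    cell (inf _ _ _)  (full f) = full (add-full fl {p = q} f wx)

    cell (int i) (int j) = int (add-int c (⊕-nimSum _ _) i j)
    cell (int i) (moon l ¬f s) = moon (add-lunar fl {p = q} l i) (sum-¬full c wy (int⇒¬full i) ¬f)
      (sets (int-set _ i) s sums-｛｝ˡ)
    cell (int i) (nym u s) = nym (unlabelled+int fl {p = q} u i) (sets (int-set _ i) s sums-｛｝)
    cell (int i) (inf u s d) = inf (unlabelled+int fl {p = q} u i) (sets (int-set _ i) s (sums-∅ʳ {｛ _ ｝}))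
      (directsʳ u s d (int-set _ i) (int⇒¬full i) sums-｛｝ʳ)

    cell (moon l ¬f s) (int j) = moon (add-lunar c l j) (sum-¬full c wy ¬f (int⇒¬full j))
      (sets s (int-set _ j) sums-｛｝ʳ)
    cell (moon l ¬f s) (moon l′ ¬f′ s′) = moon (lunar+lunar c l l′) (sum-¬full c wy ¬f ¬f′) (sets s s′ sums-⊕ˢ)
    cell (moon l ¬f s) (nym u s′) = moon (lunar+forces c l (forced u s′) wy)
      (sum-¬full c wy ¬f (unlabelled⇒¬full wy u)) (sets s s′ sums-｛｝ʳ)
    cell (moon {F} l ¬f s) (inf u s′ d) = inf (unlabelled+lunar fl {p = q} wy wx u s′ ¬f) (sets s s′ (sums-∅ʳ {F}))
      (directsʳ u s′ d s ¬f sums-⊕ˢ-swap)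

    cell (nym u s) (int j) = nym (unlabelled+int c u j) (sets s (int-set _ j) sums-｛｝)
    cell (nym u s) (moon l ¬f s′) = moon (lunar+forces fl {p = q} l (forced u s) wx)
      (sum-¬full c wy (unlabelled⇒¬full wx u) ¬f) (sets s s′ sums-｛｝ˡ)
    cell (nym u s) (nym u′ s′) = nym (unlabelled+unlabelled c wx wy u u′) (sets s s′ sums-｛｝)
    cell (nym u s) (inf u′ s′ d) = inf (unlabelled+unlabelled c wx wy u u′) (sets s s′ (sums-∅ʳ {｛ _ ｝}))
      (directsʳ u′ s′ d s (unlabelled⇒¬full wx u) sums-｛｝ʳ)

    cell (inf u s d) (int j) = inf (unlabelled+int c u j) (sets s (int-set _ j) (sums-∅ˡ {｛ _ ｝}))
      (directsˡ u s d (int-set _ j) (int⇒¬full j) sums-｛｝ʳ)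
    cell (inf u s d) (moon {F} l ¬f s′) = inf (unlabelled+lunar c wx wy u s ¬f) (sets s s′ (sums-∅ˡ {F}))
      (directsˡ u s d s′ ¬f sums-⊕ˢ)
    cell (inf u s d) (nym u′ s′) = inf (unlabelled+unlabelled c wx wy u u′) (sets s s′ (sums-∅ˡ {｛ _ ｝}))
      (directsˡ u s d s′ (unlabelled⇒¬full wy u′) sums-｛｝ʳ)
    cell (inf {D} u s d) (inf u′ s′ d′) = inf (unlabelled+unlabelled c wx wy u u′) (sets s s′ (sums-∅ˡ {∅}))
      (directsˡ u s d s′ (unlabelled⇒¬full wy u′) (sums-∅ʳ {D}))

-- The cartproduct as a sum, and the addition table

module _ (V U : Digraph) where
  open Cartproduct V U

  mix-white : ∀ {c d} → c ≡ white → d ≡ white → mix c d ≡ white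
  mix-white refl refl = refl

  mix-grayˡ : ∀ {c d} → c ≡ gray → mix c d ≡ gray
  mix-grayˡ refl = refl

  mix-grayʳ : ∀ {c d} → d ≡ gray → mix c d ≡ gray
  mix-grayʳ {white} refl = refl
  mix-grayʳ {gray}  refl = refl

  cartproduct-moves : ∀ {x y w} .{p : NotBothGray x y} → Arc (pair x y p) w → SumTheory.Move (V ∗ U) V U pair x y w
  cartproduct-moves {w = pair _ _ q} (inj₁ (a , refl , wy)) = SumTheory.left wy a q
  cartproduct-moves {w = pair _ _ q} (inj₂ (a , refl , wx)) = SumTheory.right wx a q

  cartproduct-sum : ∀ {L L′} → Labels.Solution V L → Labels.Solution U L′ → SumTheory.SumOf (V ∗ U)
  cartproduct-sum solution solution′ = record
    { V = V ; U = U
    ; node            = pair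
    ; white-node      = mix-white
    ; gray-left       = mix-grayˡ
    ; gray-right      = mix-grayʳ
    ; move-left       = λ wy a → inj₁ (a , refl , wy)
    ; move-right      = λ wx a → inj₂ (a , refl , wx)
    ; moves           = λ {_} {_} {_} {p} → cartproduct-moves {p = p}
    ; kind-left       = S.kind
    ; kind-right      = S′.kind
    ; fresh-left      = S.fresh
    ; fresh-right     = S′.fresh
    ; fresh-left-int  = S.fresh-int
    ; fresh-right-int = S′.fresh-int
    }
    where
    module S = Labels.Solution solution
    module S′ = Labels.Solution solution′

theorem2p5 : (V U : Digraph) (x : Digraph.Node V) (y : Digraph.Node U) →
    (wx : Digraph.White V x) (wy : Digraph.White U y) →
    (v w : Value) →
    HasGrundyValue (V , x) v → HasGrundyValue (U , y) w →
    HasGrundyValue (disjunctiveSum (V , x) (U , y) (white⇒notBothGray V U wx)) (v ⊞ w)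
theorem2p5 V U x y wx wy v w (L , final , r) (L′ , final′ , r′) =
  let solution   = Labels.final-solution V final
      solution′  = Labels.final-solution U final′
      L″ , final″ = Labels.final-exists (V ∗ U)
      solution″  = Labels.final-solution (V ∗ U) final″
      open Labels.Solution solution″ using (fresh; fresh-int)
  in L″ , final″ , reads⇒readsAs (V ∗ U) solution″ (mix-white V U wx wy)
       (Table.reads-sum (V ∗ U) fresh fresh-int (cartproduct-sum V U solution solution′) wx wy
         (readsAs⇒reads V solution wx r) (readsAs⇒reads U solution′ wy r′))
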